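{- For all integers $n>m>1$, \[ p(n)^2 - p(n-m)\,p(n+m) > 0. \]
   Context: $p(n)$ denotes the number of integer partitions of $n$. -}

module Defs where

open import Data.Nat using (ℕ; zero; suc; _+_; _*_; _∸_; _≤?_)
open import Data.List using (List; map; filter; upTo)
open import Data.Nat.ListAction using (sum)

-- pk n k = number of integer partitions of n all of whose parts are ≤ k.
-- Standard recursion on the largest allowed part size:
--   pk 0 0 = 1,  pk (suc n) 0 = 0,
--   pk n (suc k) = Σ_{j ≥ 0, j*(suc k) ≤ n} pk (n ∸ j*(suc k)) k
-- (j = multiplicity of the part suc k; j ranges over 0..n).
pk : ℕ → ℕ → ℕ
pk zero    zero    = 1
pk (suc n) zero    = 0
pk n       (suc k) =
  sum (map (λ j → pk (n ∸ j * suc k) k)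
           (filter (λ j → j * suc k ≤? n) (upTo (suc n))))

p : ℕ → ℕ
p n = pk n n

{-# OPTIONS --safe #-}
module Submission where

-- Write r(m) = p(m)/p(m-1).  For n ≥ 27 the quotient p(n)²/(p(n-m)p(n+m)) is a product of factors r(i)/r(j) with
-- 2 ≤ i < j and j ≥ 28, so it is enough that r decreases from r(27) on and that r(i) ≥ r(27) for 2 ≤ i ≤ 26.
--
-- Everything rests on n p(n) = Σ σ(k) p(n-k).  Put a = p(n), b = p(n-1), h(k) = p(n-1-k) and
-- c(k) = p(n-k) b - h(k) a; if r decreases up to n then c ≥ 0 and c(k)/h(k) = b (r(n-k) - r(n)) increases with k.
-- The recurrences for n - 2, …, n + 1 combine to a formula for p(n)² - p(n-1) p(n+1) as a sum over k,
-- and summation by parts makes that sum positive as soon as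
--   Σ_{j<k≤n/4} σ(k) c(k) < a σ(j) h(j)    for 2 ≤ j ≤ n/4,
-- with enough room for the terms k > n/4, which are exponentially small.
-- For small j the left side is at most Σ σ(k) c(k) = a b, and σ(j) h(j) ≥ (j+1) p(n-1-j) is larger.
-- For large j one bounds r(n-k) - r(n) by a multiple of n^(-1/2), and Σ_{k>j} σ(k) h(k) by a multiple
-- of n^(1/2) j h(j), the product of the two constants being less than 1.
-- Both bounds come from A(m) = (p(0) + ⋯ + p(m-1))/p(m): summation by parts shows that A is nondecreasing with
-- increments O(m^(-1/2)), so r(m) - 1 = (1 + A(m-1) - A(m))/A(m) is close to 1/A(m), and the recurrence
-- with Σ_{k≤x} σ(k) ≈ (π²/12) x² pins A(m) between multiples of m^(1/2).
-- The constants work for n ≥ 16384; smaller n are checked from a table of p.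

open import Defs
open import Data.Bool using (Bool; true; false; if_then_else_) renaming (T to IsTrue)
open import Data.Empty using (⊥-elim)
open import Data.List using (List; []; _∷_; _++_; applyUpTo; drop; filter; length; map; replicate; reverse; upTo)
open import Data.List.Properties using (++-assoc; ++-identityʳ; length-++; length-replicate; unfold-reverse; ≡-dec)
open import Data.Nat
open import Data.Nat.Divisibility using (divides)
open import Data.Nat.DivMod
open import Data.Nat.Induction using (<-rec)
open import Data.Nat.ListAction using (sum)
open import Data.Nat.Properties
open import Data.Nat.Tactic.RingSolver using (solve-∀)
open import Data.Product using (∃; _×_; _,_)
open import Data.Sum using (_⊎_; inj₁; inj₂)
open import Data.Unit using (tt)
open import Function using (_∘_; id)
open import Relation.Binary.PropositionalEquality hiding (J; [_])
open import Relation.Nullary using (Dec; yes; no; ¬_)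
open import Relation.Nullary.Decidable using (toWitness; _→-dec_)

-- No asymptotic formula for p is used. The true size of A(m) is (√6/π) m^(1/2), about 0.78 m^(1/2),
-- and every constant for A is a rounding of it: 5/6 from above, 7/10 near n, 13/20 down to about
-- 3n/4, 1/2 down to n/2. The roundings leave room for errors logarithmic in n, which come from sums
-- of floors; these are controlled by s, the integer square root of n, and L with 2^L > n + 1 and 8
-- L ≤ s. The slack is calibrated at s = 128, hence 16384 = 128². Since A is monotone only because
-- the ratios decrease, all these estimates live inside the induction, under the hypothesis `LC n`.
-- The main terms of the combined recurrences cancel, so positivity alone would not be enough. The
-- inequality for the suffix sums therefore carries a surplus; multiplied by 6n, it contributes p(n)
-- p(n-1)² in the end, against a loss of about 6 (p(n) - p(n-1)) p(n-1)² that arises because p(n-1)²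
-- may exceed p(n) p(n-2). As p(n) - p(n-1) is only O(p(n) n^(-1/2)), the surplus wins.

∑ : ℕ → (ℕ → ℕ) → ℕ
∑ zero    f = 0
∑ (suc n) f = ∑ n f + f n

∑-cong : ∀ n {f g : ℕ → ℕ} → (∀ k → k < n → f k ≡ g k) → ∑ n f ≡ ∑ n g
∑-cong zero    e = refl
∑-cong (suc n) e = cong₂ _+_ (∑-cong n λ k k<n → e k (m<n⇒m<1+n k<n)) (e n (n<1+n n))

∑-mono : ∀ n {f g : ℕ → ℕ} → (∀ k → k < n → f k ≤ g k) → ∑ n f ≤ ∑ n g
∑-mono zero    e = z≤n
∑-mono (suc n) e = +-mono-≤ (∑-mono n λ k k<n → e k (m<n⇒m<1+n k<n)) (e n (n<1+n n))

∑-add : ∀ n (f g : ℕ → ℕ) → ∑ n (λ k → f k + g k) ≡ ∑ n f + ∑ n g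
∑-add zero    f g = refl
∑-add (suc n) f g rewrite ∑-add n f g = lem (∑ n f) (∑ n g) (f n) (g n)
  where lem : ∀ a b c d → (a + b) + (c + d) ≡ (a + c) + (b + d)
        lem = solve-∀

∑-scale : ∀ n c (f : ℕ → ℕ) → ∑ n (λ k → c * f k) ≡ c * ∑ n f
∑-scale zero    c f = sym (*-zeroʳ c)
∑-scale (suc n) c f rewrite ∑-scale n c f = sym (*-distribˡ-+ c (∑ n f) (f n))

∑-append : ∀ m n (f : ℕ → ℕ) → ∑ (m + n) f ≡ ∑ m f + ∑ n (λ k → f (m + k))
∑-append m zero    f rewrite +-identityʳ m = sym (+-identityʳ _)
∑-append m (suc n) f rewrite +-suc m n | ∑-append m n f = +-assoc (∑ m f) _ _

∑-head : ∀ n (f : ℕ → ℕ) → ∑ (suc n) f ≡ f 0 + ∑ n (f ∘ suc)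
∑-head n f = ∑-append 1 n f

∑-zero : ∀ n {f : ℕ → ℕ} → (∀ k → k < n → f k ≡ 0) → ∑ n f ≡ 0
∑-zero zero    e = refl
∑-zero (suc n) e = cong₂ _+_ (∑-zero n λ k k<n → e k (m<n⇒m<1+n k<n)) (e n (n<1+n n))

∑-swap : ∀ m n (f : ℕ → ℕ → ℕ) → ∑ m (λ i → ∑ n (f i)) ≡ ∑ n (λ j → ∑ m (λ i → f i j))
∑-swap zero    n f = sym (∑-zero n λ _ _ → refl)
∑-swap (suc m) n f rewrite ∑-swap m n f = sym (∑-add n (λ j → ∑ m (λ i → f i j)) (f m))

∑-const : ∀ n c → ∑ n (λ _ → c) ≡ n * c
∑-const zero    c = refl
∑-const (suc n) c rewrite ∑-const n c = +-comm (n * c) c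

∑-bound : ∀ n {f : ℕ → ℕ} c → (∀ k → k < n → f k ≤ c) → ∑ n f ≤ n * c
∑-bound n c e = ≤-trans (∑-mono n e) (≤-reflexive (∑-const n c))

∑-longer : ∀ {m n} (f : ℕ → ℕ) → m ≤ n → ∑ m f ≤ ∑ n f
∑-longer {m} {n} f m≤n with m≤n⇒∃[o]m+o≡n m≤n
... | o , refl rewrite ∑-append m o f = m≤m+n _ _

∑-extend : ∀ {m n} (f : ℕ → ℕ) → m ≤ n → (∀ k → m ≤ k → k < n → f k ≡ 0) → ∑ n f ≡ ∑ m f
∑-extend {m} f m≤n e with m≤n⇒∃[o]m+o≡n m≤n
... | o , refl rewrite ∑-append m o f
  | ∑-zero o {λ k → f (m + k)} (λ k k<o → e (m + k) (m≤m+n m k) (+-monoʳ-< m k<o)) = +-identityʳ _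

-- Shifts of sequences: multiplication of generating functions by powers of x

infixl 8 _↓_

-- (f ↓ k) n is f (n - k), read as 0 when k > n.
_↓_ : (ℕ → ℕ) → ℕ → ℕ → ℕ
(f ↓ zero)  n       = f n
(f ↓ suc k) zero    = 0
(f ↓ suc k) (suc n) = (f ↓ k) n

↓-+ : ∀ (f : ℕ → ℕ) k n → (f ↓ k) (k + n) ≡ f n
↓-+ f zero    n = refl
↓-+ f (suc k) n = ↓-+ f k n

↓-∸ : ∀ (f : ℕ → ℕ) {k n} → k ≤ n → (f ↓ k) n ≡ f (n ∸ k)
↓-∸ f z≤n       = refl
↓-∸ f (s≤s k≤n) = ↓-∸ f k≤n

↓-< : ∀ (f : ℕ → ℕ) {k n} → n < k → (f ↓ k) n ≡ 0
↓-< f {suc k} {zero}  _         = refl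
↓-< f {suc k} {suc n} (s≤s n<k) = ↓-< f n<k

↓-comp : ∀ (f : ℕ → ℕ) j k n → (f ↓ j ↓ k) n ≡ (f ↓ (k + j)) n
↓-comp f j zero    n       = refl
↓-comp f j (suc k) zero    = refl
↓-comp f j (suc k) (suc n) = ↓-comp f j k n

↓-cong : ∀ {f g : ℕ → ℕ} k n → (∀ i → i ≤ n → f i ≡ g i) → (f ↓ k) n ≡ (g ↓ k) n
↓-cong zero    n       e = e n ≤-refl
↓-cong (suc k) zero    e = refl
↓-cong (suc k) (suc n) e = ↓-cong k n λ i i≤n → e i (m≤n⇒m≤1+n i≤n)

↓-add : ∀ (f g : ℕ → ℕ) k n → ((λ i → f i + g i) ↓ k) n ≡ (f ↓ k) n + (g ↓ k) n
↓-add f g zero    n       = refl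
↓-add f g (suc k) zero    = refl
↓-add f g (suc k) (suc n) = ↓-add f g k n

↓-scale : ∀ c (f : ℕ → ℕ) k n → ((λ i → c * f i) ↓ k) n ≡ c * (f ↓ k) n
↓-scale c f zero    n       = refl
↓-scale c f (suc k) zero    = sym (*-zeroʳ c)
↓-scale c f (suc k) (suc n) = ↓-scale c f k n

↓-∑ : ∀ N (f : ℕ → ℕ → ℕ) k n → ((λ i → ∑ N (λ j → f j i)) ↓ k) n ≡ ∑ N (λ j → (f j ↓ k) n)
↓-∑ N f zero    n       = refl
↓-∑ N f (suc k) zero    = sym (∑-zero N λ _ _ → refl)
↓-∑ N f (suc k) (suc n) = ↓-∑ N f k n

-- Partitions with bounded parts

F : ℕ → ℕ → ℕ
F k n = pk n k

sum-filter : ∀ {P : ℕ → Set} (P? : ∀ j → Dec (P j)) (g f : ℕ → ℕ) N (h : ℕ → ℕ) →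
  (∀ j → P (f j) → g (f j) ≡ h j) → (∀ j → ¬ P (f j) → h j ≡ 0) →
  sum (map g (filter P? (applyUpTo f N))) ≡ ∑ N h
sum-filter P? g f zero    h yes-case no-case = refl
sum-filter P? g f (suc N) h yes-case no-case rewrite ∑-head N h
  with P? (f 0) | sum-filter P? g (f ∘ suc) N (h ∘ suc) (yes-case ∘ suc) (no-case ∘ suc)
... | yes P0 | ih = cong₂ _+_ (yes-case 0 P0) ih
... | no ¬P0 | ih rewrite no-case 0 ¬P0 = ih

F-sum : ∀ k n → F (suc k) n ≡ ∑ (suc n) (λ j → (F k ↓ (j * suc k)) n)
F-sum k n = trans (unfold n) (sum-filter (λ j → j * suc k ≤? n) _ id (suc n) _
    (λ j j≤ → sym (↓-∸ (F k) j≤)) (λ j j≰ → ↓-< (F k) (≰⇒> j≰)))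
  where
  unfold : ∀ n → F (suc k) n ≡ sum (map (λ j → pk (n ∸ j * suc k) k) (filter (λ j → j * suc k ≤? n) (upTo (suc n))))
  unfold zero    = refl
  unfold (suc n) = refl

data Cut (k : ℕ) : ℕ → Set where
  below : ∀ {n} → n < k → Cut k n
  above : ∀ m → Cut k (k + m)

cut : ∀ k n → Cut k n
cut k n with n <? k
... | yes n<k = below n<k
... | no n≮k with m≤n⇒∃[o]m+o≡n (≮⇒≥ n≮k)
... | o , refl = above o

-- Multiplicity 0 of the part k + 1 gives `F k n`; taking one copy away from the other
-- multiplicities gives the same sum at n - (k + 1).
F-rec : ∀ k n → F (suc k) n ≡ F k n + (F (suc k) ↓ suc k) n
F-rec k n = trans (F-sum k n) (trans (∑-head n _) (cong (F k n +_) (rest (cut (suc k) n))))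
  where
  rest : ∀ {n} → Cut (suc k) n → ∑ n (λ j → (F k ↓ (suc k + j * suc k)) n) ≡ (F (suc k) ↓ suc k) n
  rest {n} (below n<k) = trans (∑-zero n λ j _ → ↓-< (F k) (≤-trans n<k (m≤m+n (suc k) _)))
                               (sym (↓-< (F (suc k)) n<k))
  rest (above m) = begin
    ∑ (suc k + m) (λ j → (F k ↓ (suc k + j * suc k)) (suc k + m))
      ≡⟨ ∑-cong (suc k + m) (λ j _ → trans (sym (↓-comp (F k) (j * suc k) (suc k) (suc k + m)))
                                           (↓-+ (F k ↓ (j * suc k)) (suc k) m)) ⟩
    ∑ (suc k + m) (λ j → (F k ↓ (j * suc k)) m)
      ≡⟨ ∑-extend _ (s≤s (m≤n+m m k)) (λ j m<j _ → ↓-< (F k) (≤-trans m<j (m≤m*n j (suc k)))) ⟩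
    ∑ (suc m) (λ j → (F k ↓ (j * suc k)) m)  ≡⟨ F-sum k m ⟨
    F (suc k) m                              ≡⟨ ↓-+ (F (suc k)) (suc k) m ⟨
    (F (suc k) ↓ suc k) (suc k + m)          ∎
    where open ≡-Reasoning

-- 𝕡 is p, kept from unfolding to its defining sums.
abstract
  𝕡 : ℕ → ℕ
  𝕡 = p

  𝕡-def : ∀ n → 𝕡 n ≡ p n
  𝕡-def n = refl

𝕡-0 : 𝕡 0 ≡ 1
𝕡-0 = 𝕡-def 0

𝕡-1 : 𝕡 1 ≡ 1
𝕡-1 = 𝕡-def 1

𝕡-2 : 𝕡 2 ≡ 2
𝕡-2 = 𝕡-def 2

F-stable-step : ∀ {k n} → n ≤ k → F (suc k) n ≡ F k n
F-stable-step {k} {n} n≤k = trans (F-rec k n)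
  (trans (cong (F k n +_) (↓-< (F (suc k)) (s≤s n≤k))) (+-identityʳ _))

F-stable : ∀ {k n} → n ≤ k → F k n ≡ 𝕡 n
F-stable {k} {n} n≤k with m≤n⇒∃[o]m+o≡n n≤k
... | o , refl = go o
  where
  go : ∀ o → F (n + o) n ≡ 𝕡 n
  go zero    = trans (cong (λ k → F k n) (+-identityʳ n)) (sym (𝕡-def n))
  go (suc o) = trans (cong (λ k → F k n) (+-suc n o)) (trans (F-stable-step (m≤m+n n o)) (go o))

-- Mul d (F K) n is the number of occurrences of the part d + 1 in all partitions of n counted by F K n (d < K).
Mul : ℕ → (ℕ → ℕ) → ℕ → ℕ
Mul d f n = ∑ n (λ m → (f ↓ (suc m * suc d)) n)

Mul-longer : ∀ d f {n N} → n ≤ N → ∑ N (λ m → (f ↓ (suc m * suc d)) n) ≡ Mul d f n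
Mul-longer d f n≤N = ∑-extend _ n≤N λ m n≤m _ → ↓-< f (≤-trans (s≤s n≤m) (m≤m*n (suc m) (suc d)))

Mul-cong : ∀ d {f g : ℕ → ℕ} n → (∀ i → i ≤ n → f i ≡ g i) → Mul d f n ≡ Mul d g n
Mul-cong d n e = ∑-cong n λ m _ → ↓-cong (suc m * suc d) n e

Mul-add : ∀ d f g n → Mul d (λ i → f i + g i) n ≡ Mul d f n + Mul d g n
Mul-add d f g n = trans (∑-cong n λ m _ → ↓-add f g (suc m * suc d) n) (∑-add n _ _)

Mul-rec : ∀ d f n → Mul d f n ≡ (f ↓ suc d) n + (Mul d f ↓ suc d) n
Mul-rec d f n with cut (suc d) n
... | below n<d = trans (∑-zero n λ m _ → ↓-< f (≤-trans n<d (m≤m+n (suc d) _)))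
                        (sym (cong₂ _+_ (↓-< f n<d) (↓-< (Mul d f) n<d)))
... | above m = begin
  Mul d f (suc d + m)  ≡⟨ Mul-longer d f (n≤1+n (suc d + m)) ⟨
  ∑ (suc (suc d + m)) (λ j → (f ↓ (suc j * suc d)) (suc d + m))  ≡⟨ ∑-head (suc d + m) _ ⟩
  (f ↓ (1 * suc d)) (suc d + m) + ∑ (suc d + m) (λ j → (f ↓ (suc d + suc j * suc d)) (suc d + m))
    ≡⟨ cong₂ _+_ (cong (λ e → (f ↓ e) (suc d + m)) (*-identityˡ (suc d)))
         (∑-cong (suc d + m) λ j _ → trans (sym (↓-comp f (suc j * suc d) (suc d) (suc d + m)))
                                           (↓-+ (f ↓ (suc j * suc d)) (suc d) m)) ⟩
  (f ↓ suc d) (suc d + m) + ∑ (suc d + m) (λ j → (f ↓ (suc j * suc d)) m)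
    ≡⟨ cong ((f ↓ suc d) (suc d + m) +_) (Mul-longer d f (m≤n+m m (suc d))) ⟩
  (f ↓ suc d) (suc d + m) + Mul d f m
    ≡⟨ cong ((f ↓ suc d) (suc d + m) +_) (↓-+ (Mul d f) (suc d) m) ⟨
  (f ↓ suc d) (suc d + m) + (Mul d f ↓ suc d) (suc d + m)  ∎
  where open ≡-Reasoning

Mul-↓ : ∀ d f c n → Mul d (f ↓ c) n ≡ (Mul d f ↓ c) n
Mul-↓ d f c n with cut c n
... | below n<c = trans (∑-zero n λ m _ → trans (↓-comp f c (suc m * suc d) n)
                          (↓-< f (≤-trans n<c (m≤n+m c (suc m * suc d))))) (sym (↓-< (Mul d f) n<c))
... | above m = begin
  ∑ (c + m) (λ j → (f ↓ c ↓ (suc j * suc d)) (c + m))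
    ≡⟨ ∑-cong (c + m) (λ j _ → trans (↓-comp f c (suc j * suc d) (c + m))
         (trans (cong (λ e → (f ↓ e) (c + m)) (+-comm (suc j * suc d) c))
         (trans (sym (↓-comp f (suc j * suc d) c (c + m))) (↓-+ (f ↓ (suc j * suc d)) c m)))) ⟩
  ∑ (c + m) (λ j → (f ↓ (suc j * suc d)) m)  ≡⟨ Mul-longer d f (m≤n+m m c) ⟩
  Mul d f m              ≡⟨ ↓-+ (Mul d f) c m ⟨
  (Mul d f ↓ c) (c + m)  ∎
  where open ≡-Reasoning

Weight : ℕ → (ℕ → ℕ) → ℕ → ℕ
Weight K f n = ∑ K (λ d → suc d * Mul d f n)

Weight-F-rec : ∀ J K n → Weight J (F (suc K)) n ≡ Weight J (F K) n + (Weight J (F (suc K)) ↓ suc K) n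
Weight-F-rec J K n = begin
  ∑ J (λ d → suc d * Mul d (F (suc K)) n)
    ≡⟨ ∑-cong J (λ d _ → cong (suc d *_) (trans (Mul-cong d n λ i _ → F-rec K i)
         (trans (Mul-add d (F K) (F (suc K) ↓ suc K) n) (cong (Mul d (F K) n +_) (Mul-↓ d (F (suc K)) (suc K) n))))) ⟩
  ∑ J (λ d → suc d * (Mul d (F K) n + (Mul d (F (suc K)) ↓ suc K) n))
    ≡⟨ ∑-cong J (λ d _ → trans (*-distribˡ-+ (suc d) (Mul d (F K) n) _)
         (cong (suc d * Mul d (F K) n +_) (sym (↓-scale (suc d) (Mul d (F (suc K))) (suc K) n)))) ⟩
  ∑ J (λ d → suc d * Mul d (F K) n + ((λ i → suc d * Mul d (F (suc K)) i) ↓ suc K) n)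
    ≡⟨ ∑-add J _ _ ⟩
  Weight J (F K) n + ∑ J (λ d → ((λ i → suc d * Mul d (F (suc K)) i) ↓ suc K) n)
    ≡⟨ cong (Weight J (F K) n +_) (↓-∑ J (λ d i → suc d * Mul d (F (suc K)) i) (suc K) n) ⟨
  Weight J (F K) n + (Weight J (F (suc K)) ↓ suc K) n ∎
  where open ≡-Reasoning

-- Double counting of the total size of all parts in all partitions of n into parts at most K: each
-- partition contributes n, and `Weight` collects the parts by size. Partitions never appear as
-- objects; both sides obey the recursion in K and n that `F-rec` induces.
F-weight : ∀ K n → n * F K n ≡ Weight K (F K) n
F-weight zero    zero    = refl
F-weight zero    (suc n) = *-zeroʳ n
F-weight (suc K) = <-rec _ step
  where
  open ≡-Reasoning
  D = suc K
  expand : ∀ n → Weight D (F D) n ≡ (n * F K n + (Weight K (F D) ↓ D) n) + D * ((F D ↓ D) n + (Mul K (F D) ↓ D) n)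
  expand n = cong₂ _+_ (trans (Weight-F-rec K K n) (cong (_+ (Weight K (F D) ↓ D) n) (sym (F-weight K n))))
                       (cong (D *_) (Mul-rec K (F D) n))
  regroup : ∀ x w d f m r → w + d * m ≡ r * f → (x + w) + d * (f + m) ≡ x + (d + r) * f
  regroup x w d f m r e = trans (lem x w d f m) (trans (cong (λ z → x + (d * f + z)) e)
                                (cong (x +_) (sym (*-distribʳ-+ f d r))))
    where lem : ∀ x w d f m → (x + w) + d * (f + m) ≡ x + (d * f + (w + d * m))
          lem = solve-∀
  step : ∀ n → (∀ {m} → m < n → m * F D m ≡ Weight D (F D) m) → n * F D n ≡ Weight D (F D) n
  step n ih with cut D n
  ... | below n<D = begin
    n * F D n                                ≡⟨ cong (n *_) (F-rec K n) ⟩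
    n * (F K n + (F D ↓ D) n)                ≡⟨ cong (λ z → n * (F K n + z)) (↓-< (F D) n<D) ⟩
    n * (F K n + 0)                          ≡⟨ lem n (F K n) D ⟩
    (n * F K n + 0) + D * (0 + 0)            ≡⟨ cong₂ (λ u v → (n * F K n + u) + D * v) (↓-< (Weight K (F D)) n<D)
                                                 (cong₂ _+_ (↓-< (F D) n<D) (↓-< (Mul K (F D)) n<D)) ⟨
    (n * F K n + (Weight K (F D) ↓ D) n) + D * ((F D ↓ D) n + (Mul K (F D) ↓ D) n) ≡⟨ expand n ⟨
    Weight D (F D) n ∎
    where lem : ∀ n x d → n * (x + 0) ≡ (n * x + 0) + d * (0 + 0)
          lem = solve-∀
  ... | above m = begin
    (D + m) * F D (D + m)                         ≡⟨ cong ((D + m) *_) (F-rec K (D + m)) ⟩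
    (D + m) * (F K (D + m) + (F D ↓ D) (D + m))   ≡⟨ *-distribˡ-+ (D + m) (F K (D + m)) _ ⟩
    (D + m) * F K (D + m) + (D + m) * (F D ↓ D) (D + m)
      ≡⟨ cong (λ z → (D + m) * F K (D + m) + (D + m) * z) (↓-+ (F D) D m) ⟩
    (D + m) * F K (D + m) + (D + m) * F D m
      ≡⟨ regroup ((D + m) * F K (D + m)) (Weight K (F D) m) D (F D m) (Mul K (F D) m) m (sym (ih (m<n+m m (s≤s z≤n)))) ⟨
    ((D + m) * F K (D + m) + Weight K (F D) m) + D * (F D m + Mul K (F D) m)
      ≡⟨ cong₂ (λ u v → ((D + m) * F K (D + m) + u) + D * v) (↓-+ (Weight K (F D)) D m)
           (cong₂ _+_ (↓-+ (F D) D m) (↓-+ (Mul K (F D)) D m)) ⟨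
    ((D + m) * F K (D + m) + (Weight K (F D) ↓ D) (D + m)) + D * ((F D ↓ D) (D + m) + (Mul K (F D) ↓ D) (D + m))
      ≡⟨ expand (D + m) ⟨
    Weight D (F D) (D + m) ∎

-- The divisor sum recurrence

tri : ℕ → ℕ
tri zero    = 0
tri (suc n) = suc n + tri n

tri-double : ∀ n → 2 * tri n ≡ n * n + n
tri-double zero    = refl
tri-double (suc n) = trans (lem n (tri n)) (trans (cong (2 * suc n +_) (tri-double n)) (lem' n))
  where lem : ∀ n t → 2 * (suc n + t) ≡ 2 * suc n + 2 * t
        lem = solve-∀
        lem' : ∀ n → 2 * suc n + (n * n + n) ≡ suc n * suc n + suc n
        lem' = solve-∀

/-step : ∀ x m → (suc x / suc m ≡ x / suc m) ⊎ (suc x / suc m ≡ suc (x / suc m) × suc x ≡ suc (x / suc m) * suc m)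
/-step x m with suc (x % suc m) <? suc m
... | yes r< = inj₁ (trans (/-congˡ {o = suc m} (cong suc (m≡m%n+[m/n]*n x (suc m))))
                    (trans (+-distrib-/-∣ʳ (suc (x % suc m)) {x / suc m * suc m} (divides (x / suc m) refl))
                           (cong₂ _+_ (m<n⇒m/n≡0 r<) (m*n/n≡m (x / suc m) (suc m)))))
... | no r≮ = inj₂ (trans (/-congˡ {o = suc m} sx) (m*n/n≡m (suc (x / suc m)) (suc m)) , sx)
  where
  r≡ : suc (x % suc m) ≡ suc m
  r≡ = ≤-antisym (m%n<n x (suc m)) (≮⇒≥ r≮)
  sx : suc x ≡ suc (x / suc m) * suc m
  sx = trans (cong suc (m≡m%n+[m/n]*n x (suc m))) (cong (_+ x / suc m * suc m) r≡)

/-next : ∀ n m → n < suc (n / suc m) * suc m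
/-next n m = begin-strict
  n                               ≡⟨ m≡m%n+[m/n]*n n (suc m) ⟩
  n % suc m + n / suc m * suc m   <⟨ +-monoˡ-< (n / suc m * suc m) (m%n<n n (suc m)) ⟩
  suc (n / suc m) * suc m         ∎
  where open ≤-Reasoning

-- τ m k is k / (m + 1) if m + 1 divides k, and 0 otherwise.
τ : ℕ → ℕ → ℕ
τ m zero    = 0
τ m (suc x) = tri (suc x / suc m) ∸ tri (x / suc m)

data τ-View (m x : ℕ) : Set where
  skip : τ m (suc x) ≡ 0 → suc x / suc m ≡ x / suc m → τ-View m x
  hit  : τ m (suc x) ≡ suc (x / suc m) → suc x / suc m ≡ suc (x / suc m) →
         suc x ≡ suc (x / suc m) * suc m → τ-View m x

τ-view : ∀ m x → τ-View m x
τ-view m x with /-step x m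
... | inj₁ e = skip (trans (cong (λ z → tri z ∸ tri (x / suc m)) e) (n∸n≡0 (tri (x / suc m)))) e
... | inj₂ (e , f) = hit (trans (cong (λ z → tri z ∸ tri (x / suc m)) e)
                           (m+n∸n≡m (suc (x / suc m)) (tri (x / suc m)))) e f

τ-≤ : ∀ m k → τ m k ≤ k / suc m
τ-≤ m zero = z≤n
τ-≤ m (suc x) with τ-view m x
... | skip t _   = subst (_≤ suc x / suc m) (sym t) z≤n
... | hit t e _  = ≤-reflexive (trans t (sym e))

τ-vanish : ∀ {m k} → k ≤ m → τ m k ≡ 0
τ-vanish {m} {k} k≤m = n≤0⇒n≡0 (subst (τ m k ≤_) (m<n⇒m/n≡0 (s≤s k≤m)) (τ-≤ m k))

-- The sum telescopes, which is the reason for writing `τ` as a difference of values of `tri`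
-- instead of by a divisibility test.
τ-∑ : ∀ m x → ∑ (suc x) (τ m) ≡ tri (x / suc m)
τ-∑ m zero    = sym (cong tri (0/n≡0 (suc m)))
τ-∑ m (suc x) rewrite τ-∑ m x with τ-view m x
... | skip t e  = trans (cong (tri (x / suc m) +_) t) (trans (+-identityʳ _) (cong tri (sym e)))
... | hit t e _ = trans (cong (tri (x / suc m) +_) t) (trans (+-comm (tri (x / suc m)) _) (cong tri (sym e)))

τ-group : ∀ m (g : ℕ → ℕ) x → ∑ (suc x) (λ k → τ m k * g k) ≡ ∑ (x / suc m) (λ d → suc d * g (suc d * suc m))
τ-group m g zero = sym (cong (λ z → ∑ z (λ d → suc d * g (suc d * suc m))) (0/n≡0 (suc m)))
τ-group m g (suc x) rewrite τ-group m g x with τ-view m x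
... | skip t e  = trans (cong (λ z → rest + z * g (suc x)) t)
                  (trans (+-identityʳ rest) (cong (λ z → ∑ z (λ d → suc d * g (suc d * suc m))) (sym e)))
  where rest = ∑ (x / suc m) (λ d → suc d * g (suc d * suc m))
... | hit t e f = trans (cong₂ (λ z y → rest + z * g y) t f)
                        (cong (λ z → ∑ z (λ d → suc d * g (suc d * suc m))) (sym e))
  where rest = ∑ (x / suc m) (λ d → suc d * g (suc d * suc m))

-- The divisor sum, each divisor d of k being reached as the cofactor k / (m + 1).
σ : ℕ → ℕ
σ k = ∑ k (λ m → τ m k)

σ-longer : ∀ {k N} → k ≤ N → ∑ N (λ m → τ m k) ≡ σ k
σ-longer k≤N = ∑-extend _ k≤N λ m k≤m _ → τ-vanish k≤m

-- In `F-weight`, m + 1 copies of a part d + 1 remove k = (m + 1)(d + 1) from n and carry weight d +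
-- 1. Collecting equal k turns the weights into the sum of the divisors of k.
σ-recurrence : ∀ n → n * 𝕡 n ≡ ∑ (suc n) (λ k → σ k * (𝕡 ↓ k) n)
σ-recurrence n = begin
  n * 𝕡 n  ≡⟨ trans (cong (n *_) (𝕡-def n)) (F-weight n n) ⟩
  ∑ n (λ d → suc d * Mul d (F n) n)
    ≡⟨ ∑-cong n (λ d _ → cong (suc d *_) (Mul-cong d n λ i → F-stable)) ⟩
  ∑ n (λ d → suc d * ∑ n (λ m → g (suc m * suc d)))
    ≡⟨ ∑-cong n (λ d _ → ∑-scale n (suc d) _) ⟨
  ∑ n (λ d → ∑ n (λ m → suc d * g (suc m * suc d)))
    ≡⟨ ∑-swap n n _ ⟩
  ∑ n (λ m → ∑ n (λ d → suc d * g (suc m * suc d)))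
    ≡⟨ ∑-cong n (λ m _ → trans (∑-cong n λ d _ → cong (λ z → suc d * g z) (*-comm (suc m) (suc d)))
         (trans (∑-extend _ (m/n≤m n (suc m)) λ d q≤d _ →
                   trans (cong (suc d *_) (↓-< 𝕡 (beyond m d q≤d))) (*-zeroʳ (suc d)))
                (sym (τ-group m g n)))) ⟩
  ∑ n (λ m → ∑ (suc n) (λ k → τ m k * g k))
    ≡⟨ ∑-swap n (suc n) _ ⟩
  ∑ (suc n) (λ k → ∑ n (λ m → τ m k * g k))
    ≡⟨ ∑-cong (suc n) (λ k k≤n → trans (∑-cong n λ m _ → *-comm (τ m k) (g k))
         (trans (∑-scale n (g k) _) (trans (*-comm (g k) _) (cong (_* g k) (σ-longer (s≤s⁻¹ k≤n)))))) ⟩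
  ∑ (suc n) (λ k → σ k * g k) ∎
  where
  open ≡-Reasoning
  g : ℕ → ℕ
  g k = (𝕡 ↓ k) n
  beyond : ∀ m d → n / suc m ≤ d → n < suc d * suc m
  beyond m d q≤d = <-≤-trans (/-next n m) (*-monoˡ-≤ (suc m) (s≤s q≤d))

-- A certificate for x ≤ y: a ≤ b is a combination of hypotheses, d the slack, and the identity is left to the ring solver.
≤-by : ∀ {a b x y} d → a ≤ b → x + b + d ≡ y + a → x ≤ y
≤-by {a} {b} {x} {y} d a≤b e = +-cancelʳ-≤ b x y (begin
  x + b      ≤⟨ m≤m+n (x + b) d ⟩
  x + b + d  ≡⟨ e ⟩
  y + a      ≤⟨ +-monoʳ-≤ y a≤b ⟩
  y + b      ∎)
  where open ≤-Reasoning

-- Bounds for the summatory function of σ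

C : ℕ → ℕ
C x = ∑ (suc x) σ

-- After exchanging the sums, the inner one telescopes. The free upper limit `N` lets `C-short`
-- compare two values of `C` over the same range of m.
C-tri : ∀ {x N} → x ≤ N → C x ≡ ∑ N (λ m → tri (x / suc m))
C-tri {x} {N} x≤N = begin
  ∑ (suc x) σ                          ≡⟨ ∑-cong (suc x) (λ k k≤x → σ-longer (≤-trans (s≤s⁻¹ k≤x) x≤N)) ⟨
  ∑ (suc x) (λ k → ∑ N (λ m → τ m k))  ≡⟨ ∑-swap (suc x) N _ ⟩
  ∑ N (λ m → ∑ (suc x) (τ m))          ≡⟨ ∑-cong N (λ m _ → τ-∑ m x) ⟩
  ∑ N (λ m → tri (x / suc m))          ∎
  where open ≡-Reasoning

C-double : ∀ {x N} → x ≤ N → 2 * C x ≡ ∑ N (λ m → (x / suc m) * (x / suc m)) + ∑ N (λ m → x / suc m)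
C-double {x} {N} x≤N = trans (cong (2 *_) (C-tri x≤N)) (trans (sym (∑-scale N 2 _))
  (trans (∑-cong N λ m _ → tri-double (x / suc m)) (∑-add N _ _)))

-- The block 2^l ≤ m < 2^(l+1) contributes at most 2^l * (x / 2^l) ≤ x.
harmonic : ∀ L x N → N < 2 ^ L → ∑ N (λ m → x / suc m) ≤ x * L
harmonic zero    x zero    _         = z≤n
harmonic zero    x (suc N) (s≤s ())
harmonic (suc L) x N N< with N <? 2 ^ L
... | yes N<′ = ≤-trans (harmonic L x N N<′) (*-monoʳ-≤ x (n≤1+n L))
... | no N≮ with 2 ^ L in eq
...   | zero  = ⊥-elim (<-irrefl (sym eq) (m^n>0 2 L))
...   | suc w with m≤n⇒∃[o]m+o≡n (≤-trans (n≤1+n w) (≮⇒≥ N≮))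
...     | o , refl = begin
  ∑ (w + o) (λ m → x / suc m)                                     ≡⟨ ∑-append w o _ ⟩
  ∑ w (λ m → x / suc m) + ∑ o (λ k → x / suc (w + k))             ≤⟨ +-mono-≤
      (harmonic L x w (subst (w <_) (sym eq) ≤-refl))
      (∑-bound o (x / suc w) λ k _ → /-monoʳ-≤ x (s≤s (m≤m+n w k))) ⟩
  x * L + o * (x / suc w)                                         ≤⟨ +-monoʳ-≤ (x * L) (*-monoˡ-≤ (x / suc w) o≤) ⟩
  x * L + suc w * (x / suc w)                                     ≡⟨ cong (x * L +_) (*-comm (suc w) (x / suc w)) ⟩
  x * L + x / suc w * suc w                                       ≤⟨ +-monoʳ-≤ (x * L) (m/n*n≤m x (suc w)) ⟩
  x * L + x                                                       ≡⟨ +-comm (x * L) x ⟩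
  x + x * L                                                       ≡⟨ *-suc x L ⟨
  x * suc L                                                       ∎
  where
  open ≤-Reasoning
  o≤ : o ≤ suc w
  o≤ = +-cancelˡ-≤ w o (suc w) (≤-trans (s≤s⁻¹ N<) (≤-reflexive (cong (w +_) (+-identityʳ (suc w)))))

-- 1/m² ≤ 2/(2m-1) - 2/(2m+1) telescopes to Σ 1/m² ≤ 5/3.
inverse-squares : ∀ N (y : ℕ → ℕ) a → (∀ m → m < N → y m * (suc m * suc m) ≤ a) → 3 * ∑ N y ≤ 5 * a
inverse-squares zero    y a y≤ = z≤n
inverse-squares (suc N) y a y≤ = *-cancelʳ-≤ (3 * ∑ (suc N) y) (5 * a) (6 * N + 9)
  ⦃ >-nonZero (≤-trans (s≤s z≤n) (m≤n+m 9 (6 * N))) ⦄ (≤-by (18 * a) (*-monoʳ-≤ 3 (tele N y≤)) (lem (∑ (suc N) y) N a))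
  where
  lem : ∀ S N a → 3 * S * (6 * N + 9) + 3 * (a * (10 * N + 9)) + 18 * a ≡ 5 * a * (6 * N + 9) + 3 * (S * (6 * N + 9))
  lem = solve-∀
  tele : ∀ j → (∀ m → m < suc j → y m * (suc m * suc m) ≤ a) → ∑ (suc j) y * (6 * j + 9) ≤ a * (10 * j + 9)
  tele zero    y≤ = ≤-trans (≤-reflexive (sym (lem0 (y 0)))) (*-monoˡ-≤ 9 (y≤ 0 (s≤s z≤n)))
    where lem0 : ∀ u → u * 1 * 9 ≡ (0 + u) * (0 + 9)
          lem0 = solve-∀
  tele (suc j) y≤ = *-cancelʳ-≤ (∑ (suc (suc j)) y * (6 * suc j + 9)) (a * (10 * suc j + 9)) (2 * j + 3)
    ⦃ >-nonZero (≤-trans (s≤s z≤n) (m≤n+m 3 (2 * j))) ⦄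
    (≤-by (3 * y (suc j)) (+-mono-≤ (*-monoˡ-≤ (2 * j + 5) (tele j λ m m< → y≤ m (m<n⇒m<1+n m<))) (*-monoʳ-≤ 12 (y≤ (suc j) ≤-refl)))
      (lem1 (∑ (suc j) y) (y (suc j)) j a))
    where
    lem1 : ∀ S u j a → (S + u) * (6 * (1 + j) + 9) * (2 * j + 3) + (a * (10 * j + 9) * (2 * j + 5) + 12 * a) + 3 * u
      ≡ a * (10 * (1 + j) + 9) * (2 * j + 3) + (S * (6 * j + 9) * (2 * j + 5) + 12 * (u * ((2 + j) * (2 + j))))
    lem1 = solve-∀

/-square : ∀ x m → (x / suc m) * (x / suc m) * (suc m * suc m) ≤ x * x
/-square x m = ≤-trans (≤-reflexive (lem (x / suc m) (suc m))) (*-mono-≤ (m/n*n≤m x (suc m)) (m/n*n≤m x (suc m)))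
  where lem : ∀ u v → u * u * (v * v) ≡ (u * v) * (u * v)
        lem = solve-∀

-- Since 2 tri q = q² + q, the squares are controlled by Σ 1/m² ≤ 5/3 and the linear terms by the
-- harmonic sum. The leading constant 5/6 stands for π²/12 ≈ 0.822.
C-upper : ∀ L x → x < 2 ^ L → 6 * C x ≤ 5 * (x * x) + 3 * (x * L)
C-upper L x x< = begin
  6 * C x        ≡⟨ *-assoc 3 2 (C x) ⟩
  3 * (2 * C x)  ≡⟨ cong (3 *_) (C-double {x} ≤-refl) ⟩
  3 * (∑ x (λ m → (x / suc m) * (x / suc m)) + ∑ x (λ m → x / suc m))  ≡⟨ *-distribˡ-+ 3 (∑ x _) _ ⟩
  3 * ∑ x (λ m → (x / suc m) * (x / suc m)) + 3 * ∑ x (λ m → x / suc m)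
    ≤⟨ +-mono-≤ (inverse-squares x _ (x * x) λ m _ → /-square x m) (*-monoʳ-≤ 3 (harmonic L x x x<)) ⟩
  5 * (x * x) + 3 * (x * L) ∎
  where open ≤-Reasoning

-- A bound for `C M - C j` with leading term (5/6)(M² - j²); subtracting separate upper and lower
-- bounds would spoil the constant. With u = floor(M/m) and v = floor(j/m), u ≤ M/m and j/m < v + 1
-- give u² - (v + 1)² ≤ (M² - j²)/m², and replacing (v + 1)² by v² + v costs only linear terms,
-- which the harmonic sum absorbs.
C-short : ∀ L j M a → j ≤ M → M < 2 ^ L → M * M ≡ j * j + a → 6 * C M ≤ 6 * C j + 5 * a + M * (6 * L + 3)
C-short L j M a j≤M M< M² = begin
  6 * C M                           ≡⟨ *-assoc 3 2 (C M) ⟩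
  3 * (2 * C M)                     ≡⟨ cong (3 *_) (trans (C-double {M} ≤-refl) (sym (∑-add M _ _))) ⟩
  3 * ∑ M (λ m → u m * u m + u m)   ≤⟨ *-monoʳ-≤ 3 (∑-mono M λ m _ → pointwise m) ⟩
  3 * ∑ M (λ m → (v m * v m + v m) + (y m + (2 * u m + 1)))
    ≡⟨ cong (3 *_) (trans (∑-add M _ _) (cong₂ _+_ (∑-add M _ _) (trans (∑-add M _ _)
         (cong (∑ M y +_) (trans (∑-add M _ _) (cong₂ _+_ (∑-scale M 2 u) (∑-const M 1))))))) ⟩
  3 * ((∑ M (λ m → v m * v m) + ∑ M v) + (∑ M y + (2 * ∑ M u + M * 1)))
    ≡⟨ cong (λ z → 3 * (z + (∑ M y + (2 * ∑ M u + M * 1)))) (sym (C-double j≤M)) ⟩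
  3 * (2 * C j + (∑ M y + (2 * ∑ M u + M * 1)))
    ≤⟨ ≤-by 0 (+-mono-≤ (inverse-squares M y a λ m _ → y-bound m) (*-monoʳ-≤ 6 (harmonic L M M M<)))
         (lem (C j) (∑ M y) (∑ M u) M a L) ⟩
  6 * C j + 5 * a + M * (6 * L + 3) ∎
  where
  open ≤-Reasoning
  u v y : ℕ → ℕ
  u m = M / suc m
  v m = j / suc m
  y m = u m * u m ∸ suc (v m) * suc (v m)
  lem : ∀ c y u M a L → 3 * (2 * c + (y + (2 * u + M * 1))) + (5 * a + 6 * (M * L)) + 0
    ≡ 6 * c + 5 * a + M * (6 * L + 3) + (3 * y + 6 * u)
  lem = solve-∀
  y-bound : ∀ m → y m * (suc m * suc m) ≤ a
  y-bound m = begin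
    y m * (suc m * suc m)  ≡⟨ *-distribʳ-∸ (suc m * suc m) (u m * u m) (suc (v m) * suc (v m)) ⟩
    u m * u m * (suc m * suc m) ∸ suc (v m) * suc (v m) * (suc m * suc m)
      ≤⟨ ∸-mono (/-square M m) (≤-trans (*-mono-≤ (<⇒≤ (/-next j m)) (<⇒≤ (/-next j m)))
           (≤-reflexive (lem2 (suc (v m)) (suc m)))) ⟩
    M * M ∸ j * j          ≡⟨ trans (cong (_∸ j * j) M²) (m+n∸m≡n (j * j) a) ⟩
    a                      ∎
    where lem2 : ∀ a b → (a * b) * (a * b) ≡ a * a * (b * b)
          lem2 = solve-∀
  pointwise : ∀ m → u m * u m + u m ≤ (v m * v m + v m) + (y m + (2 * u m + 1))
  pointwise m = ≤-by 0 (+-mono-≤ (m≤n+m∸n (u m * u m) (suc (v m) * suc (v m))) (/-monoˡ-≤ (suc m) j≤M))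
      (lem3 (u m) (v m) (y m))
    where lem3 : ∀ u v y → u * u + u + ((1 + v) * (1 + v) + y + u) + 0 ≡ (v * v + v) + (y + (2 * u + 1)) + (u * u + v)
          lem3 = solve-∀

τ-zero : ∀ k → τ 0 k ≡ k
τ-zero zero    = refl
τ-zero (suc x) = trans (cong₂ (λ a b → tri a ∸ tri b) (n/1≡n (suc x)) (n/1≡n x)) (m+n∸n≡m (suc x) (tri x))

σ-lower : ∀ k → k ≤ σ k
σ-lower zero    = z≤n
σ-lower (suc k) = begin
  suc k        ≡⟨ τ-zero (suc k) ⟨
  τ 0 (suc k)  ≤⟨ m≤m+n _ _ ⟩
  τ 0 (suc k) + ∑ k (λ m → τ (suc m) (suc k))  ≡⟨ ∑-head k _ ⟨
  σ (suc k)    ∎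
  where open ≤-Reasoning

-- The divisors k and 1. This bound is why the later comparisons are normalised by (J + 1) h(J).
σ-lower′ : ∀ k → 2 ≤ k → suc k ≤ σ k
σ-lower′ (suc zero) (s≤s ())
σ-lower′ (suc (suc k)) _ = begin
  suc (2 + k)                                          ≡⟨ +-comm 1 (2 + k) ⟩
  2 + k + 1                                            ≡⟨ cong₂ _+_ (sym (τ-zero (2 + k))) (sym last) ⟩
  τ 0 (2 + k) + τ (suc k) (2 + k)                      ≤⟨ +-monoʳ-≤ (τ 0 (2 + k)) (m≤n+m _ _) ⟩
  τ 0 (2 + k) + ∑ (suc k) (λ m → τ (suc m) (2 + k))    ≡⟨ ∑-head (suc k) _ ⟨
  σ (2 + k)                                            ∎
  where
  open ≤-Reasoning
  last : τ (suc k) (2 + k) ≡ 1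
  last = cong₂ (λ a b → tri a ∸ tri b) (n/n≡1 (2 + k)) (m<n⇒m/n≡0 (n<1+n (suc k)))

σ-upper : ∀ L k → k < 2 ^ L → σ k ≤ k * L
σ-upper L k k< = ≤-trans (∑-mono k λ m _ → τ-≤ m k) (harmonic L k k k<)

-- This is tri u ≥ X (X - m) / (2 m²) without subtraction. It is applied with X = x + 1 and u =
-- floor(x/m), for which the hypothesis is as sharp as possible.
tri-lower : ∀ X u m → X ≤ suc u * m → X * X ≤ tri u * (m * m * 2) + X * m
tri-lower X u m X≤ = begin
  X * X                              ≤⟨ *-monoʳ-≤ X X≤ ⟩
  X * (suc u * m)                    ≡⟨ eq₁ X u m ⟩
  X * (u * m) + X * m                ≤⟨ +-monoˡ-≤ (X * m) (*-monoˡ-≤ (u * m) X≤) ⟩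
  suc u * m * (u * m) + X * m        ≡⟨ cong (_+ X * m) (eq₂ u m) ⟩
  (u * u + u) * (m * m) + X * m      ≡⟨ cong (λ z → z * (m * m) + X * m) (tri-double u) ⟨
  2 * tri u * (m * m) + X * m        ≡⟨ cong (_+ X * m) (eq₃ (tri u) m) ⟩
  tri u * (m * m * 2) + X * m        ∎
  where
  open ≤-Reasoning
  eq₁ : ∀ X u m → X * ((1 + u) * m) ≡ X * (u * m) + X * m
  eq₁ = solve-∀
  eq₂ : ∀ u m → (1 + u) * m * (u * m) ≡ (u * u + u) * (m * m)
  eq₂ = solve-∀
  eq₃ : ∀ t m → 2 * t * (m * m) ≡ t * (m * m * 2)
  eq₃ = solve-∀

-- 266681/176400 is Σ 1/m² for m ≤ 7, just above 3/2.
seven-squares : ∀ X (t : ℕ → ℕ) → (∀ m → X * X ≤ t m * (suc m * suc m * 2) + X * suc m) →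
  X * X * 266681 ≤ ∑ 7 t * 352800 + X * 457380
seven-squares X t one = ≤-by 0 (+-mono-≤ (*-monoˡ-≤ 176400 (one 0)) (+-mono-≤ (*-monoˡ-≤ 44100 (one 1))
    (+-mono-≤ (*-monoˡ-≤ 19600 (one 2)) (+-mono-≤ (*-monoˡ-≤ 11025 (one 3)) (+-mono-≤ (*-monoˡ-≤ 7056 (one 4))
    (+-mono-≤ (*-monoˡ-≤ 4900 (one 5)) (*-monoˡ-≤ 3600 (one 6))))))))
    (big X (t 0) (t 1) (t 2) (t 3) (t 4) (t 5) (t 6))
  where
  big : ∀ X a b c d e f g → X * X * 266681
    + ((a * 2 + X * 1) * 176400 + ((b * 8 + X * 2) * 44100 + ((c * 18 + X * 3) * 19600
    + ((d * 32 + X * 4) * 11025 + ((e * 50 + X * 5) * 7056 + ((f * 72 + X * 6) * 4900 + (g * 98 + X * 7) * 3600)))))) + 0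
    ≡ (0 + a + b + c + d + e + f + g) * 352800 + X * 457380
    + (X * X * 176400 + (X * X * 44100 + (X * X * 19600 + (X * X * 11025 + (X * X * 7056 + (X * X * 4900 + X * X * 3600))))))
  big = solve-∀

-- Only the terms m ≤ 7 are kept. The excess 2081 of 266681 over 264600 = (3/2) · 176400, together
-- with the use of x + 1 in place of x, pays for the linear loss once x ≥ 3.
C-lower-≥3 : ∀ x t → t + 3 ≡ x → x * x * 3 ≤ C x * 4
C-lower-≥3 x t refl = *-cancelʳ-≤ (x * x * 3) (C x * 4) 88200 (begin
  x * x * 3 * 88200      ≤⟨ +-cancelʳ-≤ ((t + 4) * 457380) (x * x * 3 * 88200) (∑ 7 T * 352800)
                              (≤-trans (≤-by (t * 88468 + t * t * 2081 + 55976) (z≤n {0}) (lem t)) collected) ⟩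
  ∑ 7 T * 352800         ≤⟨ *-monoˡ-≤ 352800 S≤ ⟩
  C x * 352800           ≡⟨ lem′ (C x) ⟩
  C x * 4 * 88200        ∎)
  where
  open ≤-Reasoning
  T : ℕ → ℕ
  T m = tri (x / suc m)
  S≤ : ∑ 7 T ≤ C x
  S≤ = ≤-trans (∑-longer {7} {7 + x} T (m≤m+n 7 x)) (≤-reflexive (sym (C-tri (m≤n+m x 7))))
  lem : ∀ t → (t + 3) * (t + 3) * 3 * 88200 + (t + 4) * 457380 + 0 + (t * 88468 + t * t * 2081 + 55976)
    ≡ (t + 4) * (t + 4) * 266681 + 0
  lem = solve-∀
  lem′ : ∀ c → c * 352800 ≡ c * 4 * 88200
  lem′ = solve-∀
  collected : (t + 4) * (t + 4) * 266681 ≤ ∑ 7 T * 352800 + (t + 4) * 457380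
  collected = seven-squares (t + 4) T λ m → tri-lower (t + 4) (x / suc m) (suc m)
    (subst (_≤ suc (x / suc m) * suc m) (sym (+-suc t 3)) (/-next x m))

C-lower : ∀ x → x * x * 3 ≤ C x * 4
C-lower 0 = z≤n
C-lower 1 = s≤s (s≤s (s≤s z≤n))
C-lower 2 = *-monoˡ-≤ 4 {3} {4} (s≤s (s≤s (s≤s z≤n)))
C-lower (suc (suc (suc t))) = C-lower-≥3 (3 + t) t (+-comm t 3)

-- Summation by parts

abel-prefix : ∀ N (u v h : ℕ → ℕ) → (∀ k → h (suc k) ≤ h k) → (∀ i → i ≤ N → ∑ i u ≤ ∑ i v) →
  ∑ N (λ k → u k * h k) ≤ ∑ N (λ k → v k * h k)
abel-prefix N u v h h-dec prefix =
  +-cancelʳ-≤ 0 (∑ N (λ k → u k * h k)) (∑ N (λ k → v k * h k)) (strong N ≤-refl 0 λ _ _ → z≤n)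
  where
  h-antitone : ∀ {j k} → j ≤ k → h k ≤ h j
  h-antitone {j} j≤k with m≤n⇒∃[o]m+o≡n j≤k
  ... | o , refl = go o
    where go : ∀ o → h (j + o) ≤ h j
          go zero    = ≤-reflexive (cong h (+-identityʳ j))
          go (suc o) = ≤-trans (≤-reflexive (cong h (+-suc j o))) (≤-trans (h-dec (j + o)) (go o))
  -- The claim for h - c in place of h, with the c-terms moved across. The induction raises c to the
  -- last value of h, so that the last term drops out.
  strong : ∀ M → M ≤ N → ∀ c → (∀ k → k < M → c ≤ h k) →
    ∑ M (λ k → u k * h k) + c * ∑ M v ≤ ∑ M (λ k → v k * h k) + c * ∑ M u
  strong zero    M≤N c c≤ = ≤-refl
  strong (suc M) M≤N c c≤ with m≤n⇒∃[o]m+o≡n (c≤ M ≤-refl)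
  ... | o , c+o = subst (λ H → ∑ M (λ k → u k * h k) + u M * H + c * ∑ (suc M) v
                             ≤ ∑ M (λ k → v k * h k) + v M * H + c * ∑ (suc M) u) c+o
      (≤-by 0 (+-mono-≤ (strong M (≤-trans (n≤1+n M) M≤N) (c + o) λ k k<M → ≤-trans (≤-reflexive c+o) (h-antitone (<⇒≤ k<M)))
                        (*-monoʳ-≤ o (prefix (suc M) M≤N)))
        (lem (∑ M (λ k → u k * h k)) (∑ M (λ k → v k * h k)) (∑ M u) (∑ M v) (u M) (v M) c o))
    where
    lem : ∀ Uh Vh U V u v c o →
      Uh + u * (c + o) + c * (V + v) + ((Vh + (c + o) * U) + o * (V + v)) + 0
      ≡ Vh + v * (c + o) + c * (U + u) + ((Uh + (c + o) * V) + o * (U + u))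
    lem = solve-∀

-- If x k / h k is nondecreasing, only the suffix sums of the weights against h matter.
abel-suffix : ∀ N (α β h x : ℕ → ℕ) → (∀ k → k < N → 0 < h k) → (∀ k → suc k < N → x k * h (suc k) ≤ x (suc k) * h k) →
  (∀ j o → j + o ≡ N → ∑ o (λ k → β (j + k) * h (j + k)) ≤ ∑ o (λ k → α (j + k) * h (j + k))) →
  ∑ N (λ k → β k * x k) ≤ ∑ N (λ k → α k * x k)
abel-suffix zero    α β h x h-pos x-mono suffix = z≤n
abel-suffix (suc N) α β h x h-pos x-mono suffix with m≤n⇒∃[o]m+o≡n (suffix 0 (suc N) refl)
... | g , eg = *-cancelˡ-≤ (h 0) ⦃ >-nonZero (h-pos 0 (s≤s z≤n)) ⦄ (≤-trans (m≤m+n _ (x 0 * g))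
      (strong N α β h x h-pos x-mono (λ j o e → suffix j o e) g eg))
  where
  -- The surplus g of α over β against h is carried along: against x the surplus is at least g
  -- x(0)/h(0), because x/h is smallest at 0.
  strong : ∀ N (α β h x : ℕ → ℕ) → (∀ k → k < suc N → 0 < h k) → (∀ k → suc k < suc N → x k * h (suc k) ≤ x (suc k) * h k) →
    (∀ j o → j + o ≡ suc N → ∑ o (λ k → β (j + k) * h (j + k)) ≤ ∑ o (λ k → α (j + k) * h (j + k))) →
    ∀ g → ∑ (suc N) (λ k → β k * h k) + g ≡ ∑ (suc N) (λ k → α k * h k) →
    h 0 * ∑ (suc N) (λ k → β k * x k) + x 0 * g ≤ h 0 * ∑ (suc N) (λ k → α k * x k)
  strong zero α β h x h-pos x-mono suffix g e = ≤-by 0 (≤-reflexive (cong (x 0 *_) e)) (lem (h 0) (x 0) (α 0) (β 0) g)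
    where lem : ∀ h x α β g → h * (0 + β * x) + x * g + x * (0 + α * h) + 0 ≡ h * (0 + α * x) + x * (0 + β * h + g)
          lem = solve-∀
  strong (suc N) α β h x h-pos x-mono suffix g e with m≤n⇒∃[o]m+o≡n (suffix 1 (suc N) refl)
  ... | g′ , e′ = ≤-by 0 (+-mono-≤ ih (≤-reflexive (cong (x 0 *_) e″)))
        (trans (cong (λ u → h 0 * u + x 0 * g + (h 0 * A′ + x 0 * (α 0 * h 0 + (Bh′ + g′))) + 0) (∑-head (suc N) (λ k → β k * x k)))
        (trans (lem (h 0) (x 0) (α 0) (β 0) B′ A′ Bh′ g g′) (cong (λ u → h 0 * u + (h 0 * B′ + x 0 * g′ + x 0 * (β 0 * h 0 + Bh′ + g))) (sym (∑-head (suc N) (λ k → α k * x k))))))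
    where
    B′  = ∑ (suc N) (λ k → β (suc k) * x (suc k))
    A′  = ∑ (suc N) (λ k → α (suc k) * x (suc k))
    Bh′ = ∑ (suc N) (λ k → β (suc k) * h (suc k))
    e″ : β 0 * h 0 + Bh′ + g ≡ α 0 * h 0 + (Bh′ + g′)
    e″ = trans (cong (_+ g) (sym (∑-head (suc N) (λ k → β k * h k)))) (trans e
         (trans (∑-head (suc N) (λ k → α k * h k)) (cong (α 0 * h 0 +_) (sym e′))))
    tail-ineq : h 1 * B′ + x 1 * g′ ≤ h 1 * A′
    tail-ineq = strong N (α ∘ suc) (β ∘ suc) (h ∘ suc) (x ∘ suc) (λ k k< → h-pos (suc k) (s≤s k<))
      (λ k k< → x-mono (suc k) (s≤s k<)) (λ j o e → suffix (suc j) o (cong suc e)) g′ e′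
    ih : h 0 * B′ + x 0 * g′ ≤ h 0 * A′
    ih = *-cancelˡ-≤ (h 1) ⦃ >-nonZero (h-pos 1 (s≤s (s≤s z≤n))) ⦄
      (≤-by 0 (+-mono-≤ (*-monoʳ-≤ (h 0) tail-ineq) (*-monoʳ-≤ g′ (x-mono 0 (s≤s (s≤s z≤n)))))
        (lem₁ (h 0) (h 1) (x 0) (x 1) A′ B′ g′))
      where lem₁ : ∀ h0 h1 x0 x1 A B g → h1 * (h0 * B + x0 * g) + (h0 * (h1 * A) + g * (x1 * h0)) + 0
                     ≡ h1 * (h0 * A) + (h0 * (h1 * B + x1 * g) + g * (x0 * h1))
            lem₁ = solve-∀
    lem : ∀ h x α β B A Bh g g′ → h * (β * x + B) + x * g + (h * A + x * (α * h + (Bh + g′))) + 0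
      ≡ h * (α * x + A) + (h * B + x * g′ + x * (β * h + Bh + g))
    lem = solve-∀

-- When the weights α pass β at κ, comparing c k / h k with its value c₀ / H at κ is enough.
abel-crossing : ∀ κ o β (α h c : ℕ → ℕ) c₀ H → 0 < H →
  (∀ k → k < κ → c k * H ≤ c₀ * h k) → (∀ k → k < o → c₀ * h (κ + k) ≤ c (κ + k) * H) →
  (∀ k → k < o → β ≤ α (κ + k)) →
  β * ∑ (κ + o) h ≤ ∑ o (λ k → α (κ + k) * h (κ + k)) →
  β * ∑ (κ + o) c ≤ ∑ (κ + o) (λ k → α k * c k)
abel-crossing κ o β α h c c₀ H H>0 low high β≤α total = *-cancelˡ-≤ H ⦃ >-nonZero H>0 ⦄ (begin
  H * (β * ∑ (κ + o) c)                         ≤⟨ ≤-by 0 (+-mono-≤ (+-mono-≤ lowsum highsum) (*-monoʳ-≤ c₀ total)) identity ⟩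
  H * ∑ o (λ k → α (κ + k) * c (κ + k))         ≤⟨ *-monoʳ-≤ H (m≤n+m _ (∑ κ (λ k → α k * c k))) ⟩
  H * (∑ κ (λ k → α k * c k) + ∑ o (λ k → α (κ + k) * c (κ + k)))  ≡⟨ cong (H *_) (∑-append κ o _) ⟨
  H * ∑ (κ + o) (λ k → α k * c k)               ∎)
  where
  open ≤-Reasoning
  cκ = ∑ κ c
  co = ∑ o (λ k → c (κ + k))
  hκ = ∑ κ h
  ho = ∑ o (λ k → h (κ + k))
  αc = ∑ o (λ k → α (κ + k) * c (κ + k))
  αh = ∑ o (λ k → α (κ + k) * h (κ + k))
  lowsum : β * (H * cκ) ≤ β * (c₀ * hκ)
  lowsum = *-monoʳ-≤ β (begin
    H * cκ                   ≡⟨ ∑-scale κ H c ⟨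
    ∑ κ (λ k → H * c k)      ≤⟨ ∑-mono κ (λ k k<κ → ≤-trans (≤-reflexive (*-comm H (c k))) (low k k<κ)) ⟩
    ∑ κ (λ k → c₀ * h k)     ≡⟨ ∑-scale κ c₀ h ⟩
    c₀ * hκ                  ∎)
  -- This is (α - β)(c H - c₀ h) ≥ 0: from κ on both factors are nonnegative.
  pointwise : ∀ k → k < o → H * β * c (κ + k) + c₀ * (α (κ + k) * h (κ + k)) ≤ H * (α (κ + k) * c (κ + k)) + c₀ * β * h (κ + k)
  pointwise k k<o with m≤n⇒∃[o]m+o≡n (β≤α k k<o)
  ... | e , β+e rewrite sym β+e = ≤-by 0 (*-monoʳ-≤ e (high k k<o)) (lem H β (c (κ + k)) c₀ e (h (κ + k)))
    where lem : ∀ H β c c₀ e h → H * β * c + c₀ * ((β + e) * h) + e * (c * H) + 0 ≡ H * ((β + e) * c) + c₀ * β * h + e * (c₀ * h)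
          lem = solve-∀
  highsum : H * β * co + c₀ * αh ≤ H * αc + c₀ * β * ho
  highsum = begin
    H * β * co + c₀ * αh  ≡⟨ cong₂ _+_ (∑-scale o (H * β) _) (∑-scale o c₀ _) ⟨
    ∑ o (λ k → H * β * c (κ + k)) + ∑ o (λ k → c₀ * (α (κ + k) * h (κ + k)))  ≡⟨ ∑-add o _ _ ⟨
    ∑ o (λ k → H * β * c (κ + k) + c₀ * (α (κ + k) * h (κ + k)))  ≤⟨ ∑-mono o pointwise ⟩
    ∑ o (λ k → H * (α (κ + k) * c (κ + k)) + c₀ * β * h (κ + k))  ≡⟨ ∑-add o _ _ ⟩
    ∑ o (λ k → H * (α (κ + k) * c (κ + k))) + ∑ o (λ k → c₀ * β * h (κ + k))
      ≡⟨ cong₂ _+_ (∑-scale o H _) (∑-scale o (c₀ * β) _) ⟩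
    H * αc + c₀ * β * ho  ∎
  identity : H * (β * ∑ (κ + o) c) + (β * (c₀ * hκ) + (H * αc + c₀ * β * ho) + c₀ * αh) + 0
    ≡ H * αc + (β * (H * cκ) + (H * β * co + c₀ * αh) + c₀ * (β * ∑ (κ + o) h))
  identity = trans (cong (λ z → H * (β * z) + (β * (c₀ * hκ) + (H * αc + c₀ * β * ho) + c₀ * αh) + 0) (∑-append κ o c))
    (trans (lem H β cκ co c₀ hκ ho αc αh)
      (cong (λ z → H * αc + (β * (H * cκ) + (H * β * co + c₀ * αh) + c₀ * (β * z))) (sym (∑-append κ o h))))
    where lem : ∀ H β cκ co c₀ hκ ho αc αh → H * (β * (cκ + co)) + (β * (c₀ * hκ) + (H * αc + c₀ * β * ho) + c₀ * αh) + 0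
                  ≡ H * αc + (β * (H * cκ) + (H * β * co + c₀ * αh) + c₀ * (β * (hκ + ho)))
          lem = solve-∀

-- Monotonicity of p, and the recurrence with σ replaced by linear weights

F-one : ∀ n → F 1 n ≡ 1
F-one zero    = refl
F-one (suc n) = trans (F-rec 0 (suc n)) (F-one n)

F-mono : ∀ k n → F (suc k) n ≤ F (suc k) (suc n)
F-mono zero    n = ≤-reflexive (trans (F-one n) (sym (F-one (suc n))))
F-mono (suc k) = <-rec _ step
  where
  D = 2 + k
  step : ∀ n → (∀ {m} → m < n → F D m ≤ F D (suc m)) → F D n ≤ F D (suc n)
  step n ih = subst₂ _≤_ (sym (F-rec (suc k) n)) (sym (F-rec (suc k) (suc n))) (+-mono-≤ (F-mono k n) (shifted (cut D n) ih))
    where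
    shifted : ∀ {n} → Cut D n → (∀ {m} → m < n → F D m ≤ F D (suc m)) → (F D ↓ D) n ≤ (F D ↓ D) (suc n)
    shifted {n} (below n<D) ih = ≤-trans (≤-reflexive (↓-< (F D) n<D)) z≤n
    shifted (above m)   ih = subst₂ _≤_ (sym (↓-+ (F D) D m))
      (sym (trans (cong (F D ↓ D) (sym (+-suc D m))) (↓-+ (F D) D (suc m)))) (ih (m<n+m m (s≤s z≤n)))

p-mono-step : ∀ n → 𝕡 n ≤ 𝕡 (suc n)
p-mono-step n = subst₂ _≤_ (F-stable (n≤1+n n)) (sym (𝕡-def (suc n))) (F-mono n n)

p-mono : ∀ {m n} → m ≤ n → 𝕡 m ≤ 𝕡 n
p-mono {m} m≤n with m≤n⇒∃[o]m+o≡n m≤n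
... | o , refl = go o
  where go : ∀ o → 𝕡 m ≤ 𝕡 (m + o)
        go zero    = ≤-reflexive (cong 𝕡 (sym (+-identityʳ m)))
        go (suc o) = ≤-trans (go o) (≤-trans (p-mono-step (m + o)) (≤-reflexive (cong 𝕡 (sym (+-suc m o)))))

p-pos : ∀ n → 0 < 𝕡 n
p-pos n = subst (_≤ 𝕡 n) 𝕡-0 (p-mono {0} {n} z≤n)

instance
  p-nonZero : ∀ {n} → NonZero (𝕡 n)
  p-nonZero {n} = >-nonZero (p-pos n)

p↓-antitone : ∀ k n → (𝕡 ↓ suc k) n ≤ (𝕡 ↓ k) n
p↓-antitone zero    zero    = z≤n
p↓-antitone zero    (suc n) = p-mono-step n
p↓-antitone (suc k) zero    = z≤n
p↓-antitone (suc k) (suc n) = p↓-antitone k n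

p↓-≤ : ∀ k n → (𝕡 ↓ k) n ≤ 𝕡 n
p↓-≤ zero    n = ≤-refl
p↓-≤ (suc k) n = ≤-trans (p↓-antitone k n) (p↓-≤ k n)

P : ℕ → ℕ
P m = ∑ m 𝕡

-- `R m` is also the first moment Σ k p(m - 1 - k) (`R-reverse`). A weight linear in k thus turns
-- the recurrence into a combination of `R` and `P`.
R : ℕ → ℕ
R m = ∑ m P

P-reverse : ∀ m → ∑ m (λ k → (𝕡 ↓ suc k) m) ≡ P m
P-reverse zero    = refl
P-reverse (suc m) = trans (∑-head m _) (trans (cong (𝕡 m +_) (P-reverse m)) (+-comm (𝕡 m) (P m)))

R-reverse : ∀ m → ∑ m (λ k → k * (𝕡 ↓ suc k) m) ≡ R m
R-reverse zero    = refl
R-reverse (suc m) = trans (∑-head m _) (trans (∑-add m _ _) (trans (cong₂ _+_ (P-reverse m) (R-reverse m)) (+-comm (P m) (R m))))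

linear-reverse : ∀ m a b → ∑ m (λ k → (a * k + b) * (𝕡 ↓ suc k) m) ≡ a * R m + b * P m
linear-reverse m a b = begin
  ∑ m (λ k → (a * k + b) * (𝕡 ↓ suc k) m)  ≡⟨ ∑-cong m (λ k _ → lem a k b ((𝕡 ↓ suc k) m)) ⟩
  ∑ m (λ k → a * (k * (𝕡 ↓ suc k) m) + b * (𝕡 ↓ suc k) m)  ≡⟨ ∑-add m _ _ ⟩
  ∑ m (λ k → a * (k * (𝕡 ↓ suc k) m)) + ∑ m (λ k → b * (𝕡 ↓ suc k) m)
    ≡⟨ cong₂ _+_ (trans (∑-scale m a _) (cong (a *_) (R-reverse m))) (trans (∑-scale m b _) (cong (b *_) (P-reverse m))) ⟩
  a * R m + b * P m ∎
  where
  open ≡-Reasoning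
  lem : ∀ a k b h → (a * k + b) * h ≡ a * (k * h) + b * h
  lem = solve-∀

∑-linear : ∀ a b i → 2 * ∑ i (λ k → a * k + b) + a * i ≡ a * (i * i) + 2 * (b * i)
∑-linear a b zero    = lem a b
  where lem : ∀ a b → 2 * 0 + a * 0 ≡ a * (0 * 0) + 2 * (b * 0)
        lem = solve-∀
∑-linear a b (suc i) = trans (lem₁ a b i (∑ i (λ k → a * k + b))) (trans (cong (_+ (2 * (a * i) + 2 * b + a)) (∑-linear a b i)) (lem₂ a b i))
  where lem₁ : ∀ a b i S → 2 * (S + (a * i + b)) + a * (1 + i) ≡ 2 * S + a * i + (2 * (a * i) + 2 * b + a)
        lem₁ = solve-∀
        lem₂ : ∀ a b i → a * (i * i) + 2 * (b * i) + (2 * (a * i) + 2 * b + a) ≡ a * ((1 + i) * (1 + i)) + 2 * (b * (1 + i))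
        lem₂ = solve-∀

C-suc : ∀ i → ∑ i (σ ∘ suc) ≡ C i
C-suc i = sym (∑-head i σ)

σ-recurrence′ : ∀ m → m * 𝕡 m ≡ ∑ m (λ k → σ (suc k) * (𝕡 ↓ suc k) m)
σ-recurrence′ m = trans (σ-recurrence m) (∑-head m _)

-- The sum of 10 k + 5 over k < i is exactly 5 i², so `C-upper` says that the prefix sums of 6 σ(k +
-- 1) stay below those of 10 k + 5 + 3 L; as p(m - 1 - k) decreases in k, prefix sums suffice.
p-upper : ∀ L m → m < 2 ^ L → 6 * (m * 𝕡 m) ≤ 10 * R m + (3 * L + 5) * P m
p-upper L m m< = begin
  6 * (m * 𝕡 m)  ≡⟨ cong (6 *_) (σ-recurrence′ m) ⟩
  6 * ∑ m (λ k → σ (suc k) * (𝕡 ↓ suc k) m)  ≡⟨ ∑-scale m 6 _ ⟨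
  ∑ m (λ k → 6 * (σ (suc k) * (𝕡 ↓ suc k) m))  ≡⟨ ∑-cong m (λ k _ → sym (*-assoc 6 (σ (suc k)) _)) ⟩
  ∑ m (λ k → 6 * σ (suc k) * (𝕡 ↓ suc k) m)
    ≤⟨ abel-prefix m _ (λ k → 10 * k + (3 * L + 5)) _ (λ k → p↓-antitone (suc k) m) prefix ⟩
  ∑ m (λ k → (10 * k + (3 * L + 5)) * (𝕡 ↓ suc k) m)  ≡⟨ linear-reverse m 10 (3 * L + 5) ⟩
  10 * R m + (3 * L + 5) * P m ∎
  where
  open ≤-Reasoning
  prefix : ∀ i → i ≤ m → ∑ i (λ k → 6 * σ (suc k)) ≤ ∑ i (λ k → 10 * k + (3 * L + 5))
  prefix i i≤m = *-cancelˡ-≤ 2 (≤-by 0 (+-mono-≤ (*-monoʳ-≤ 2 (C-upper L i (≤-<-trans i≤m m<))) (≤-reflexive (sym (∑-linear 10 (3 * L + 5) i))))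
    (trans (cong (λ z → 2 * z + (2 * (5 * (i * i) + 3 * (i * L)) + (2 * S + 10 * i)) + 0) (trans (∑-scale i 6 _) (cong (6 *_) (C-suc i)))) (lem (C i) S i L)))
    where
    S = ∑ i (λ k → 10 * k + (3 * L + 5))
    lem : ∀ c S i L → 2 * (6 * c) + (2 * (5 * (i * i) + 3 * (i * L)) + (2 * S + 10 * i)) + 0
      ≡ 2 * S + (2 * (6 * c) + (10 * (i * i) + 2 * ((3 * L + 5) * i)))
    lem = solve-∀

p-lower : ∀ m → 6 * R m + 3 * P m ≤ 4 * (m * 𝕡 m)
p-lower m = begin
  6 * R m + 3 * P m                            ≡⟨ linear-reverse m 6 3 ⟨
  ∑ m (λ k → (6 * k + 3) * (𝕡 ↓ suc k) m)      ≤⟨ abel-prefix m _ (λ k → 4 * σ (suc k)) _ (λ k → p↓-antitone (suc k) m) prefix ⟩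
  ∑ m (λ k → 4 * σ (suc k) * (𝕡 ↓ suc k) m)    ≡⟨ ∑-cong m (λ k _ → *-assoc 4 (σ (suc k)) _) ⟩
  ∑ m (λ k → 4 * (σ (suc k) * (𝕡 ↓ suc k) m))  ≡⟨ ∑-scale m 4 _ ⟩
  4 * ∑ m (λ k → σ (suc k) * (𝕡 ↓ suc k) m)    ≡⟨ cong (4 *_) (σ-recurrence′ m) ⟨
  4 * (m * 𝕡 m) ∎
  where
  open ≤-Reasoning
  prefix : ∀ i → i ≤ m → ∑ i (λ k → 6 * k + 3) ≤ ∑ i (λ k → 4 * σ (suc k))
  prefix i _ = *-cancelˡ-≤ 2 (≤-by 0 (+-mono-≤ (*-monoʳ-≤ 2 (C-lower i)) (≤-reflexive (∑-linear 6 3 i)))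
    (trans (lem (∑ i (λ k → 6 * k + 3)) (C i) i)
      (cong (λ z → 2 * z + (2 * (i * i * 3) + (2 * ∑ i (λ k → 6 * k + 3) + 6 * i))) (sym (trans (∑-scale i 4 _) (cong (4 *_) (C-suc i)))))))
    where
    lem : ∀ S c i → 2 * S + (2 * (c * 4) + (6 * (i * i) + 2 * (3 * i))) + 0 ≡ 2 * (4 * c) + (2 * (i * i * 3) + (2 * S + 6 * i))
    lem = solve-∀

∸-sum : ∀ t N → 2 * ∑ N (λ k → t ∸ suc k) ≤ t * t
∸-sum t zero = z≤n
∸-sum zero (suc N) = ≤-reflexive (cong (2 *_) (∑-zero (suc N) λ _ _ → refl))
∸-sum (suc t) (suc N) = begin
  2 * ∑ (suc N) (λ k → t ∸ k)              ≡⟨ cong (2 *_) (∑-head N (λ k → t ∸ k)) ⟩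
  2 * (t + ∑ N (λ k → t ∸ suc k))          ≡⟨ *-distribˡ-+ 2 t _ ⟩
  2 * t + 2 * ∑ N (λ k → t ∸ suc k)        ≤⟨ +-monoʳ-≤ (2 * t) (∸-sum t N) ⟩
  2 * t + t * t                            ≤⟨ ≤-by 1 (z≤n {0}) (lem t) ⟩
  suc t * suc t                            ∎
  where open ≤-Reasoning
        lem : ∀ t → 2 * t + t * t + 0 + 1 ≡ (1 + t) * (1 + t) + 0
        lem = solve-∀

-- From t ≤ σ(k + 1) + max(t - (k + 1), 0): the first part sums to m p(m) by the recurrence, the
-- second to at most t²/2 times p(m). So A(m) ≤ m/t + t/2, a family of lines tangent to (2m)^(1/2).
P-tangent : ∀ t m → 2 * (t * P m) ≤ (2 * m + t * t) * 𝕡 m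
P-tangent t m = begin
  2 * (t * P m)  ≡⟨ cong (λ z → 2 * (t * z)) (P-reverse m) ⟨
  2 * (t * ∑ m h)  ≡⟨ cong (2 *_) (∑-scale m t h) ⟨
  2 * ∑ m (λ k → t * h k)  ≤⟨ *-monoʳ-≤ 2 (∑-mono m λ k _ → pointwise k) ⟩
  2 * ∑ m (λ k → σ (suc k) * h k + 𝕡 m * (t ∸ suc k))
    ≡⟨ cong (2 *_) (trans (∑-add m _ _) (cong₂ _+_ (sym (σ-recurrence′ m)) (∑-scale m (𝕡 m) _))) ⟩
  2 * (m * 𝕡 m + 𝕡 m * ∑ m (λ k → t ∸ suc k))
    ≤⟨ ≤-by 0 (*-monoʳ-≤ (𝕡 m) (∸-sum t m)) (lem m (𝕡 m) (∑ m (λ k → t ∸ suc k)) t) ⟩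
  (2 * m + t * t) * 𝕡 m ∎
  where
  open ≤-Reasoning
  h : ℕ → ℕ
  h k = (𝕡 ↓ suc k) m
  lem : ∀ m pₘ S t → 2 * (m * pₘ + pₘ * S) + pₘ * (t * t) + 0 ≡ (2 * m + t * t) * pₘ + pₘ * (2 * S)
  lem = solve-∀
  pointwise : ∀ k → t * h k ≤ σ (suc k) * h k + 𝕡 m * (t ∸ suc k)
  pointwise k = begin
    t * h k                                  ≤⟨ *-monoˡ-≤ (h k) (m≤n+m∸n t (suc k)) ⟩
    (suc k + (t ∸ suc k)) * h k              ≡⟨ *-distribʳ-+ (h k) (suc k) (t ∸ suc k) ⟩
    suc k * h k + (t ∸ suc k) * h k          ≤⟨ +-mono-≤ (*-monoˡ-≤ (h k) (σ-lower (suc k)))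
                                                (≤-trans (*-monoʳ-≤ (t ∸ suc k) (p↓-≤ (suc k) m)) (≤-reflexive (*-comm (t ∸ suc k) (𝕡 m)))) ⟩
    σ (suc k) * h k + 𝕡 m * (t ∸ suc k)      ∎

-- p(m - k) ≥ 1 in the recurrence, so m p(m) ≥ C m ≥ 3m²/4.
p-linear : ∀ m → 3 * m ≤ 4 * 𝕡 m
p-linear zero = z≤n
p-linear (suc n) = *-cancelˡ-≤ m (begin
  m * (3 * m)      ≡⟨ lem m ⟩
  m * m * 3        ≤⟨ C-lower m ⟩
  C m * 4          ≡⟨ cong (_* 4) (C-suc m) ⟨
  ∑ m (σ ∘ suc) * 4
    ≤⟨ *-monoˡ-≤ 4 (∑-mono m λ k k<m → ≤-trans (≤-reflexive (sym (*-identityʳ _)))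
         (*-monoʳ-≤ (σ (suc k)) (subst (1 ≤_) (sym (↓-∸ 𝕡 k<m)) (p-pos (m ∸ suc k))))) ⟩
  ∑ m (λ k → σ (suc k) * (𝕡 ↓ suc k) m) * 4  ≡⟨ cong (_* 4) (σ-recurrence′ m) ⟨
  m * 𝕡 m * 4      ≡⟨ lem′ m (𝕡 m) ⟩
  m * (4 * 𝕡 m)    ∎)
  where
  open ≤-Reasoning
  m = suc n
  lem : ∀ m → m * (3 * m) ≡ m * m * 3
  lem = solve-∀
  lem′ : ∀ m pₘ → m * pₘ * 4 ≡ m * (4 * pₘ)
  lem′ = solve-∀

-- Tabulating p

-- Division of the generating function of f by 1 - x^(k+1).
geo : ℕ → (ℕ → ℕ) → ℕ → ℕ
geo k f n = ∑ (suc n) (λ j → (f ↓ (j * suc k)) n)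

geo-rec : ∀ k f n → geo k f n ≡ f n + (geo k f ↓ suc k) n
geo-rec k f n = trans (∑-head n _) (cong (f n +_) (rest (cut (suc k) n)))
  where
  rest : ∀ {n} → Cut (suc k) n → ∑ n (λ j → (f ↓ (suc k + j * suc k)) n) ≡ (geo k f ↓ suc k) n
  rest {n} (below n<k) = trans (∑-zero n λ j _ → ↓-< f (≤-trans n<k (m≤m+n (suc k) _))) (sym (↓-< (geo k f) n<k))
  rest (above m) = begin
    ∑ (suc k + m) (λ j → (f ↓ (suc k + j * suc k)) (suc k + m))
      ≡⟨ ∑-cong (suc k + m) (λ j _ → trans (sym (↓-comp f (j * suc k) (suc k) (suc k + m))) (↓-+ (f ↓ (j * suc k)) (suc k) m)) ⟩
    ∑ (suc k + m) (λ j → (f ↓ (j * suc k)) m)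
      ≡⟨ ∑-extend _ (s≤s (m≤n+m m k)) (λ j m<j _ → ↓-< f (≤-trans m<j (m≤m*n j (suc k)))) ⟩
    geo k f m                                  ≡⟨ ↓-+ (geo k f) (suc k) m ⟨
    (geo k f ↓ suc k) (suc k + m)              ∎
    where open ≡-Reasoning

geo-cong : ∀ k {f g : ℕ → ℕ} n → (∀ i → i ≤ n → f i ≡ g i) → geo k f n ≡ geo k g n
geo-cong k n e = ∑-cong (suc n) λ j _ → ↓-cong (j * suc k) n e

geo-add : ∀ k f g n → geo k (λ i → f i + g i) n ≡ geo k f n + geo k g n
geo-add k f g n = trans (∑-cong (suc n) λ j _ → ↓-add f g (j * suc k) n) (∑-add (suc n) _ _)

-- 1 - x^(k+1) is invertible. The commutation laws of `geo` follow from this without rearranging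
-- double sums.
geo-unique : ∀ k (f x : ℕ → ℕ) → (∀ n → x n ≡ f n + (x ↓ suc k) n) → ∀ n → x n ≡ geo k f n
geo-unique k f x eq = <-rec _ step
  where
  step : ∀ n → (∀ {m} → m < n → x m ≡ geo k f m) → x n ≡ geo k f n
  step n ih = trans (eq n) (trans (cong (f n +_) (shifted (cut (suc k) n) ih)) (sym (geo-rec k f n)))
    where
    shifted : ∀ {n} → Cut (suc k) n → (∀ {m} → m < n → x m ≡ geo k f m) → (x ↓ suc k) n ≡ (geo k f ↓ suc k) n
    shifted (below n<k) ih = trans (↓-< x n<k) (sym (↓-< (geo k f) n<k))
    shifted (above m)   ih = trans (↓-+ x (suc k) m) (trans (ih (m<n+m m (s≤s z≤n))) (sym (↓-+ (geo k f) (suc k) m)))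

↓-swap : ∀ (f : ℕ → ℕ) i j n → (f ↓ i ↓ j) n ≡ (f ↓ j ↓ i) n
↓-swap f i j n = trans (↓-comp f i j n) (trans (cong (λ k → (f ↓ k) n) (+-comm j i)) (sym (↓-comp f j i n)))

geo-↓ : ∀ k f c n → geo k (f ↓ c) n ≡ (geo k f ↓ c) n
geo-↓ k f c n = sym (geo-unique k (f ↓ c) (geo k f ↓ c) eq n)
  where
  eq : ∀ n → (geo k f ↓ c) n ≡ (f ↓ c) n + (geo k f ↓ c ↓ suc k) n
  eq n = trans (↓-cong c n λ i _ → geo-rec k f i) (trans (↓-add f (geo k f ↓ suc k) c n) (cong ((f ↓ c) n +_) (↓-swap (geo k f) (suc k) c n)))

geo-comm : ∀ j k f n → geo j (geo k f) n ≡ geo k (geo j f) n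
geo-comm j k f n = sym (geo-unique j (geo k f) (geo k (geo j f)) eq n)
  where
  eq : ∀ n → geo k (geo j f) n ≡ geo k f n + (geo k (geo j f) ↓ suc j) n
  eq n = trans (geo-cong k n λ i _ → geo-rec j f i) (trans (geo-add k f (geo j f ↓ suc j) n) (cong (geo k f n +_) (geo-↓ k (geo j f) (suc j) n)))

-- Division of a generating function by (1 - x)(1 - x²) ⋯ (1 - x^B).
Φ : ℕ → (ℕ → ℕ) → ℕ → ℕ
Φ zero    f = f
Φ (suc B) f = geo B (Φ B f)

Φ-cong : ∀ B {f g : ℕ → ℕ} → (∀ i → f i ≡ g i) → ∀ n → Φ B f n ≡ Φ B g n
Φ-cong zero    e n = e n
Φ-cong (suc B) e n = geo-cong B n λ i _ → Φ-cong B e i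

Φ-add : ∀ B f g n → Φ B (λ i → f i + g i) n ≡ Φ B f n + Φ B g n
Φ-add zero    f g n = refl
Φ-add (suc B) f g n = trans (geo-cong B n λ i _ → Φ-add B f g i) (geo-add B (Φ B f) (Φ B g) n)

Φ-↓ : ∀ B f c n → Φ B (f ↓ c) n ≡ (Φ B f ↓ c) n
Φ-↓ zero    f c n = refl
Φ-↓ (suc B) f c n = trans (geo-cong B n λ i _ → Φ-↓ B f c i) (geo-↓ B (Φ B f) c n)

F-Φ : ∀ k n → F k n ≡ Φ k (F 0) n
F-Φ zero    n = refl
F-Φ (suc k) n = trans (F-sum k n) (geo-cong k n λ i _ → F-Φ k i)

-- The coefficients of 1/((x)_i (x)_B), where (x)_i = (1 - x) ⋯ (1 - x^i). Removing a factor from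
-- either product gives the two recurrences that follow.
G : ℕ → ℕ → ℕ → ℕ
G i B = Φ B (F i)

G-recʳ : ∀ i B n → G i (suc B) n ≡ G i B n + (G i (suc B) ↓ suc B) n
G-recʳ i B n = geo-rec B (Φ B (F i)) n

G-recˡ : ∀ i B n → G (suc i) B n ≡ G i B n + (G (suc i) B ↓ suc i) n
G-recˡ i B n = trans (Φ-cong B (F-rec i) n) (trans (Φ-add B (F i) (F (suc i) ↓ suc i) n) (cong (G i B n +_) (Φ-↓ B (F (suc i)) (suc i) n)))

-- Partitions with i parts above B, and the others at most B.
split-count : ℕ → ℕ → ℕ → ℕ
split-count B N n = ∑ N (λ i → (G i B ↓ (i * suc B)) n)

-- Both sides below count the same series, Σ x^(i(B+1)) / ((x)_i (x)_(B+1)), reduced by either recurrence of G.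
split-count-step : ∀ B N n → n < N → split-count B N n ≡ split-count (suc B) N n
split-count-step B zero n ()
split-count-step B (suc N) n n<N = +-cancelʳ-≡ Z (split-count B (suc N) n) (split-count D (suc N) n) (trans (sym way₁) way₂)
  where
  open ≡-Reasoning
  D = suc B
  Z = ∑ (suc N) (λ i → (G i D ↓ (suc i * D)) n)
  vanish : ∀ (f : ℕ → ℕ) k → suc N ≤ k → (f ↓ k) n ≡ 0
  vanish f k N<k = ↓-< f (≤-trans n<N N<k)
  way₁ : ∑ (suc N) (λ i → (G i D ↓ (i * D)) n) ≡ split-count B (suc N) n + Z
  way₁ = trans (∑-cong (suc N) λ i _ → trans (↓-cong (i * D) n λ m _ → G-recʳ i B m)
           (trans (↓-add (G i B) (G i D ↓ D) (i * D) n) (cong ((G i B ↓ (i * D)) n +_)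
             (trans (↓-comp (G i D) D (i * D) n) (cong (λ k → (G i D ↓ k) n) (+-comm (i * D) D))))))
         (∑-add (suc N) _ _)
  shift-eq : ∀ i → suc i * D + suc i ≡ suc i * suc D
  shift-eq i = trans (+-comm (suc i * D) (suc i)) (sym (*-suc (suc i) D))
  way₂ : ∑ (suc N) (λ i → (G i D ↓ (i * D)) n) ≡ split-count D (suc N) n + Z
  way₂ = begin
    ∑ (suc N) (λ i → (G i D ↓ (i * D)) n)   ≡⟨ ∑-head N _ ⟩
    G 0 D n + ∑ N (λ i → (G (suc i) D ↓ (suc i * D)) n)
      ≡⟨ cong (G 0 D n +_) (trans (∑-cong N λ i _ → trans (↓-cong (suc i * D) n λ m _ → G-recˡ i D m)
           (trans (↓-add (G i D) (G (suc i) D ↓ suc i) (suc i * D) n) (cong ((G i D ↓ (suc i * D)) n +_)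
             (trans (↓-comp (G (suc i) D) (suc i) (suc i * D) n) (cong (λ k → (G (suc i) D ↓ k) n) (shift-eq i))))))
           (∑-add N _ _)) ⟩
    G 0 D n + (∑ N (λ i → (G i D ↓ (suc i * D)) n) + ∑ N (λ i → (G (suc i) D ↓ (suc i * suc D)) n))
      ≡⟨ lem (G 0 D n) _ _ ⟩
    (G 0 D n + ∑ N (λ i → (G (suc i) D ↓ (suc i * suc D)) n)) + (∑ N (λ i → (G i D ↓ (suc i * D)) n) + 0)
      ≡⟨ cong₂ _+_ (∑-head N (λ i → (G i D ↓ (i * suc D)) n)) (cong (∑ N (λ i → (G i D ↓ (suc i * D)) n) +_)
           (vanish (G N D) (suc N * D) (m≤m*n (suc N) D))) ⟨
    split-count D (suc N) n + Z ∎
    where lem : ∀ g x y → g + (x + y) ≡ (g + y) + (x + 0)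
          lem = solve-∀

-- The count does not depend on B, and once B ≥ n no part exceeds B, so that only i = 0 is left.
split-count-p : ∀ B N n → n < N → split-count B N n ≡ 𝕡 n
split-count-p B N n n<N = trans (raise n) (large (n + B) (m≤m+n n B))
  where
  raise : ∀ k → split-count B N n ≡ split-count (k + B) N n
  raise zero    = refl
  raise (suc k) = trans (raise k) (split-count-step (k + B) N n n<N)
  large : ∀ B′ → n ≤ B′ → split-count B′ N n ≡ 𝕡 n
  large B′ n≤B′ = trans (∑-extend {1} {N} _ (≤-trans (s≤s z≤n) n<N) λ i 1≤i _ → ↓-< (G i B′) (≤-trans (s≤s n≤B′) (≤-trans (≤-reflexive (sym (*-identityˡ (suc B′)))) (*-monoˡ-≤ (suc B′) 1≤i))))
    (trans (sym (F-Φ B′ n)) (F-stable n≤B′))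

-- Division by (1 - x^(j+1)) ⋯ (1 - x^(j+i)).
chain : ℕ → ℕ → (ℕ → ℕ) → ℕ → ℕ
chain zero    j f = f
chain (suc i) j f = geo j (chain i (suc j) f)

chain-cong : ∀ i j {f g : ℕ → ℕ} → (∀ m → f m ≡ g m) → ∀ n → chain i j f n ≡ chain i j g n
chain-cong zero    j e n = e n
chain-cong (suc i) j e n = geo-cong j n λ m _ → chain-cong i (suc j) e m

chain-geo : ∀ i j k f n → chain i j (geo k f) n ≡ geo k (chain i j f) n
chain-geo zero    j k f n = refl
chain-geo (suc i) j k f n = trans (geo-cong j n λ m _ → chain-geo i (suc j) k f m) (geo-comm j k (chain i (suc j) f) n)

chain-F : ∀ i j n → chain i j (F j) n ≡ F (i + j) n
chain-F zero    j n = refl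
chain-F (suc i) j n = trans (sym (chain-geo i (suc j) j (F j) n)) (trans (chain-cong i (suc j) (λ m → sym (F-sum j m)) n)
  (trans (chain-F i (suc j) n) (cong (λ k → F k n) (+-suc i j))))

module Table (D : ℕ) where

  -- Horner scheme for Σ x^(i(D+1)) / ((1 - x^(j+1)) ⋯ (1 - x^(j+i))), i ≤ r.
  U : ℕ → ℕ → ℕ → ℕ
  U zero    j n = F 0 n
  U (suc r) j n = F 0 n + (geo j (U r (suc j)) ↓ suc D) n

  U-sum : ∀ r j n → U r j n ≡ ∑ (suc r) (λ i → (chain i j (F 0) ↓ (i * suc D)) n)
  U-sum zero    j n = refl
  U-sum (suc r) j n = sym (trans (∑-head (suc r) _) (cong (F 0 n +_) (begin
    ∑ (suc r) (λ i → (geo j (chain i (suc j) (F 0)) ↓ (suc D + i * suc D)) n)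
      ≡⟨ ∑-cong (suc r) (λ i _ → trans (sym (↓-comp (geo j (chain i (suc j) (F 0))) (i * suc D) (suc D) n))
           (↓-cong (suc D) n λ m _ → sym (geo-↓ j (chain i (suc j) (F 0)) (i * suc D) m))) ⟩
    ∑ (suc r) (λ i → (geo j (chain i (suc j) (F 0) ↓ (i * suc D)) ↓ suc D) n)
      ≡⟨ ↓-∑ (suc r) (λ i → geo j (chain i (suc j) (F 0) ↓ (i * suc D))) (suc D) n ⟨
    ((λ m → ∑ (suc r) (λ i → geo j (chain i (suc j) (F 0) ↓ (i * suc D)) m)) ↓ suc D) n
      ≡⟨ ↓-cong (suc D) n (λ m _ → trans (sym (geo-∑ (suc r) (λ i → chain i (suc j) (F 0) ↓ (i * suc D)) m)) (geo-cong j m λ m′ _ → sym (U-sum r (suc j) m′))) ⟩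
    (geo j (U r (suc j)) ↓ suc D) n ∎)))
    where
    open ≡-Reasoning
    geo-∑ : ∀ N (f : ℕ → ℕ → ℕ) m → geo j (λ m → ∑ N (λ i → f i m)) m ≡ ∑ N (λ i → geo j (f i) m)
    geo-∑ N f m = trans (∑-cong (suc m) λ k _ → ↓-∑ N f (k * suc j) m) (∑-swap (suc m) N _)

  Φ-∑ : ∀ B N (f : ℕ → ℕ → ℕ) n → Φ B (λ m → ∑ N (λ i → f i m)) n ≡ ∑ N (λ i → Φ B (f i) n)
  Φ-∑ B zero    f n = Φ-zero B n
    where Φ-zero : ∀ B n → Φ B (λ _ → 0) n ≡ 0
          Φ-zero zero    n = refl
          Φ-zero (suc B) n = trans (geo-cong B n λ i _ → Φ-zero B i) (∑-zero (suc n) λ k _ → zero-↓ (k * suc B) n)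
            where zero-↓ : ∀ k n → ((λ _ → 0) ↓ k) n ≡ 0
                  zero-↓ zero    n       = refl
                  zero-↓ (suc k) zero    = refl
                  zero-↓ (suc k) (suc n) = zero-↓ k n
  Φ-∑ B (suc N) f n = trans (Φ-add B (λ m → ∑ N (λ i → f i m)) (f N) n) (cong (_+ Φ B (f N) n) (Φ-∑ B N f n))

  -- A partition with more than r parts above D has size at least (r + 1)(D + 1), so r Horner steps
  -- are enough in this range. With D and r both of order n^(1/2), a table of p up to n needs only D
  -- + r linear passes.
  ΦU-p : ∀ r n → n < suc r * suc D → Φ D (U r 0) n ≡ 𝕡 n
  ΦU-p r n n<r = begin
    Φ D (U r 0) n                                           ≡⟨ Φ-cong D (U-sum r 0) n ⟩
    Φ D (λ m → ∑ (suc r) (λ i → (chain i 0 (F 0) ↓ (i * suc D)) m)) n  ≡⟨ Φ-∑ D (suc r) (λ i → chain i 0 (F 0) ↓ (i * suc D)) n ⟩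
    ∑ (suc r) (λ i → Φ D (chain i 0 (F 0) ↓ (i * suc D)) n)
      ≡⟨ ∑-cong (suc r) (λ i _ → trans (Φ-↓ D (chain i 0 (F 0)) (i * suc D) n) (↓-cong (i * suc D) n λ m _ →
           Φ-cong D (λ m′ → trans (chain-F i 0 m′) (cong (λ k → F k m′) (+-identityʳ i))) m)) ⟩
    split-count D (suc r) n
      ≡⟨ ∑-extend _ (m≤m+n (suc r) (suc n)) (λ i r<i _ → ↓-< (G i D) (≤-trans n<r (*-monoˡ-≤ (suc D) r<i))) ⟨
    split-count D (suc r + suc n) n                         ≡⟨ split-count-p D (suc r + suc n) n (m≤n+m (suc n) (suc r)) ⟩
    𝕡 n ∎
    where open ≡-Reasoning

-- The table as lists, and its verification

data Lists (f : ℕ → ℕ) : ℕ → List ℕ → Set where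
  []  : ∀ {n} → Lists f n []
  _∷_ : ∀ {n x xs} → x ≡ f n → Lists f (suc n) xs → Lists f n (x ∷ xs)

lists-++ : ∀ {f : ℕ → ℕ} {n xs ys} → Lists f n xs → Lists f (length xs + n) ys → Lists f n (xs ++ ys)
lists-++ [] ys = ys
lists-++ {f} {n} {_ ∷ xs} {ys} (x ∷ r) q = x ∷ lists-++ r (subst (λ k → Lists f k ys) (sym (+-suc (length xs) n)) q)

lists-replicate : ∀ {f : ℕ → ℕ} {n} k → (∀ i → i < k → f (n + i) ≡ 0) → Lists f n (replicate k 0)
lists-replicate zero    z = []
lists-replicate {f} {n} (suc k) z = sym (trans (cong f (sym (+-identityʳ n))) (z 0 (s≤s z≤n)))
  ∷ lists-replicate k λ i i<k → trans (cong f (sym (+-suc n i))) (z (suc i) (s≤s i<k))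

-- sweep xs front back runs g n = x n + g (n - K); front ++ reverse back is the queue of the last K values of g.
sweep : List ℕ → List ℕ → List ℕ → List ℕ
refill : ℕ → List ℕ → List ℕ → List ℕ
sweep []       _        _  = []
sweep (x ∷ xs) (y ∷ ys) bs = (x + y) ∷ sweep xs ys ((x + y) ∷ bs)
sweep (x ∷ xs) []       bs = refill x xs (reverse bs)
refill x xs []       = []
refill x xs (y ∷ ys) = (x + y) ∷ sweep xs ys ((x + y) ∷ [])

row : ℕ → List ℕ → List ℕ
row k xs = sweep xs (replicate (suc k) 0) []

module _ (k : ℕ) (f : ℕ → ℕ) where
  private
    g = geo k f

    push : ∀ {n y} ys {z} → Lists (g ↓ suc k) n (y ∷ ys) → length ys ≡ k → z ≡ g n → Lists (g ↓ suc k) (suc n) (ys ++ (z ∷ []))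
    push {n} ys (_ ∷ r) len e = lists-++ r (trans e (sym (trans (cong (λ l → (g ↓ suc k) (l + suc n)) len) (trans (cong (g ↓ suc k) (+-suc k n)) (↓-+ g (suc k) n)))) ∷ [])

    new-value : ∀ {n x y ys} → x ≡ f n → Lists (g ↓ suc k) n (y ∷ ys) → x + y ≡ g n
    new-value {n} ex (ey ∷ _) = trans (cong₂ _+_ ex ey) (sym (geo-rec k f n))

  -- The invariant: the queue holds k + 1 consecutive values of `g ↓ suc k` beginning at n, so its
  -- head is the summand that `geo-rec` adds to f(n). The initial zeros are the values of g at
  -- negative arguments.
  sweep-lists : ∀ {n} xs ys bs → Lists f n xs → Lists (g ↓ suc k) n (ys ++ reverse bs) → length (ys ++ reverse bs) ≡ suc k →
    Lists g n (sweep xs ys bs)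
  refill-lists : ∀ {n x} xs ys → x ≡ f n → Lists f (suc n) xs → Lists (g ↓ suc k) n ys → length ys ≡ suc k →
    Lists g n (refill x xs ys)
  sweep-lists []       ys       bs _        queue len = []
  sweep-lists (x ∷ xs) (y ∷ ys) bs (ex ∷ r) queue len = new-value ex queue ∷
    sweep-lists xs ys ((x + y) ∷ bs) r (subst (Lists (g ↓ suc k) _) (sym eq) (push (ys ++ reverse bs) queue (suc-injective len) (new-value ex queue)))
      (trans (cong length eq) (trans (length-++ (ys ++ reverse bs)) (trans (+-comm _ 1) len)))
    where
    eq : ys ++ reverse ((x + y) ∷ bs) ≡ (ys ++ reverse bs) ++ ((x + y) ∷ [])
    eq = trans (cong (ys ++_) (unfold-reverse (x + y) bs)) (sym (++-assoc ys (reverse bs) ((x + y) ∷ [])))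
  sweep-lists (x ∷ xs) []       bs (ex ∷ r) queue len = refill-lists xs (reverse bs) ex r queue len
  refill-lists {n} {x} xs (y ∷ ys) ex r queue len = new-value ex queue ∷
    sweep-lists xs ys ((x + y) ∷ []) r (push ys queue (suc-injective len) (new-value ex queue))
      (trans (length-++ ys) (trans (+-comm (length ys) 1) len))
  refill-lists xs [] ex r queue ()

  row-lists : ∀ {xs} → Lists f 0 xs → Lists g 0 (row k xs)
  row-lists {xs} r = sweep-lists xs (replicate (suc k) 0) [] r
    (subst (Lists (g ↓ suc k) 0) (sym (++-identityʳ _)) (lists-replicate (suc k) λ i i<k → ↓-< g i<k))
    (trans (cong length (++-identityʳ (replicate (suc k) 0))) (length-replicate (suc k)))

rows : ℕ → List ℕ → List ℕ
rows zero    xs = xs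
rows (suc k) xs = row k (rows k xs)

rows-lists : ∀ B {f xs} → Lists f 0 xs → Lists (Φ B f) 0 (rows B xs)
rows-lists zero    r = r
rows-lists (suc B) {f} r = row-lists B (Φ B f) (rows-lists B r)

-- Each level is D + 1 entries longer than the one inside it, so the inner passes are short; the
-- outermost list has (r + 1)(D + 1) entries, exactly the range of `ΦU-p`.
horner : ℕ → ℕ → ℕ → List ℕ
horner D zero    j = 1 ∷ replicate D 0
horner D (suc r) j = 1 ∷ (replicate D 0 ++ row j (horner D r (suc j)))

horner-lists : ∀ D r j → Lists (Table.U D r j) 0 (horner D r j)
horner-lists D zero    j = refl ∷ lists-replicate D λ i _ → refl
horner-lists D (suc r) j = refl ∷ lists-++ (lists-replicate D λ i i<D → ↓-< (geo j (Table.U D r (suc j))) (s≤s i<D))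
  (subst (λ m → Lists (Table.U D (suc r) j) m (row j (horner D r (suc j)))) position (tail (row-lists j (Table.U D r (suc j)) (horner-lists D r (suc j)))))
  where
  position : suc D + 0 ≡ length (replicate D 0) + 1
  position = trans (+-identityʳ (suc D)) (trans (+-comm 1 D) (cong (_+ 1) (sym (length-replicate D))))
  tail : ∀ {n xs} → Lists (geo j (Table.U D r (suc j))) n xs → Lists (Table.U D (suc r) j) (suc D + n) xs
  tail [] = []
  tail {n} {x ∷ xs} (e ∷ es) = trans e (sym (↓-+ (geo j (Table.U D r (suc j))) D n)) ∷ subst (λ m → Lists (Table.U D (suc r) j) m xs) (+-suc (suc D) n) (tail es)

lists-drop : ∀ {f : ℕ → ℕ} k {n xs} → Lists f n xs → Lists f (k + n) (drop k xs)
lists-drop zero    r        = r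
lists-drop (suc k) []       = []
lists-drop {f} (suc k) {n} {_ ∷ xs} (_ ∷ r) = subst (λ m → Lists f m (drop k xs)) (+-suc k n) (lists-drop k r)

check : ℕ → ℕ → ℕ → List ℕ → Bool
check zero    x y zs       = true
check (suc i) x y []       = false
check (suc i) x y (z ∷ zs) = if z * x <ᵇ y * y then check i y z zs else false

check-from : ℕ → List ℕ → Bool
check-from i (x ∷ y ∷ zs) = check i x y zs
check-from i _            = false

LogConcaveAt : (ℕ → ℕ) → ℕ → Set
LogConcaveAt f m = f (2 + m) * f m < f (1 + m) * f (1 + m)

check-sound : ∀ (f : ℕ → ℕ) n l {x y} zs → x ≡ f n → y ≡ f (1 + n) → Lists f (2 + n) zs → check l x y zs ≡ true →
  ∀ i → i < l → LogConcaveAt f (n + i)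
check-sound f n (suc l) {x} {y} (z ∷ zs) refl refl (refl ∷ r) ok i i<l with z * x <ᵇ y * y in eq
check-sound f n (suc l) {x} {y} (z ∷ zs) refl refl (refl ∷ r) ok zero i<l | true =
  subst (LogConcaveAt f) (sym (+-identityʳ n)) (<ᵇ⇒< (z * x) (y * y) (subst IsTrue (sym eq) tt))
check-sound f n (suc l) {x} {y} (z ∷ zs) refl refl (refl ∷ r) ok (suc i) (s≤s i<l) | true =
  subst (LogConcaveAt f) (sym (+-suc n i)) (check-sound f (suc n) l zs refl refl r ok i i<l)

check-from-sound : ∀ (f : ℕ → ℕ) n l xs → Lists f n xs → check-from l xs ≡ true → ∀ i → i < l → LogConcaveAt f (n + i)
check-from-sound f n l (x ∷ y ∷ zs) (ex ∷ ey ∷ r) ok = check-sound f n l zs ex ey r ok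

value : List ℕ → ℕ → ℕ
value []       i       = 0
value (x ∷ xs) zero    = x
value (x ∷ xs) (suc i) = value xs i

lists-value : ∀ {f : ℕ → ℕ} {n xs} → Lists f n xs → ∀ i → i < length xs → value xs i ≡ f (n + i)
lists-value {f} {n} (e ∷ r) zero    _         = trans e (cong f (sym (+-identityʳ n)))
lists-value {f} {n} (e ∷ r) (suc i) (s≤s i<l) = trans (lists-value r i i<l) (cong f (sym (+-suc n i)))

table : ℕ → ℕ → List ℕ
table D r = rows D (horner D r 0)

table-lists : ∀ D r → Lists (Φ D (Table.U D r 0)) 0 (table D r)
table-lists D r = rows-lists D (horner-lists D r 0)

-- 56 = (6 + 1)(7 + 1) is the length of `table 7 6`; the cases n < 27 reach only indices below 56.
initial : List ℕ
initial = 1 ∷ 1 ∷ 2 ∷ 3 ∷ 5 ∷ 7 ∷ 11 ∷ 15 ∷ 22 ∷ 30 ∷ 42 ∷ 56 ∷ 77 ∷ 101 ∷ 135 ∷ 176 ∷ 231 ∷ 297 ∷ 385 ∷ 490 ∷ 627 ∷ 792 ∷ 1002 ∷ 1255 ∷ 1575 ∷ 1958 ∷ 2436 ∷ 3010 ∷ 3718 ∷ 4565 ∷ 5604 ∷ 6842 ∷ 8349 ∷ 10143 ∷ 12310 ∷ 14883 ∷ 17977 ∷ 21637 ∷ 26015 ∷ 31185 ∷ 37338 ∷ 44583 ∷ 53174 ∷ 63261 ∷ 75175 ∷ 89134 ∷ 105558 ∷ 124754 ∷ 147273 ∷ 173525 ∷ 204226 ∷ 239943 ∷ 281589 ∷ 329931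 ∷ 386155 ∷ 451276 ∷ []

log-concave-by-table : ∀ D r k l → check-from l (drop k (table D r)) ≡ true → (∀ n → n < k + l + 2 → n < suc r * suc D) →
  ∀ i → i < l → LogConcaveAt 𝕡 (k + i)
log-concave-by-table D r k l ok inside i i<l = subst₂ (λ x y → x < y * y) (cong₂ _*_ (eq (2 + (k + i)) 2≤) (eq (k + i) 0≤)) (eq (1 + (k + i)) 1≤)
  (check-from-sound (Φ D (Table.U D r 0)) k l (drop k (table D r))
    (subst (λ m → Lists (Φ D (Table.U D r 0)) m (drop k (table D r))) (+-identityʳ k) (lists-drop k (table-lists D r))) ok i i<l)
  where
  eq : ∀ n → n < k + l + 2 → Φ D (Table.U D r 0) n ≡ 𝕡 n
  eq n n< = Table.ΦU-p D r n (inside n n<)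
  2≤ : 2 + (k + i) < k + l + 2
  2≤ = ≤-trans (+-monoʳ-< 2 (+-monoʳ-< k i<l)) (≤-reflexive (+-comm 2 (k + l)))
  1≤ : 1 + (k + i) < k + l + 2
  1≤ = <-trans (n<1+n (1 + (k + i))) 2≤
  0≤ : k + i < k + l + 2
  0≤ = <-trans (n<1+n (k + i)) 1≤

initial-by-table : ∀ D r xs → table D r ≡ xs → ∀ i → i < length xs → i < suc r * suc D → value xs i ≡ 𝕡 i
initial-by-table D r xs eq i i<l i< = trans (lists-value (subst (Lists (Φ D (Table.U D r 0)) 0) eq (table-lists D r)) i i<l) (Table.ΦU-p D r i i<)

initial-value : ∀ i → i < 56 → value initial i ≡ 𝕡 i
initial-value i i<56 = initial-by-table 7 6 initial (toWitness {a? = ≡-dec _≟_ (table 7 6) initial} tt) i i<56 i<56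

-- Log-concavity at n = m + 1 for 27 ≤ n ≤ 16383, which meets the range of `large-step`. It needs p
-- up to 16384, and (148 + 1)(110 + 1) = 16539.
large-table-checks : check-from 16357 (drop 26 (table 110 148)) ≡ true
large-table-checks = refl

log-concave-below : ∀ i → i < 16357 → LogConcaveAt 𝕡 (26 + i)
log-concave-below = log-concave-by-table 110 148 26 16357 large-table-checks λ n n< → <-≤-trans n< (m≤m+n 16385 154)

-- A is monotone from the start although the ratios of p are not; here this is read off the values.
A-small : ∀ l → l < 26 → P l * 𝕡 (suc l) ≤ P (suc l) * 𝕡 l
A-small l l<26 = subst₂ _≤_ (cong₂ _*_ (P-eq l (<⇒≤ l<26)) (v (suc l) (s≤s l<26))) (cong₂ _*_ (P-eq (suc l) l<26) (v l (<-trans l<26 (n<1+n 26)))) (toWitness {a? = allUpTo? (λ l → ∑ l (value initial) * value initial (suc l) ≤? ∑ (suc l) (value initial) * value initial l) 26} tt l<26)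
  where
  v : ∀ i → i < 27 → value initial i ≡ 𝕡 i
  v i i< = initial-value i (≤-trans i< (m≤m+n 27 29))
  P-eq : ∀ l → l ≤ 26 → ∑ l (value initial) ≡ P l
  P-eq l l≤ = ∑-cong l λ k k<l → v k (<-trans (≤-trans k<l l≤) (n<1+n 26))

base-ratio : ∀ i → i < 26 → 𝕡 27 * 𝕡 (suc i) ≤ 𝕡 (2 + i) * 𝕡 26
base-ratio i i<26 = subst₂ _≤_ (cong₂ _*_ (initial-value 27 (m≤m+n 28 28)) (initial-value (suc i) (≤-trans (s≤s i<26) (m≤m+n 27 29))))
  (cong₂ _*_ (initial-value (2 + i) (≤-trans (s≤s (s≤s i<26)) (m≤m+n 28 28))) (initial-value 26 (m≤m+n 27 29)))
  (toWitness {a? = allUpTo? (λ i → value initial 27 * value initial (suc i) ≤? value initial (2 + i) * value initial 26) 26} tt i<26)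

small-cases : ∀ {n} → n < 27 → ∀ {m} → m < n → 1 < m → value initial (n ∸ m) * value initial (n + m) < value initial n * value initial n
small-cases = toWitness {a? = allUpTo? (λ n → allUpTo? (λ m → (1 <? m) →-dec (value initial (n ∸ m) * value initial (n + m) <? value initial n * value initial n)) n) 27} tt

-- Consequences of decreasing ratios

-- The bound 26 ≤ j is sharp: p 25 * p 25 < p 26 * p 24.
LC : ℕ → Set
LC n = ∀ i j → 1 ≤ i → i ≤ j → 26 ≤ j → j < n → 𝕡 (suc j) * 𝕡 i ≤ 𝕡 (suc i) * 𝕡 j

W-reverse : ∀ n → ∑ n (λ l → (n ∸ l) * 𝕡 l) ≡ R n + P n
W-reverse zero    = refl
W-reverse (suc n) = begin
  ∑ n (λ l → (suc n ∸ l) * 𝕡 l) + (suc n ∸ n) * 𝕡 n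
    ≡⟨ cong₂ _+_ (∑-cong n λ l l<n → cong (_* 𝕡 l) (+-∸-assoc 1 (<⇒≤ l<n))) (cong (_* 𝕡 n) (m+n∸n≡m 1 n)) ⟩
  ∑ n (λ l → 𝕡 l + (n ∸ l) * 𝕡 l) + 1 * 𝕡 n  ≡⟨ cong₂ _+_ (trans (∑-add n _ _) (cong (P n +_) (W-reverse n))) (*-identityˡ (𝕡 n)) ⟩
  P n + (R n + P n) + 𝕡 n                    ≡⟨ lem (P n) (R n) (𝕡 n) ⟩
  R n + P n + (P n + 𝕡 n)                    ∎
  where open ≡-Reasoning
        lem : ∀ P R pₘ → P + (R + P) + pₘ ≡ R + P + (P + pₘ)
        lem = solve-∀

↓-self : ∀ (f : ℕ → ℕ) k → (f ↓ k) k ≡ f 0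
↓-self f zero    = refl
↓-self f (suc k) = ↓-self f k

-- c/h = (g/h) b - a, so c/h increases along with g/h.
ratio-sub : ∀ {c h g c′ h′ g′} a b → c + h * a ≡ g * b → c′ + h′ * a ≡ g′ * b → g * h′ ≤ g′ * h → c * h′ ≤ c′ * h
ratio-sub {c} {h} {g} {c′} {h′} {g′} a b e e′ gh≤ = +-cancelʳ-≤ (h * a * h′) (c * h′) (c′ * h) (begin
  c * h′ + h * a * h′    ≡⟨ *-distribʳ-+ h′ c (h * a) ⟨
  (c + h * a) * h′       ≡⟨ cong (_* h′) e ⟩
  g * b * h′             ≡⟨ lem g b h′ ⟩
  b * (g * h′)           ≤⟨ *-monoʳ-≤ b gh≤ ⟩
  b * (g′ * h)           ≡⟨ lem g′ b h ⟨
  g′ * b * h             ≡⟨ cong (_* h) e′ ⟨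
  (c′ + h′ * a) * h      ≡⟨ lem′ c′ h′ a h ⟩
  c′ * h + h * a * h′    ∎)
  where open ≤-Reasoning
        lem : ∀ g b h → g * b * h ≡ b * (g * h)
        lem = solve-∀
        lem′ : ∀ c h′ a h → (c + h′ * a) * h ≡ c * h + h * a * h′
        lem′ = solve-∀

∑-ratio : ∀ N (u c h g : ℕ → ℕ) a b → (∀ k → k < N → c k + h k * a ≡ g k * b) →
  ∑ N (λ k → u k * c k) + ∑ N (λ k → u k * h k) * a ≡ ∑ N (λ k → u k * g k) * b
∑-ratio zero    u c h g a b e = refl
∑-ratio (suc N) u c h g a b e = trans (lem₁ (∑ N (λ k → u k * c k)) (∑ N (λ k → u k * h k)) a (u N) (c N) (h N))
  (trans (cong₂ (λ x y → x + u N * y) (∑-ratio N u c h g a b λ k k<N → e k (m<n⇒m<1+n k<N)) (e N ≤-refl))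
         (lem₂ (∑ N (λ k → u k * g k)) b (u N) (g N)))
  where lem₁ : ∀ C H a u c h → C + u * c + (H + u * h) * a ≡ (C + H * a) + u * (c + h * a)
        lem₁ = solve-∀
        lem₂ : ∀ G b u g → G * b + u * (g * b) ≡ (G + u * g) * b
        lem₂ = solve-∀

bernoulli : ∀ b d t → b ^ t * (b + t * d) ≤ (b + d) ^ t * b
bernoulli b d zero    = ≤-reflexive (lem b)
  where lem : ∀ b → 1 * (b + 0) ≡ 1 * b
        lem = solve-∀
bernoulli b d (suc t) = begin
  b * b ^ t * (b + suc t * d)        ≤⟨ ≤-by (t * d * d * b ^ t) (z≤n {0}) (lem b (b ^ t) t d) ⟩
  (b + d) * (b ^ t * (b + t * d))    ≤⟨ *-monoʳ-≤ (b + d) (bernoulli b d t) ⟩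
  (b + d) * ((b + d) ^ t * b)        ≡⟨ *-assoc (b + d) ((b + d) ^ t) b ⟨
  (b + d) ^ suc t * b                ∎
  where open ≤-Reasoning
        lem : ∀ b B t d → b * B * (b + (1 + t) * d) + 0 + t * d * d * B ≡ (b + d) * (B * (b + t * d)) + 0
        lem = solve-∀

^-scale : ∀ m n o → (m * n) ^ o ≡ m ^ o * n ^ o
^-scale m n zero    = refl
^-scale m n (suc o) = trans (cong (m * n *_) (^-scale m n o)) (lem m n (m ^ o) (n ^ o))
  where lem : ∀ m n M N → m * n * (M * N) ≡ m * M * (n * N)
        lem = solve-∀

exponential-step : ∀ c d (x y x′ y′ z : ℕ) → x * (2 * y) ≤ z → c * y′ ≤ d * y → x′ ≡ c * x → x′ * (2 * y′) ≤ d * z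
exponential-step c d x y x′ y′ z ih sixth refl = begin
  c * x * (2 * y′)      ≡⟨ lem₁ c x y′ ⟩
  x * 2 * (c * y′)      ≤⟨ *-monoʳ-≤ (x * 2) sixth ⟩
  x * 2 * (d * y)       ≡⟨ lem₂ d x y ⟩
  d * (x * (2 * y))     ≤⟨ *-monoʳ-≤ d ih ⟩
  d * z                 ∎
  where
  open ≤-Reasoning
  lem₁ : ∀ c x y → c * x * (2 * y) ≡ x * 2 * (c * y)
  lem₁ = solve-∀
  lem₂ : ∀ d x y → x * 2 * (d * y) ≡ d * (x * (2 * y))
  lem₂ = solve-∀

sixth-step : ∀ c d u v s → c * v ^ 6 ≤ d * u ^ 6 → suc s * u ≤ s * v → 0 < u → c * suc s ^ 6 ≤ d * s ^ 6
sixth-step c d u v s numeric ratio u>0 = *-cancelʳ-≤ (c * suc s ^ 6) (d * s ^ 6) (u ^ 6) ⦃ >-nonZero (m^n>0 u ⦃ >-nonZero u>0 ⦄ 6) ⦄ (begin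
  c * suc s ^ 6 * u ^ 6      ≡⟨ *-assoc c (suc s ^ 6) (u ^ 6) ⟩
  c * (suc s ^ 6 * u ^ 6)    ≡⟨ cong (c *_) (^-scale (suc s) u 6) ⟨
  c * (suc s * u) ^ 6        ≤⟨ *-monoʳ-≤ c (^-monoˡ-≤ 6 ratio) ⟩
  c * (s * v) ^ 6            ≡⟨ cong (c *_) (^-scale s v 6) ⟩
  c * (s ^ 6 * v ^ 6)        ≡⟨ lem₄ c (s ^ 6) (v ^ 6) ⟩
  s ^ 6 * (c * v ^ 6)        ≤⟨ *-monoʳ-≤ (s ^ 6) numeric ⟩
  s ^ 6 * (d * u ^ 6)        ≡⟨ lem₅ (s ^ 6) d (u ^ 6) ⟩
  d * s ^ 6 * u ^ 6          ∎)
  where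
  open ≤-Reasoning
  lem₄ : ∀ c x y → c * (x * y) ≡ x * (c * y)
  lem₄ = solve-∀
  lem₅ : ∀ x c y → x * (c * y) ≡ c * x * y
  lem₅ = solve-∀

-- 2 s⁶ ≤ (32/25)^s for s ≥ 128: true at 128, and from there one step multiplies s⁶ by at most
-- (129/128)⁶ < 32/25.
exponential-beats-power : ∀ t → 25 ^ (t + 128) * (2 * (t + 128) ^ 6) ≤ 32 ^ (t + 128)
exponential-beats-power zero    = toWitness {a? = 25 ^ 128 * (2 * 128 ^ 6) ≤? 32 ^ 128} tt
exponential-beats-power (suc t) = exponential-step 25 32 (25 ^ (t + 128)) ((t + 128) ^ 6) (25 ^ suc (t + 128)) (suc (t + 128) ^ 6) (32 ^ (t + 128))
  (exponential-beats-power t)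
  (sixth-step 25 32 128 129 (t + 128) (toWitness {a? = 25 * 129 ^ 6 ≤? 32 * 128 ^ 6} tt) (≤-by 0 (m≤n+m 128 t) (lem t)) (s≤s z≤n))
  refl
  where lem : ∀ t → (1 + (t + 128)) * 128 + (t + 128) + 0 ≡ (t + 128) * 129 + 128
        lem = solve-∀

-- s replaces n^(1/2), and 8 L ≤ s turns each logarithmic error x L into at most x s / 8.
module Ratios (n s L : ℕ) (s≥ : 128 ≤ s) (s²≤n : s * s ≤ n) (n≤ : n ≤ s * s + 2 * s) (8L≤s : 8 * L ≤ s) (n<2^L : suc n < 2 ^ L)
  (lc : LC n) where

  s·128≤s² : s * 128 ≤ s * s
  s·128≤s² = *-monoʳ-≤ s s≥

  -- For l ≥ 26, p(j) p(l+1) ≤ p(j+1) p(l) is summed over 1 ≤ j < l, matching p(1), ..., p(l-1) with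
  -- p(2), ..., p(l). What remains is p(0) = 1 against p(0) + p(1) = 2, and p(l+1) ≤ 2 p(l).
  A-step : ∀ l → l < n → P l * 𝕡 (suc l) ≤ P (suc l) * 𝕡 l
  A-step l l<n with l <? 26
  ... | yes l<26 = A-small l l<26
  ... | no l≮26 with l | ≮⇒≥ l≮26
  ...   | suc l′ | 26≤l = begin
    P m * a                                                ≡⟨ cong (_* a) (trans (∑-head l′ 𝕡) (cong (_+ ∑ l′ (𝕡 ∘ suc)) 𝕡-0)) ⟩
    (1 + ∑ l′ (𝕡 ∘ suc)) * a                               ≡⟨ *-distribʳ-+ a 1 (∑ l′ (𝕡 ∘ suc)) ⟩
    1 * a + ∑ l′ (𝕡 ∘ suc) * a                             ≤⟨ +-mono-≤ first rest ⟩
    2 * b + ∑ l′ (𝕡 ∘ suc ∘ suc) * b                       ≡⟨ *-distribʳ-+ b 2 (∑ l′ (𝕡 ∘ suc ∘ suc)) ⟨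
    (2 + ∑ l′ (𝕡 ∘ suc ∘ suc)) * b
      ≡⟨ cong (λ z → z * b) (trans (∑-head (suc l′) 𝕡) (cong₂ _+_ 𝕡-0 (trans (∑-head l′ (𝕡 ∘ suc)) (cong (_+ ∑ l′ (𝕡 ∘ suc ∘ suc)) 𝕡-1)))) ⟨
    P (suc m) * b                                          ∎
    where
    open ≤-Reasoning
    m = suc l′
    a = 𝕡 (suc m)
    b = 𝕡 m
    first : 1 * a ≤ 2 * b
    first = subst₂ (λ u v → u ≤ v * b) (trans (cong (a *_) 𝕡-1) (*-comm a 1)) 𝕡-2 (lc 1 m (s≤s z≤n) (s≤s z≤n) 26≤l l<n)
    rest : ∑ l′ (𝕡 ∘ suc) * a ≤ ∑ l′ (𝕡 ∘ suc ∘ suc) * b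
    rest = begin
      ∑ l′ (𝕡 ∘ suc) * a                ≡⟨ *-comm (∑ l′ (𝕡 ∘ suc)) a ⟩
      a * ∑ l′ (𝕡 ∘ suc)                ≡⟨ ∑-scale l′ a _ ⟨
      ∑ l′ (λ j → a * 𝕡 (suc j))        ≤⟨ ∑-mono l′ (λ j j< → ≤-trans
                                             (lc (suc j) m (s≤s z≤n) (≤-trans j< (n≤1+n l′)) 26≤l l<n)
                                             (≤-reflexive (*-comm (𝕡 (suc (suc j))) b))) ⟩
      ∑ l′ (λ j → b * 𝕡 (suc (suc j)))  ≡⟨ ∑-scale l′ b _ ⟩
      b * ∑ l′ (𝕡 ∘ suc ∘ suc)          ≡⟨ *-comm b (∑ l′ (𝕡 ∘ suc ∘ suc)) ⟩
      ∑ l′ (𝕡 ∘ suc ∘ suc) * b          ∎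

  A-mono : ∀ {l m} → l ≤ m → m ≤ n → P l * 𝕡 m ≤ P m * 𝕡 l
  A-mono {l} l≤m with m≤n⇒∃[o]m+o≡n l≤m
  ... | o , refl = go o
    where
    go : ∀ o → l + o ≤ n → P l * 𝕡 (l + o) ≤ P (l + o) * 𝕡 l
    go zero    _ rewrite +-identityʳ l = ≤-refl
    go (suc o) l+o<n rewrite +-suc l o = *-cancelʳ-≤ _ _ (𝕡 (l + o))
      (≤-by 0 (+-mono-≤ (*-monoˡ-≤ (𝕡 (suc (l + o))) (go o (≤-trans (n≤1+n _) l+o<n))) (*-monoˡ-≤ (𝕡 l) (A-step (l + o) l+o<n)))
        (lem (P l) (𝕡 (suc (l + o))) (𝕡 (l + o)) (P (l + o)) (𝕡 l) (P (suc (l + o)))))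
      where lem : ∀ Pl p1 p0 P0 pl P1 → Pl * p1 * p0 + (P0 * pl * p1 + P1 * p0 * pl) + 0 ≡ P1 * pl * p0 + (Pl * p0 * p1 + P0 * p1 * pl)
            lem = solve-∀

  R-upper : ∀ {m} → m ≤ n → R m * 𝕡 m ≤ P m * P m
  R-upper {m} m≤n = begin
    R m * 𝕡 m              ≡⟨ *-comm (R m) (𝕡 m) ⟩
    𝕡 m * R m              ≡⟨ ∑-scale m (𝕡 m) P ⟨
    ∑ m (λ l → 𝕡 m * P l)  ≤⟨ ∑-mono m (λ l l<m → ≤-trans (≤-reflexive (*-comm (𝕡 m) (P l))) (A-mono (<⇒≤ l<m) m≤n)) ⟩
    ∑ m (λ l → P m * 𝕡 l)  ≡⟨ ∑-scale m (P m) 𝕡 ⟩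
    P m * P m              ∎
    where open ≤-Reasoning

  -- Divided by p(m)²: 48 m ≤ 80 A² + (3 s + 40) A, from `p-upper`, R p ≤ P² and 8 L ≤ s. The
  -- leading terms alone give A ≥ (3m/5)^(1/2), about 0.775 m^(1/2).
  A-quadratic : ∀ {m} → m ≤ n → 48 * (m * 𝕡 m * 𝕡 m) ≤ 80 * (P m * P m) + (3 * s + 40) * (P m * 𝕡 m)
  A-quadratic {m} m≤n = ≤-by 0 (+-mono-≤ (+-mono-≤ (*-monoˡ-≤ (8 * 𝕡 m) (p-upper L m (<-trans (s≤s m≤n) n<2^L))) (*-monoʳ-≤ 80 (R-upper m≤n)))
                                (*-monoˡ-≤ (3 * (P m * 𝕡 m)) 8L≤s))
      (lem m (𝕡 m) (P m) (R m) L s)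
    where lem : ∀ m pₘ P R L s → 48 * (m * pₘ * pₘ) + ((10 * R + (3 * L + 5) * P) * (8 * pₘ) + 80 * (P * P) + s * (3 * (P * pₘ))) + 0
                  ≡ 80 * (P * P) + (3 * s + 40) * (P * pₘ) + (6 * (m * pₘ) * (8 * pₘ) + 80 * (R * pₘ) + 8 * L * (3 * (P * pₘ)))
          lem = solve-∀

  -- The quadratic in `A-quadratic` increases with A, so a trial value u s / v at which it is at
  -- most 48 m is a lower bound for A.
  A-lower : ∀ u v {m} → m ≤ n → 80 * (u * s * (u * s)) + (3 * s + 40) * (u * s * v) ≤ 48 * (m * v * v) → u * s * 𝕡 m ≤ v * P m
  A-lower u v {m} m≤n cond with u * s * 𝕡 m ≤? v * P m
  ... | yes le = le
  ... | no nle = ⊥-elim (<-irrefl refl (≤-<-trans q₁ (<-≤-trans q₂ q₃)))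
    where
    x = u * s * 𝕡 m
    y = v * P m
    y<x : y < x
    y<x = ≰⇒> nle
    q₁ : 48 * (m * v * v) * (𝕡 m * 𝕡 m) ≤ 80 * (y * y) + (3 * s + 40) * (y * (v * 𝕡 m))
    q₁ = ≤-by 0 (*-monoˡ-≤ (v * v) (A-quadratic m≤n)) (lem m v (𝕡 m) (P m) (3 * s + 40))
      where lem : ∀ m v pₘ P t → 48 * (m * v * v) * (pₘ * pₘ) + (80 * (P * P) + t * (P * pₘ)) * (v * v) + 0
                    ≡ 80 * (v * P * (v * P)) + t * (v * P * (v * pₘ)) + 48 * (m * pₘ * pₘ) * (v * v)
            lem = solve-∀
    q₂ : 80 * (y * y) + (3 * s + 40) * (y * (v * 𝕡 m)) < 80 * (x * x) + (3 * s + 40) * (x * (v * 𝕡 m))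
    q₂ = +-mono-<-≤ (*-monoʳ-< 80 (*-mono-< y<x y<x)) (*-monoʳ-≤ (3 * s + 40) (*-monoˡ-≤ (v * 𝕡 m) (<⇒≤ y<x)))
    q₃ : 80 * (x * x) + (3 * s + 40) * (x * (v * 𝕡 m)) ≤ 48 * (m * v * v) * (𝕡 m * 𝕡 m)
    q₃ = ≤-trans (≤-reflexive (lem (u * s) (𝕡 m) v (3 * s + 40))) (*-monoˡ-≤ (𝕡 m * 𝕡 m) cond)
      where lem : ∀ us pₘ v t → 80 * (us * pₘ * (us * pₘ)) + t * (us * pₘ * (v * pₘ)) ≡ (80 * (us * us) + t * (us * v)) * (pₘ * pₘ)
            lem = solve-∀

  -- Monotonicity of A rearranges to (p(l+1) - p(l))/p(l) ≤ 1/A(l+1), and the hypothesis is A(l+1) ≥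
  -- u/v.
  ratio-upper : ∀ u v {l} → l < n → u * 𝕡 (suc l) ≤ v * P (suc l) → u * 𝕡 (suc l) ≤ (u + v) * 𝕡 l
  ratio-upper u v {l} l<n A≥ with m≤n⇒∃[o]m+o≡n (p-mono-step l)
  ... | d , eq = subst (λ z → u * z ≤ (u + v) * 𝕡 l) eq (≤-by 0 ud≤ (lem u v (𝕡 l) d))
    where
    lem : ∀ u v b d → u * (b + d) + v * b + 0 ≡ (u + v) * b + u * d
    lem = solve-∀
    Pd≤ : P (suc l) * d ≤ 𝕡 l * 𝕡 (suc l)
    Pd≤ = ≤-by 0 (A-step l l<n) (subst (λ z → (P l + 𝕡 l) * d + (P l + 𝕡 l) * 𝕡 l + 0 ≡ 𝕡 l * z + P l * z) eq (lem₁ (P l) (𝕡 l) d))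
      where lem₁ : ∀ P b d → (P + b) * d + (P + b) * b + 0 ≡ b * (b + d) + P * (b + d)
            lem₁ = solve-∀
    ud≤ : u * d ≤ v * 𝕡 l
    ud≤ = *-cancelʳ-≤ (u * d) (v * 𝕡 l) (𝕡 (suc l)) (begin
      u * d * 𝕡 (suc l)       ≡⟨ lem₂ u d (𝕡 (suc l)) ⟩
      u * 𝕡 (suc l) * d       ≤⟨ *-monoˡ-≤ d A≥ ⟩
      v * P (suc l) * d       ≡⟨ *-assoc v (P (suc l)) d ⟩
      v * (P (suc l) * d)     ≤⟨ *-monoʳ-≤ v Pd≤ ⟩
      v * (𝕡 l * 𝕡 (suc l))   ≡⟨ *-assoc v (𝕡 l) _ ⟨
      v * 𝕡 l * 𝕡 (suc l)     ∎)
      where open ≤-Reasoning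
            lem₂ : ∀ u d pₘ → u * d * pₘ ≡ u * pₘ * d
            lem₂ = solve-∀

  -- The constants of this bound and the next two lie below (3/5)^(1/2) times (1/2)^(1/2),
  -- (3/4)^(1/2) and 1, that is below 0.548, 0.671 and 0.775; the rest absorbs the term (3 s + 40)
  -- A.
  A-half : ∀ {m} → m ≤ n → s * s ≤ 2 * m → 1 * s * 𝕡 m ≤ 2 * P m
  A-half {m} m≤n s²≤2m = A-lower 1 2 m≤n (≤-by (s * s * 9 + s * 48) (+-mono-≤ (*-monoˡ-≤ 96 s²≤2m) s·128≤s²) (lem s m))
    where lem : ∀ s m → 80 * (1 * s * (1 * s)) + (3 * s + 40) * (1 * s * 2) + (2 * m * 96 + s * s) + (s * s * 9 + s * 48)
                  ≡ 48 * (m * 2 * 2) + (s * s * 96 + s * 128)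
          lem = solve-∀

  A-three-quarters : ∀ {m} → m ≤ n → 3 * (s * s) ≤ 4 * m → 13 * s * 𝕡 m ≤ 20 * P m
  A-three-quarters {m} m≤n h = A-lower 13 20 m≤n (≤-by (s * 2400) (+-mono-≤ (*-monoˡ-≤ 4800 h) (*-monoˡ-≤ 100 s·128≤s²)) (lem s m))
    where lem : ∀ s m → 80 * (13 * s * (13 * s)) + (3 * s + 40) * (13 * s * 20) + (4 * m * 4800 + s * s * 100) + s * 2400
                  ≡ 48 * (m * 20 * 20) + (3 * (s * s) * 4800 + s * 128 * 100)
          lem = solve-∀

  A-near : ∀ {m} → m ≤ n → s * s ≤ m + 2 * s + 2 → 7 * s * 𝕡 m ≤ 10 * P m
  A-near {m} m≤n h = A-lower 7 10 m≤n (≤-by (s * s * 570 + s * 325)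
      (+-mono-≤ (*-monoˡ-≤ 4800 h) (+-mono-≤ (*-monoˡ-≤ 100 s·128≤s²) (*-monoˡ-≤ 75 s≥))) (lem s m))
    where lem : ∀ s m → 80 * (7 * s * (7 * s)) + (3 * s + 40) * (7 * s * 10) + ((m + 2 * s + 2) * 4800 + (s * s * 100 + s * 75)) + (s * s * 570 + s * 325)
                  ≡ 48 * (m * 10 * 10) + (s * s * 4800 + (s * 128 * 100 + 9600))
          lem = solve-∀

  -- Shows A(M+1) - A(M) ≤ 3/s. With c(k) = p(M-k) p(M) - p(M-1-k) p(M+1), the sum of c is
  -- essentially P(M+1) p(M) - P(M) p(M+1), while the recurrences for M and M + 1 make Σ σ(k+1) c(k)
  -- essentially p(M) p(M+1). Since c/h increases, most of c sits where σ(k+1) is at least s/3, so s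
  -- Σ c ≤ 3 Σ σ c.
  module Slow (N : ℕ) (M<n : suc N < n) (s²≤2m : s * s ≤ 2 * (2 + N)) where
    M = suc N
    a = 𝕡 (suc M)
    b = 𝕡 M
    g h c : ℕ → ℕ
    g k = (𝕡 ↓ k) M
    h k = (𝕡 ↓ suc k) M
    c k = g k * b ∸ h k * a

    data Index (k : ℕ) : Set where
      index : ∀ i → 1 ≤ i → k + suc i ≡ M → g k ≡ 𝕡 (suc i) → h k ≡ 𝕡 i → Index k

    at : ∀ {k} → k < N → Index k
    at {k} k<N with m≤n⇒∃[o]m+o≡n k<N
    ... | o , refl = index (suc o) (s≤s z≤n) (lem k o) (trans (cong (𝕡 ↓ k) (sym (lem k o))) (↓-+ 𝕡 k (2 + o)))
                           (trans (cong (𝕡 ↓ suc k) (sym (lem′ k o))) (↓-+ 𝕡 (suc k) (suc o)))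
      where lem : ∀ k o → k + (2 + o) ≡ 2 + (k + o)
            lem = solve-∀
            lem′ : ∀ k o → 1 + k + (1 + o) ≡ 2 + (k + o)
            lem′ = solve-∀

    h-pos : ∀ {k} → Index k → 0 < h k
    h-pos (index i _ _ _ he) = subst (0 <_) (sym he) (p-pos i)

    26≤M : 26 ≤ M
    26≤M = *-cancelˡ-≤ 2 (≤-by (s * 127 + 74) (+-mono-≤ (≤-trans s·128≤s² s²≤2m) s≥) (lem s N))
      where lem : ∀ s N → 2 * 26 + (2 * (2 + N) + s) + (s * 127 + 74) ≡ 2 * (1 + N) + (s * 128 + 128)
            lem = solve-∀

    c-eq : ∀ k → k < N → c k + h k * a ≡ g k * b
    c-eq k k<N with at k<N
    ... | index i 1≤i e ge he = m∸n+n≡m (subst₂ (λ u v → u * a ≤ v * b) (sym he) (sym ge)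
            (≤-trans (≤-reflexive (*-comm (𝕡 i) a)) (lc i M 1≤i (≤-trans (≤-trans (n≤1+n i) (m≤n+m (suc i) k)) (≤-reflexive e)) 26≤M M<n)))

    ratio-mono : ∀ {k k′} → k ≤ k′ → k′ < N → k + 27 ≤ M → g k * h k′ ≤ g k′ * h k
    ratio-mono {k} {k′} k≤k′ k′<N k+27≤M with at (≤-<-trans k≤k′ k′<N) | at k′<N
    ... | index i 1≤i e ge he | index i′ 1≤i′ e′ ge′ he′ rewrite ge | he | ge′ | he′ =
      lc i′ i 1≤i′ (s≤s⁻¹ (+-cancelˡ-≤ k′ (suc i′) (suc i) (≤-trans (≤-reflexive (trans e′ (sym e))) (+-monoˡ-≤ (suc i) k≤k′))))
        (s≤s⁻¹ (+-cancelˡ-≤ k 27 (suc i) (≤-trans k+27≤M (≤-reflexive (sym e)))))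
        (≤-trans (≤-trans (m≤n+m (suc i) k) (≤-reflexive e)) (<⇒≤ M<n))

    c-mono : ∀ {k k′} → k ≤ k′ → k′ < N → k + 27 ≤ M → c k * h k′ ≤ c k′ * h k
    c-mono {k} {k′} k≤k′ k′<N k+27≤M = ratio-sub {c k} {h k} {g k} {c k′} {h k′} {g k′} a b (c-eq _ (≤-<-trans k≤k′ k′<N)) (c-eq _ k′<N) (ratio-mono k≤k′ k′<N k+27≤M)

    -- From this index on, 3 σ(k + 1) ≥ 3 (k + 1) ≥ s.
    κ = s / 3

    3κ≤s : 3 * κ ≤ s
    3κ≤s = ≤-trans (≤-reflexive (*-comm 3 κ)) (m/n*n≤m s 3)

    κ+27≤M : κ + 27 ≤ M
    κ+27≤M = *-cancelˡ-≤ 6 (≤-by (s * 380 + 88) (+-mono-≤ (*-monoˡ-≤ 3 (≤-trans s·128≤s² s²≤2m)) (+-mono-≤ (*-monoˡ-≤ 2 3κ≤s) (*-monoˡ-≤ 2 s≥))) (lem κ s N))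
      where lem : ∀ κ s N → 6 * (κ + 27) + (2 * (2 + N) * 3 + (s * 2 + s * 2)) + (s * 380 + 88) ≡ 6 * (1 + N) + (s * 128 * 3 + (3 * κ * 2 + 256))
            lem = solve-∀

    κ<N : κ < N
    κ<N = s≤s⁻¹ (≤-trans (≤-reflexive (+-comm 2 κ)) (≤-trans (+-monoʳ-≤ κ (s≤s (s≤s z≤n))) κ+27≤M))

    o = N ∸ κ

    κ+o : κ + o ≡ N
    κ+o = m+[n∸m]≡n (<⇒≤ κ<N)

    inside : ∀ k → k < o → κ + k < N
    inside k k<o = ≤-trans (+-monoʳ-< κ k<o) (≤-reflexive κ+o)

    P-M : P M ≡ ∑ N h + 1
    P-M = trans (sym (P-reverse M)) (cong (∑ N h +_) (trans (↓-self 𝕡 M) 𝕡-0))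

    P-sucM : P (suc M) ≡ ∑ N g + 1 + 1
    P-sucM = trans (sym (P-reverse (suc M))) (cong₂ (λ u v → ∑ N g + u + v)
      (trans (cong (𝕡 ↓ N) (+-comm 1 N)) (trans (↓-+ 𝕡 N 1) 𝕡-1)) (trans (↓-self 𝕡 M) 𝕡-0))

    Sh = ∑ N (λ k → σ (suc k) * h k)
    Sg = ∑ N (λ k → σ (suc k) * g k)
    Sc = ∑ N (λ k → σ (suc k) * c k)

    rec-M : M * b ≡ Sh + σ M
    rec-M = trans (σ-recurrence′ M) (cong (Sh +_) (trans (cong (σ M *_) (trans (↓-self 𝕡 M) 𝕡-0)) (*-identityʳ (σ M))))

    rec-sucM : suc M * a ≡ Sg + σ M + σ (suc M)
    rec-sucM = trans (σ-recurrence′ (suc M)) (cong₂ (λ u v → Sg + u + v)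
      (trans (cong (σ M *_) (trans (cong (𝕡 ↓ N) (+-comm 1 N)) (trans (↓-+ 𝕡 N 1) 𝕡-1))) (*-identityʳ (σ M)))
      (trans (cong (σ (suc M) *_) (trans (↓-self 𝕡 M) 𝕡-0)) (*-identityʳ (σ (suc M)))))

    σM≤ : σ M ≤ M * L
    σM≤ = σ-upper L M (<-trans (<-trans M<n (n<1+n n)) n<2^L)

    -- The condition of `abel-crossing` on total weights. The left side is at most (M + s²/2) p(M)
    -- by `P-tangent`; the right side is 3 M p(M) less about 3 C(κ) p(M), where C(κ) ≤ (49/432) s².
    -- With M close to s²/2 or larger there is room, as 121 s² < 288 M.
    total : s * ∑ N h ≤ 3 * ∑ o (λ k → σ (suc (κ + k)) * h (κ + k))
    total = *-cancelʳ-≤ (s * ∑ N h) (3 * ∑ o (λ k → σ (suc (κ + k)) * h (κ + k))) 144 (≤-by 0 (+-mono-≤ (+-mono-≤ (+-mono-≤ hP hX) (+-mono-≤ hσ (*-monoˡ-≤ b hM))) (≤-reflexive (cong (_* 432) split)))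
      (lem (s * ∑ N h) Y M s b X (σ M)))
      where
      open ≤-Reasoning
      X = ∑ κ (λ k → σ (suc k) * h k)
      Y = ∑ o (λ k → σ (suc (κ + k)) * h (κ + k))
      split : M * b ≡ X + Y + σ M
      split = trans rec-M (cong (_+ σ M) (trans (cong (λ z → ∑ z (λ k → σ (suc k) * h k)) (sym κ+o)) (∑-append κ o _)))
      hP : s * ∑ N h * 144 ≤ (2 * M + s * s) * b * 72
      hP = begin
        s * ∑ N h * 144           ≤⟨ *-monoˡ-≤ 144 (*-monoʳ-≤ s (≤-trans (m≤m+n (∑ N h) 1) (≤-reflexive (sym P-M)))) ⟩
        s * P M * 144             ≡⟨ eq (s * P M) ⟩
        2 * (s * P M) * 72        ≤⟨ *-monoˡ-≤ 72 (P-tangent s M) ⟩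
        (2 * M + s * s) * b * 72  ∎
        where eq : ∀ x → x * 144 ≡ 2 * x * 72
              eq = solve-∀
      hC : C κ * 432 ≤ s * s * 49
      hC = ≤-by 0 (+-mono-≤ (*-monoˡ-≤ 72 (C-upper L κ (<-trans (<-trans κ<N (<-trans (n<1+n N) M<n)) (<-trans (n<1+n n) n<2^L))))
                  (+-mono-≤ (*-monoˡ-≤ 40 (*-mono-≤ 3κ≤s 3κ≤s)) (*-monoˡ-≤ 9 (*-mono-≤ 3κ≤s 8L≤s)))) (eq (C κ) κ L s)
        where eq : ∀ C κ L s → C * 432 + ((5 * (κ * κ) + 3 * (κ * L)) * 72 + (s * s * 40 + s * s * 9)) + 0
                     ≡ s * s * 49 + (6 * C * 72 + (3 * κ * (3 * κ) * 40 + 3 * κ * (8 * L) * 9))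
              eq = solve-∀
      hX : X * 432 ≤ b * (s * s * 49)
      hX = begin
        X * 432                              ≤⟨ *-monoˡ-≤ 432 (∑-mono κ λ k _ → ≤-trans (*-monoʳ-≤ (σ (suc k)) (p↓-≤ (suc k) M)) (≤-reflexive (*-comm (σ (suc k)) b))) ⟩
        ∑ κ (λ k → b * σ (suc k)) * 432      ≡⟨ cong (_* 432) (trans (∑-scale κ b _) (cong (b *_) (C-suc κ))) ⟩
        b * C κ * 432                        ≡⟨ *-assoc b (C κ) 432 ⟩
        b * (C κ * 432)                      ≤⟨ *-monoʳ-≤ b hC ⟩
        b * (s * s * 49)                     ∎
      hσ : σ M * 432 ≤ b * (s * 72)
      hσ = ≤-by 0 (+-mono-≤ (*-monoˡ-≤ 432 σM≤) (+-mono-≤ (*-monoˡ-≤ (L * 144) (p-linear M)) (*-monoˡ-≤ (b * 72) 8L≤s)))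
             (eq (σ M) b s M L)
        where eq : ∀ σ b s M L → σ * 432 + (M * L * 432 + (4 * b * (L * 144) + s * (b * 72))) + 0
                     ≡ b * (s * 72) + (σ * 432 + (3 * M * (L * 144) + 8 * L * (b * 72)))
              eq = solve-∀
      hM : s * s * 121 + s * 72 ≤ M * 288
      hM = ≤-by (s * s * 22 + s * 53 + 96) (+-mono-≤ (*-monoˡ-≤ 144 s²≤2m) (+-mono-≤ s·128≤s² (*-monoˡ-≤ 3 s≥))) (eq s N)
        where eq : ∀ s N → s * s * 121 + s * 72 + (2 * (2 + N) * 144 + (s * s + s * 3)) + (s * s * 22 + s * 53 + 96) ≡ (1 + N) * 288 + (s * s * 144 + (s * 128 + 384))
              eq = solve-∀
      lem : ∀ H Y M s b X σ → H * 144 + ((2 * M + s * s) * b * 72 + b * (s * s * 49) + (b * (s * 72) + M * 288 * b) + (X + Y + σ) * 432) + 0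
        ≡ 3 * Y * 144 + (H * 144 + X * 432 + (σ * 432 + (s * s * 121 + s * 72) * b) + M * b * 432)
      lem = solve-∀

    crossing : s * ∑ N c ≤ 3 * Sc
    crossing = ≤-trans (subst (λ z → s * ∑ z c ≤ ∑ z (λ k → 3 * σ (suc k) * c k)) κ+o
        (abel-crossing κ o s (λ k → 3 * σ (suc k)) h c (c κ) (h κ) hκ>0
          (λ k k<κ → c-mono (<⇒≤ k<κ) κ<N (≤-trans (+-monoˡ-≤ 27 (<⇒≤ k<κ)) κ+27≤M))
          (λ k k<o → c-mono (m≤m+n κ k) (inside k k<o) κ+27≤M)
          (λ k _ → weight k) total′))
      (≤-reflexive (trans (∑-cong N λ k _ → *-assoc 3 (σ (suc k)) (c k)) (∑-scale N 3 (λ k → σ (suc k) * c k))))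
      where
      weight : ∀ k → s ≤ 3 * σ (suc (κ + k))
      weight k = begin
        s                      ≤⟨ <⇒≤ (/-next s 2) ⟩
        suc (s / 3) * 3        ≡⟨ *-comm (suc (s / 3)) 3 ⟩
        3 * suc (s / 3)        ≤⟨ *-monoʳ-≤ 3 (s≤s (m≤m+n (s / 3) k)) ⟩
        3 * suc (s / 3 + k)    ≤⟨ *-monoʳ-≤ 3 (σ-lower (suc (s / 3 + k))) ⟩
        3 * σ (suc (κ + k))    ∎
        where open ≤-Reasoning
      total′ : s * ∑ (κ + o) h ≤ ∑ o (λ k → 3 * σ (suc (κ + k)) * h (κ + k))
      total′ = begin
        s * ∑ (κ + o) h                                      ≡⟨ cong (λ z → s * ∑ z h) κ+o ⟩
        s * ∑ N h                                            ≤⟨ total ⟩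
        3 * ∑ o (λ k → σ (suc (κ + k)) * h (κ + k))          ≡⟨ ∑-scale o 3 (λ k → σ (suc (κ + k)) * h (κ + k)) ⟨
        ∑ o (λ k → 3 * (σ (suc (κ + k)) * h (κ + k)))        ≡⟨ ∑-cong o (λ k _ → *-assoc 3 (σ (suc (κ + k))) (h (κ + k))) ⟨
        ∑ o (λ k → 3 * σ (suc (κ + k)) * h (κ + k))          ∎
        where open ≤-Reasoning
      hκ>0 : 0 < h κ
      hκ>0 = h-pos (at κ<N)

    a-upper : 1 * s * a ≤ (1 * s + 2) * b
    a-upper = ratio-upper (1 * s) 2 M<n (A-half M<n s²≤2m)

    slow : s * (P (suc M) * b) ≤ 3 * (a * b) + s * (P M * a)
    slow = subst₂ (λ u v → s * (u * b) ≤ 3 * (a * b) + s * (v * a)) (sym P-sucM) (sym P-M)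
      (≤-by 0 (+-mono-≤ (+-mono-≤ crossing (≤-reflexive (cong (s *_) (sym sum-c)))) boundary) (lem (∑ N g) b s a Sc (∑ N c) (∑ N h)))
      where
      sum-c : ∑ N c + ∑ N h * a ≡ ∑ N g * b
      sum-c = trans (cong₂ (λ u v → u + v * a) (unit c) (unit h)) (trans (∑-ratio N (λ _ → 1) c h g a b c-eq) (cong (_* b) (sym (unit g))))
        where unit : ∀ (f : ℕ → ℕ) → ∑ N f ≡ ∑ N (λ k → 1 * f k)
              unit f = ∑-cong N λ k _ → sym (*-identityˡ (f k))
      Sc-eq : Sc + σ M * b + σ (suc M) * b ≡ a * b + σ M * a
      Sc-eq = +-cancelʳ-≡ (M * b * a) _ _ (trans (cong (λ z → Sc + σ M * b + σ (suc M) * b + z * a) rec-M)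
        (trans (lem₁ Sc (σ M) b (σ (suc M)) Sh a) (trans (cong (λ z → z + σ M * b + σ (suc M) * b + σ M * a) (∑-ratio N (λ k → σ (suc k)) c h g a b c-eq))
        (trans (lem₂ Sg b (σ M) (σ (suc M)) a) (trans (cong (λ z → z * b + σ M * a) (sym rec-sucM)) (lem₃ M a b (σ M)))))))
        where
        lem₁ : ∀ Sc σ b σ′ Sh a → Sc + σ * b + σ′ * b + (Sh + σ) * a ≡ (Sc + Sh * a) + σ * b + σ′ * b + σ * a
        lem₁ = solve-∀
        lem₂ : ∀ Sg b σ σ′ a → Sg * b + σ * b + σ′ * b + σ * a ≡ (Sg + σ + σ′) * b + σ * a
        lem₂ = solve-∀
        lem₃ : ∀ M a b σ → (1 + M) * a * b + σ * a ≡ a * b + σ * a + M * b * a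
        lem₃ = solve-∀
      -- The two terms k = M - 1 and k = M left out of c.
      boundary : 3 * Sc + s * (b + b) ≤ 3 * (a * b) + s * a
      boundary with m≤n⇒∃[o]m+o≡n (p-mono-step M)
      ... | d , b+d = subst (λ z → 3 * Sc + s * (b + b) ≤ 3 * (z * b) + s * z) b+d (*-cancelˡ-≤ 8
          (≤-by (M * b * 16 + b * s * 120 + d * s * 8 + b * 22)
            (+-mono-≤ (+-mono-≤ (≤-reflexive (cong (_* 24) (trans Sc-eq (cong (λ z → z * b + σ M * z) (sym b+d))))) (*-monoˡ-≤ (3 * d) σs))
              (+-mono-≤ (*-monoˡ-≤ (3 * M) sd≤) (+-mono-≤ (*-monoˡ-≤ (24 * b) (σ-lower (suc M))) (*-monoˡ-≤ b (≤-trans s·128≤s² s²≤2m)))))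
            (lem₄ Sc s b d (σ M) (σ (suc M)) M)))
        where
        σs : 8 * σ M ≤ s * M
        σs = ≤-by 0 (+-mono-≤ (*-monoʳ-≤ 8 σM≤) (*-monoˡ-≤ M 8L≤s)) (lem₅ (σ M) s M L)
          where lem₅ : ∀ σ s M L → 8 * σ + (8 * (M * L) + s * M) + 0 ≡ s * M + (8 * σ + 8 * L * M)
                lem₅ = solve-∀
        sd≤ : s * d ≤ 2 * b
        sd≤ = ≤-by 0 (subst (λ z → 1 * s * z ≤ (1 * s + 2) * b) (sym b+d) a-upper) (lem₆ s b d)
          where lem₆ : ∀ s b d → s * d + (1 * s + 2) * b + 0 ≡ 2 * b + 1 * s * (b + d)
                lem₆ = solve-∀
        lem₄ : ∀ S s b d w v M → 8 * (3 * S + s * (b + b)) + (((b + d) * b + w * (b + d)) * 24 + s * M * (3 * d) + (2 * b * (3 * M) + (v * (24 * b) + 2 * (1 + M) * b)))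
            + (M * b * 16 + b * s * 120 + d * s * 8 + b * 22)
          ≡ 8 * (3 * ((b + d) * b) + s * (b + d)) + ((S + w * b + v * b) * 24 + 8 * w * (3 * d) + (s * d * (3 * M) + ((1 + M) * (24 * b) + s * 128 * b)))
        lem₄ = solve-∀
      lem : ∀ G b s a S c h → s * ((G + 1 + 1) * b) + (3 * S + s * (c + h * a) + (3 * (a * b) + s * a)) + 0
        ≡ 3 * (a * b) + s * ((h + 1) * a) + (s * c + s * (G * b) + (3 * S + s * (b + b)))
      lem = solve-∀

  -- A(n) - A(l) ≤ 3 (n - l)/s. For l ≥ n/2 this sums the steps of `Slow`; for smaller l already s
  -- A(n) ≤ n + s²/2 ≤ 3n/2 ≤ 3 (n - l), by `P-tangent`.
  A-descent : ∀ i l → l + i ≡ n → s * (P n * 𝕡 l) ≤ s * (P l * 𝕡 n) + 3 * i * (𝕡 l * 𝕡 n)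
  A-descent i l e with n ≤? 2 * l
  ... | no n≰2l = ≤-trans (*-cancelˡ-≤ 2 (≤-by 0 (+-mono-≤ (*-monoˡ-≤ (𝕡 l) (P-tangent s n)) (+-mono-≤ (*-monoˡ-≤ (𝕡 n * 𝕡 l) s²≤n) (*-monoˡ-≤ (3 * (𝕡 n * 𝕡 l)) n≤2i)))
                              (lem s (P n) (𝕡 l) i (𝕡 n) n)))
                          (m≤n+m (3 * i * (𝕡 l * 𝕡 n)) (s * (P l * 𝕡 n)))
    where
    lem : ∀ s P l i m n → 2 * (s * (P * l)) + ((2 * n + s * s) * m * l + (n * (m * l) + 2 * i * (3 * (m * l)))) + 0
      ≡ 2 * (3 * i * (l * m)) + (2 * (s * P) * l + (s * s * (m * l) + n * (3 * (m * l))))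
    lem = solve-∀
    n≤2i : n ≤ 2 * i
    n≤2i = ≤-by 1 (+-mono-≤ (≰⇒> n≰2l) (≤-reflexive (cong (λ z → z * 2) (sym e)))) (lem₁ n i l)
      where lem₁ : ∀ n i l → n + (n + (l + i) * 2) + 1 ≡ 2 * i + (1 + 2 * l + n * 2)
            lem₁ = solve-∀
  A-descent zero l e | yes n≤2l = ≤-reflexive (trans (cong (λ z → s * (P n * 𝕡 z)) l≡n)
      (trans (sym (+-identityʳ _)) (cong (λ z → s * (P z * 𝕡 n) + 0) (sym l≡n))))
    where l≡n : l ≡ n
          l≡n = trans (sym (+-identityʳ l)) e
  A-descent (suc i) zero e | yes n≤0 = ⊥-elim (<⇒≱ (≤-trans (s≤s z≤n) (≤-trans s≥ (≤-trans (m≤m*n s s ⦃ >-nonZero (≤-trans (s≤s z≤n) s≥) ⦄) s²≤n))) n≤0)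
  A-descent (suc i) (suc N) e | yes n≤2l = *-cancelʳ-≤ _ _ (𝕡 (2 + N))
      (≤-by 0 (+-mono-≤ (*-monoˡ-≤ (𝕡 (suc N)) (A-descent i (2 + N) (trans (sym (+-suc (suc N) i)) e)))
                        (*-monoˡ-≤ (𝕡 n) (Slow.slow N l<n (≤-trans s²≤n (≤-trans n≤2l (*-monoʳ-≤ 2 (n≤1+n (suc N))))))))
        (lem s (P n) (𝕡 (suc N)) (𝕡 (2 + N)) (P (2 + N)) (P (suc N)) (𝕡 n) i))
    where
    l<n : suc N < n
    l<n = ≤-trans (m<m+n (suc N) (s≤s z≤n)) (≤-reflexive e)
    lem : ∀ s Pn l m Pm Pl pn i → s * (Pn * l) * m + ((s * (Pm * pn) + 3 * i * (m * pn)) * l + (3 * (m * l) + s * (Pl * m)) * pn) + 0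
      ≡ (s * (Pl * pn) + 3 * (1 + i) * (l * pn)) * m + (s * (Pn * m) * l + s * (Pm * l) * pn)
    lem = solve-∀

  -- A converse of `R-upper` up to a factor 1 + 3/s: `A-descent` weighted by p(l) and summed.
  P²-upper : s * (P n * P n) ≤ (s + 3) * (𝕡 n * R n) + 3 * (𝕡 n * P n)
  P²-upper = begin
    s * (P n * P n)                      ≡⟨ *-assoc s (P n) (P n) ⟨
    s * P n * P n                        ≡⟨ ∑-scale n (s * P n) 𝕡 ⟨
    ∑ n (λ l → s * P n * 𝕡 l)            ≤⟨ ∑-mono n (λ l l<n → ≤-trans (≤-reflexive (*-assoc s (P n) (𝕡 l)))
                                              (≤-trans (A-descent (n ∸ l) l (m+[n∸m]≡n (<⇒≤ l<n))) (≤-reflexive (lem s (P l) (𝕡 n) (n ∸ l) (𝕡 l))))) ⟩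
    ∑ n (λ l → s * 𝕡 n * P l + 3 * 𝕡 n * ((n ∸ l) * 𝕡 l))  ≡⟨ trans (∑-add n _ _) (cong₂ _+_ (∑-scale n (s * 𝕡 n) P) (∑-scale n (3 * 𝕡 n) _)) ⟩
    s * 𝕡 n * R n + 3 * 𝕡 n * ∑ n (λ l → (n ∸ l) * 𝕡 l)    ≡⟨ cong (λ z → s * 𝕡 n * R n + 3 * 𝕡 n * z) (W-reverse n) ⟩
    s * 𝕡 n * R n + 3 * 𝕡 n * (R n + P n)  ≡⟨ lem′ s (𝕡 n) (R n) (P n) ⟩
    (s + 3) * (𝕡 n * R n) + 3 * (𝕡 n * P n) ∎
    where
    open ≤-Reasoning
    lem : ∀ s P pn i l → s * (P * pn) + 3 * i * (l * pn) ≡ s * pn * P + 3 * pn * (i * l)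
    lem = solve-∀
    lem′ : ∀ s p R P → s * p * R + 3 * p * (R + P) ≡ (s + 3) * (p * R) + 3 * (p * P)
    lem′ = solve-∀

  -- `P²-upper` together with the bound on R from `p-lower` is a quadratic inequality for A(n). Its
  -- leading terms give A ≤ (2/3)^(1/2) s, about 0.817 s, below 5/6.
  A-upper : 6 * P n ≤ 5 * s * 𝕡 n
  A-upper = go (m≤n⇒∃[o]m+o≡n (≤-trans (s≤s (s≤s (s≤s z≤n))) s≥))
    where
    -- t = s - 3 because the terms in P p have net coefficient 18 (s + 3) - 108 = 18 (s - 3).
    go : (∃ λ t → 3 + t ≡ s) → 6 * P n ≤ 5 * s * 𝕡 n
    go (t , 3+t) with 6 * P n ≤? 5 * s * 𝕡 n
    ... | yes le = le
    ... | no nle = ⊥-elim (<-irrefl refl (<-≤-trans (≤-<-trans q₃ q₂) q₁))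
      where
      Z = 6 * P n
      Y = 5 * s * 𝕡 n
      Y<Z : Y < Z
      Y<Z = ≰⇒> nle
      q₁ : s * (Z * Z) + 3 * t * (𝕡 n * Z) ≤ 24 * n * (s + 3) * (𝕡 n * 𝕡 n)
      q₁ = ≤-by 0 (+-mono-≤ (+-mono-≤ (*-monoʳ-≤ 36 P²-upper) (*-monoˡ-≤ (6 * (s + 3) * 𝕡 n) (p-lower n))) (≤-reflexive (cong (λ z → 18 * z * (𝕡 n * P n)) 3+t)))
             (lem s (P n) (𝕡 n) (R n) n t)
        where lem : ∀ s P p R n t → s * (6 * P * (6 * P)) + 3 * t * (p * (6 * P)) + (36 * ((s + 3) * (p * R) + 3 * (p * P)) + 4 * (n * p) * (6 * (s + 3) * p) + 18 * s * (p * P)) + 0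
                      ≡ 24 * n * (s + 3) * (p * p) + (36 * (s * (P * P)) + (6 * R + 3 * P) * (6 * (s + 3) * p) + 18 * (3 + t) * (p * P))
              lem = solve-∀
      q₂ : s * (Y * Y) + 3 * t * (𝕡 n * Y) < s * (Z * Z) + 3 * t * (𝕡 n * Z)
      q₂ = +-mono-<-≤ (*-monoʳ-< s ⦃ >-nonZero (≤-trans (s≤s z≤n) s≥) ⦄ (*-mono-< Y<Z Y<Z)) (*-monoʳ-≤ (3 * t) (*-monoʳ-≤ (𝕡 n) (<⇒≤ Y<Z)))
      q₃ : 24 * n * (s + 3) * (𝕡 n * 𝕡 n) ≤ s * (Y * Y) + 3 * t * (𝕡 n * Y)
      q₃ = ≤-trans (*-monoˡ-≤ (𝕡 n * 𝕡 n) poly) (≤-reflexive (lem s t (𝕡 n)))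
        where
        lem : ∀ s t p → (s * s * s * 25 + s * t * 15) * (p * p) ≡ s * (5 * s * p * (5 * s * p)) + 3 * t * (p * (5 * s * p))
        lem = solve-∀
        poly : 24 * n * (s + 3) ≤ s * s * s * 25 + s * t * 15
        poly = ≤-by (s * s * 19 + s * 323) (+-mono-≤ (+-mono-≤ (*-monoˡ-≤ (24 * (s + 3)) n≤) (*-monoˡ-≤ s s·128≤s²)) (+-mono-≤ (*-monoˡ-≤ 4 s·128≤s²) (≤-reflexive (cong (λ z → s * z * 15) (sym 3+t)))))
                 (lem₁ n s t)
          where lem₁ : ∀ n s t → 24 * n * (s + 3) + ((s * s + 2 * s) * (24 * (s + 3)) + s * s * s + (s * s * 4 + s * (3 + t) * 15)) + (s * s * 19 + s * 323)
                         ≡ s * s * s * 25 + s * t * 15 + (n * (24 * (s + 3)) + s * 128 * s + (s * 128 * 4 + s * s * 15))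
                lem₁ = solve-∀

-- The induction step

-- A Bernoulli step of length t ≈ s/4 gains the factor 32/25.
gain : ∀ s u t b d → 3 + u ≡ s → 128 ≤ s → s ≤ 4 * t + 4 → 6 * (s * b) ≤ 5 * (s * s * d) + 18 * b → 7 * b ≤ 25 * (t * d)
gain s u t b d refl s≥ s≤ R = *-cancelʳ-≤ (7 * b) (25 * (t * d)) (4 * (s * s)) ⦃ >-nonZero (≤-trans (s≤s z≤n) (m≤n*m (s * s) 4)) ⦄
  (≤-by (b * u * 46 + b * 498) (+-mono-≤ (*-monoˡ-≤ (20 * t) R) (+-mono-≤ (*-monoˡ-≤ (30 * (u * b)) s≤) (*-monoˡ-≤ (2 * (b * s)) s≥)))
     (lem u t b d))
  where
  lem : ∀ u t b d → 7 * b * (4 * ((3 + u) * (3 + u))) + ((5 * ((3 + u) * (3 + u) * d) + 18 * b) * (20 * t) + ((4 * t + 4) * (30 * (u * b)) + (3 + u) * (2 * (b * (3 + u))))) + (b * u * 46 + b * 498)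
    ≡ 25 * (t * d) * (4 * ((3 + u) * (3 + u))) + (6 * ((3 + u) * b) * (20 * t) + ((3 + u) * (30 * (u * b)) + 128 * (2 * (b * (3 + u)))))
  lem = solve-∀

gain-iterated : ∀ s t a b → 25 * a ^ t ≥ 32 * b ^ t → 32 ^ s * b ^ (t * s) ≤ 25 ^ s * a ^ (t * s)
gain-iterated s t a b le = begin
  32 ^ s * b ^ (t * s)      ≡⟨ cong (32 ^ s *_) (^-*-assoc b t s) ⟨
  32 ^ s * (b ^ t) ^ s      ≡⟨ ^-scale 32 (b ^ t) s ⟨
  (32 * b ^ t) ^ s          ≤⟨ ^-monoˡ-≤ s le ⟩
  (25 * a ^ t) ^ s          ≡⟨ ^-scale 25 (a ^ t) s ⟩
  25 ^ s * (a ^ t) ^ s      ≡⟨ cong (25 ^ s *_) (^-*-assoc a t s) ⟩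
  25 ^ s * a ^ (t * s)      ∎
  where open ≤-Reasoning

abel-prefix-const : ∀ N c (u v h : ℕ → ℕ) → (∀ k → h (suc k) ≤ h k) → (∀ i → i ≤ N → ∑ i u ≤ ∑ i v + c) →
  ∑ N (λ k → u k * h k) ≤ ∑ N (λ k → v k * h k) + c * h 0
abel-prefix-const zero    c u v h h-dec prefix = z≤n
abel-prefix-const (suc N) c u v h h-dec prefix = ≤-trans (abel-prefix (suc N) u v′ h h-dec prefix′) (≤-reflexive eq)
  where
  v′ : ℕ → ℕ
  v′ zero    = v 0 + c
  v′ (suc k) = v (suc k)
  shift : ∀ i (f : ℕ → ℕ) → ∑ (suc i) (λ k → v′ k * f k) ≡ ∑ (suc i) (λ k → v k * f k) + c * f 0
  shift i f = trans (∑-head i _) (trans (lem (v 0) c (f 0) (∑ i (λ k → v (suc k) * f (suc k)))) (cong (_+ c * f 0) (sym (∑-head i (λ k → v k * f k)))))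
    where lem : ∀ v c f S → (v + c) * f + S ≡ v * f + S + c * f
          lem = solve-∀
  eq : ∑ (suc N) (λ k → v′ k * h k) ≡ ∑ (suc N) (λ k → v k * h k) + c * h 0
  eq = shift N h
  prefix′ : ∀ i → i ≤ suc N → ∑ i u ≤ ∑ i v′
  prefix′ zero    _   = z≤n
  prefix′ (suc i) i≤N = ≤-trans (prefix (suc i) i≤N) (≤-reflexive (sym (trans (unit v′) (trans (shift i (λ _ → 1)) (cong₂ _+_ (sym (unit v)) (*-identityʳ c))))))
    where unit : ∀ (f : ℕ → ℕ) → ∑ (suc i) f ≡ ∑ (suc i) (λ k → f k * 1)
          unit f = ∑-cong (suc i) λ k _ → sym (*-identityʳ (f k))

↓-shift : ∀ (f : ℕ → ℕ) j k m → (f ↓ (j + k)) (j + m) ≡ (f ↓ k) m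
↓-shift f zero    k m = refl
↓-shift f (suc j) k m = ↓-shift f j k m

-- K = floor(n/4) is where the sums are cut, and T′ + 1 = K - 1 is the number of indices from 2 to
-- K.
module Step (z s L K : ℕ) (s≥ : 128 ≤ s) (s²≤n : s * s ≤ 2 + z) (n≤ : 2 + z ≤ s * s + 2 * s) (8L≤s : 8 * L ≤ s) (n<2^L : 3 + z < 2 ^ L)
  (4K≤n : 4 * K ≤ 2 + z) (n<4K+4 : 2 + z < 4 * K + 4)
  (lc : LC (2 + z))
  (T′ : ℕ) (K≡ : 2 + T′ ≡ K) where
  n = 2 + z
  M = suc z
  open Ratios n s L s≥ s²≤n n≤ 8L≤s n<2^L lc

  a = 𝕡 n
  b = 𝕡 M
  h₁ = 𝕡 z
  d = a ∸ b

  b+d : b + d ≡ a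
  b+d = m+[n∸m]≡n (p-mono-step M)

  s>0 : 0 < s
  s>0 = ≤-trans (s≤s z≤n) s≥

  16384≤n : 16384 ≤ n
  16384≤n = ≤-trans (*-mono-≤ s≥ s≥) s²≤n

  d-upper : s * d ≤ 2 * b
  d-upper = ≤-by 0 (subst (λ w → 1 * s * w ≤ (1 * s + 2) * b) (sym b+d)
      (ratio-upper (1 * s) 2 ≤-refl (A-half ≤-refl (≤-trans s²≤n (m≤n*m n 2))))) (lem s b d)
    where lem : ∀ s b d → s * d + (1 * s + 2) * b + 0 ≡ 2 * b + 1 * s * (b + d)
          lem = solve-∀

  -- p(n)/p(n-1) - 1 ≥ 6/(5s) - 18/(5s²): it is at least (1 - 3/s)/A(n) by `slow`, and A(n) ≤ 5s/6.
  ratio-lower : 6 * (s * b) ≤ 5 * (s * s * d) + 18 * b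
  ratio-lower = *-cancelʳ-≤ _ _ a (≤-by 0 (+-mono-≤ (*-monoʳ-≤ 6 slow′) (*-monoˡ-≤ (s * d) A-upper)) eq)
    where
    slow′ : s * ((P M + b) * b) ≤ 3 * (a * b) + s * (P M * a)
    slow′ = Slow.slow z ≤-refl (≤-trans s²≤n (m≤n*m n 2))
    eq : 6 * (s * b) * a + (6 * (3 * (a * b) + s * (P M * a)) + 5 * s * a * (s * d)) + 0
      ≡ (5 * (s * s * d) + 18 * b) * a + (6 * (s * ((P M + b) * b)) + 6 * (P M + b) * (s * d))
    eq = trans (cong (λ w → 6 * (s * b) * w + (6 * (3 * (a * b) + s * (P M * w)) + 5 * s * a * (s * d)) + 0) (sym b+d)) (lem s b d a (P M))
      where lem : ∀ s b d a P → 6 * (s * b) * (b + d) + (6 * (3 * (a * b) + s * (P * (b + d))) + 5 * s * a * (s * d)) + 0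
                    ≡ (5 * (s * s * d) + 18 * b) * a + (6 * (s * ((P + b) * b)) + 6 * (P + b) * (s * d))
            lem = solve-∀

  growth-step : ∀ i j → j + i ≡ M → 1 ≤ j → 𝕡 j * a ^ i ≤ b * b ^ i
  growth-step zero    j e _   = ≤-reflexive (cong (λ w → 𝕡 w * 1) (trans (sym (+-identityʳ j)) e))
  growth-step (suc i) j e 1≤j = begin
    𝕡 j * (a * a ^ i)       ≡⟨ lem (𝕡 j) a (a ^ i) ⟩
    a * 𝕡 j * a ^ i         ≤⟨ *-monoˡ-≤ (a ^ i) (lc j M 1≤j (≤-trans (m≤m+n j (suc i)) (≤-reflexive e)) 26≤M ≤-refl) ⟩
    𝕡 (suc j) * b * a ^ i   ≡⟨ lem′ (𝕡 (suc j)) b (a ^ i) ⟩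
    b * (𝕡 (suc j) * a ^ i) ≤⟨ *-monoʳ-≤ b (growth-step i (suc j) (trans (sym (+-suc j i)) e) (s≤s z≤n)) ⟩
    b * (b * b ^ i)         ∎
    where
    open ≤-Reasoning
    26≤M : 26 ≤ M
    26≤M = s≤s⁻¹ (≤-trans (m≤m+n 27 16357) 16384≤n)
    lem : ∀ x a y → x * (a * y) ≡ a * x * y
    lem = solve-∀
    lem′ : ∀ x a y → x * a * y ≡ a * (x * y)
    lem′ = solve-∀

  -- Each ratio below n is at least p(n)/p(n-1), and t ≈ s/4 consecutive ratios gain 32/25. About
  -- n/4 steps contain s such blocks, so the gain is (32/25)^s ≥ 2 s⁶.
  growth : 2 * s ^ 6 * 𝕡 (n ∸ K) ≤ b
  growth = ≤-trans (*-monoʳ-≤ (2 * s ^ 6) (p-mono n∸K≤j)) (*-cancelˡ-≤ (25 ^ s) ⦃ m^n≢0 25 s ⦄ (*-cancelʳ-≤ _ _ (b ^ i) ⦃ m^n≢0 b i ⦄ (begin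
      25 ^ s * (2 * s ^ 6 * 𝕡 j) * b ^ i    ≡⟨ lem₁ (25 ^ s) (2 * s ^ 6) (𝕡 j) (b ^ i) ⟩
      25 ^ s * (2 * s ^ 6) * (𝕡 j * b ^ i)  ≤⟨ *-monoˡ-≤ (𝕡 j * b ^ i) exp≤ ⟩
      32 ^ s * (𝕡 j * b ^ i)                ≡⟨ lem₂ (32 ^ s) (𝕡 j) (b ^ i) ⟩
      32 ^ s * b ^ i * 𝕡 j                  ≤⟨ *-monoˡ-≤ (𝕡 j) (gain-iterated s t a b 32≤25) ⟩
      25 ^ s * a ^ i * 𝕡 j                  ≡⟨ lem₃ (25 ^ s) (a ^ i) (𝕡 j) ⟩
      25 ^ s * (𝕡 j * a ^ i)                ≤⟨ *-monoʳ-≤ (25 ^ s) (growth-step i j (m∸n+n≡m (<⇒≤ i<M)) (m<n⇒0<n∸m i<M)) ⟩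
      25 ^ s * (b * b ^ i)                  ≡⟨ *-assoc (25 ^ s) b (b ^ i) ⟨
      25 ^ s * b * b ^ i                    ∎)))
    where
    open ≤-Reasoning
    lem₁ : ∀ x y p b → x * (y * p) * b ≡ x * y * (p * b)
    lem₁ = solve-∀
    lem₂ : ∀ x p b → x * (p * b) ≡ x * b * p
    lem₂ = solve-∀
    lem₃ : ∀ x a p → x * a * p ≡ x * (p * a)
    lem₃ = solve-∀
    -- Rounded so that 4 t < s, which makes t s + 1 ≤ K.
    t = (s ∸ 1) / 4
    i = t * s
    j = M ∸ i
    s-1 : suc (s ∸ 1) ≡ s
    s-1 = m+[n∸m]≡n {1} s>0
    4t<s : t * 4 < s
    4t<s = ≤-trans (s≤s (m/n*n≤m (s ∸ 1) 4)) (≤-reflexive s-1)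
    s≤4t+4 : s ≤ 4 * t + 4
    s≤4t+4 = ≤-trans (≤-reflexive (sym s-1)) (≤-trans (/-next (s ∸ 1) 3) (≤-reflexive (lem t)))
      where lem : ∀ t → (1 + t) * 4 ≡ 4 * t + 4
            lem = solve-∀
    i+1≤K : i + 1 ≤ K
    i+1≤K = *-cancelˡ-≤ 4 (≤-by 121 (+-mono-≤ (+-mono-≤ s²≤n n<4K+4) (+-mono-≤ (*-monoˡ-≤ s 4t<s) s≥)) (lem t s K z))
      where lem : ∀ t s K z → 4 * (t * s + 1) + (2 + z + (4 * K + 4) + (s * s + s)) + 121 ≡ 4 * K + (s * s + (3 + z) + ((1 + t * 4) * s + 128))
            lem = solve-∀
    K<n : K < n
    K<n = *-cancelˡ-< 4 K n (≤-<-trans 4K≤n (≤-by (5 + 3 * z) (z≤n {0}) (lem z)))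
      where lem : ∀ z → 3 + z + 0 + (5 + 3 * z) ≡ 4 * (2 + z) + 0
            lem = solve-∀
    i<M : i < M
    i<M = s≤s⁻¹ (≤-trans (s≤s (≤-trans (≤-reflexive (+-comm 1 i)) i+1≤K)) K<n)
    n∸K≤j : n ∸ K ≤ j
    n∸K≤j = ∸-monoʳ-≤ n (≤-trans (≤-reflexive (+-comm 1 i)) i+1≤K)
    exp≤ : 25 ^ s * (2 * s ^ 6) ≤ 32 ^ s
    exp≤ = subst (λ w → 25 ^ w * (2 * w ^ 6) ≤ 32 ^ w) (m∸n+n≡m s≥) (exponential-beats-power (s ∸ 128))
    32≤25 : 32 * b ^ t ≤ 25 * a ^ t
    32≤25 = *-cancelʳ-≤ _ _ b (begin
      32 * b ^ t * b                     ≤⟨ ≤-by 0 (*-monoʳ-≤ (b ^ t) (gain s (s ∸ 3) t b d (m+[n∸m]≡n (≤-trans (s≤s (s≤s (s≤s z≤n))) s≥)) s≥ s≤4t+4 ratio-lower)) (lem (b ^ t) b t d) ⟩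
      25 * (b ^ t * (b + t * d))         ≤⟨ *-monoʳ-≤ 25 (bernoulli b d t) ⟩
      25 * ((b + d) ^ t * b)             ≡⟨ cong (λ w → 25 * (w ^ t * b)) b+d ⟩
      25 * (a ^ t * b)                   ≡⟨ *-assoc 25 (a ^ t) b ⟨
      25 * a ^ t * b                     ∎)
      where lem : ∀ B b t d → 32 * B * b + B * (25 * (t * d)) + 0 ≡ 25 * (B * (b + t * d)) + B * (7 * b)
            lem = solve-∀

  q h c : ℕ → ℕ
  q k = (𝕡 ↓ k) n
  h k = (𝕡 ↓ suc k) n
  c k = q k * b ∸ h k * a

  data At (k : ℕ) : Set where
    at : ∀ i → k + i ≡ M → q k ≡ 𝕡 (suc i) → h k ≡ 𝕡 i → At k

  at? : ∀ {k} → k ≤ M → At k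
  at? {k} k≤M = at (M ∸ k) e (trans (cong (λ w → (𝕡 ↓ k) (suc w)) (sym e)) (trans (cong (𝕡 ↓ k) (sym (+-suc k (M ∸ k)))) (↓-+ 𝕡 k (suc (M ∸ k)))))
                   (trans (cong (𝕡 ↓ k) (sym e)) (↓-+ 𝕡 k (M ∸ k)))
    where e : k + (M ∸ k) ≡ M
          e = m+[n∸m]≡n k≤M

  h-antitone : ∀ k → h (suc k) ≤ h k
  h-antitone k = p↓-antitone (suc k) n

  128≤n : 128 ≤ n
  128≤n = ≤-trans s≥ (≤-trans (m≤m*n s s ⦃ >-nonZero s>0 ⦄) s²≤n)

  K+30≤z : K + 30 ≤ z
  K+30≤z = *-cancelˡ-≤ 4 (≤-by 256 (+-mono-≤ 4K≤n (*-monoˡ-≤ 3 128≤n)) (lem K z))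
    where lem : ∀ K z → 4 * (K + 30) + (2 + z + (2 + z) * 3) + 256 ≡ 4 * z + (4 * K + 384)
          lem = solve-∀

  K≤M : K ≤ M
  K≤M = ≤-trans (m≤m+n K 30) (≤-trans K+30≤z (n≤1+n z))

  26≤z : 26 ≤ z
  26≤z = ≤-trans (m≤m+n 26 4) (≤-trans (m≤n+m 30 K) K+30≤z)

  large : ∀ {k i} → k ≤ K → k + i ≡ M → 26 ≤ i
  large {k} {i} k≤K e = +-cancelˡ-≤ k 26 i (≤-trans (+-monoˡ-≤ 26 k≤K) (≤-trans (+-monoʳ-≤ K (m≤m+n 26 4))
    (≤-trans K+30≤z (≤-trans (n≤1+n z) (≤-reflexive (sym e))))))

  c-eq : ∀ k → k ≤ K → c k + h k * a ≡ q k * b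
  c-eq k k≤K = go (at? (≤-trans k≤K K≤M))
    where
    go : At k → c k + h k * a ≡ q k * b
    go (at i e qe he) = m∸n+n≡m (subst₂ (λ u v → u * a ≤ v * b) (sym he) (sym qe)
      (≤-trans (≤-reflexive (*-comm (𝕡 i) a)) (lc i M (≤-trans (s≤s z≤n) (large k≤K e)) (≤-trans (m≤n+m i k) (≤-reflexive e)) (≤-trans 26≤z (n≤1+n z)) ≤-refl)))

  -- c(k)/(b h(k)) is the difference of the ratios at n - k and n. The first is at most 1 +
  -- 20/(13s), as A ≥ 13s/20 down to 3n/4; the second is bounded by `ratio-lower`. The difference is
  -- 22/(65s) + 234/(65s²).
  c-upper : ∀ k → k ≤ K → 65 * (s * s) * c k ≤ (22 * s + 234) * (b * h k)
  c-upper k k≤K = go (at? (≤-trans k≤K K≤M))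
    where
    go : At k → 65 * (s * s) * c k ≤ (22 * s + 234) * (b * h k)
    go (at i e qe he) = ≤-by 0 (+-mono-≤ (*-monoˡ-≤ (5 * (s * b)) ratio) (+-mono-≤ (*-monoˡ-≤ (13 * h k) ratio-lower) (≤-reflexive (cong (65 * (s * s) *_) (trans (cong (λ w → c k + h k * w) b+d) (c-eq k k≤K))))))
        (lem s (c k) (h k) b d (q k))
      where
      3s²≤ : 3 * (s * s) ≤ 4 * suc i
      3s²≤ = ≤-by 0 (+-mono-≤ (*-monoʳ-≤ 3 s²≤n) (+-mono-≤ (*-monoʳ-≤ 4 k≤K) (+-mono-≤ 4K≤n (≤-reflexive (cong (λ w → 4 * w + 4) (sym e)))))) (lem₁ s z k i K)
        where lem₁ : ∀ s z k i K → 3 * (s * s) + (3 * (2 + z) + (4 * K + (2 + z + (4 * (k + i) + 4)))) + 0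
                       ≡ 4 * (1 + i) + (3 * (s * s) + (4 * k + (4 * K + (4 * (1 + z) + 4))))
              lem₁ = solve-∀
      i<n : suc i ≤ n
      i<n = s≤s (≤-trans (m≤n+m i k) (≤-reflexive e))
      ratio : 13 * s * q k ≤ (13 * s + 20) * h k
      ratio = subst₂ (λ u v → 13 * s * u ≤ (13 * s + 20) * v) (sym qe) (sym he) (ratio-upper (13 * s) 20 i<n (A-three-quarters i<n 3s²≤))
      lem : ∀ s c h b d q → 65 * (s * s) * c + ((13 * s + 20) * h * (5 * (s * b)) + ((5 * (s * s * d) + 18 * b) * (13 * h) + 65 * (s * s) * (q * b))) + 0
        ≡ (22 * s + 234) * (b * h) + (13 * s * q * (5 * (s * b)) + (6 * (s * b) * (13 * h) + 65 * (s * s) * (c + h * (b + d))))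
      lem = solve-∀

  near-ratio : ∀ i → i < n → s * s ≤ suc i + 2 * s + 2 → 7 * s * 𝕡 (suc i) ≤ (7 * s + 10) * 𝕡 i
  near-ratio i i<n near = ratio-upper (7 * s) 10 i<n (A-near i<n near)

  -- Within about 2 s of n every increment of p is at most 10/(7s) of the value before it, and so of
  -- the larger p(i + x).
  near-linear : ∀ x i → i + x ≤ n → s * s ≤ suc i + 2 * s + 2 → 7 * s * 𝕡 (i + x) ≤ 7 * s * 𝕡 i + 10 * x * 𝕡 (i + x)
  near-linear zero    i le near = ≤-reflexive (trans (cong (λ w → 7 * s * 𝕡 w) (+-identityʳ i)) (sym (+-identityʳ _)))
  near-linear (suc x) i le near = subst (λ w → 7 * s * 𝕡 w ≤ 7 * s * 𝕡 i + 10 * suc x * 𝕡 w) (sym (+-suc i x))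
    (≤-by 0 (+-mono-≤ (near-ratio (i + x) le′ (≤-trans near (+-monoˡ-≤ 2 (+-monoˡ-≤ (2 * s) (s≤s (m≤m+n i x))))))
              (+-mono-≤ (near-linear x i (≤-trans (n≤1+n _) le′) near) (*-monoʳ-≤ (10 * suc x) (p-mono-step (i + x)))))
      (lem s (𝕡 (suc (i + x))) (𝕡 (i + x)) (𝕡 i) x))
    where
    le′ : suc (i + x) ≤ n
    le′ = ≤-trans (≤-reflexive (sym (+-suc i x))) le
    lem : ∀ s u v w x → 7 * s * u + ((7 * s + 10) * v + (7 * s * w + 10 * x * v + 10 * (1 + x) * u)) + 0
      ≡ 7 * s * w + 10 * (1 + x) * u + (7 * s * u + (7 * s * v + 10 * (1 + x) * v))
    lem = solve-∀

  near-half : ∀ x i → 20 * x ≤ 7 * s → i + x ≤ n → s * s ≤ suc i + 2 * s + 2 → 𝕡 (i + x) ≤ 2 * 𝕡 i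
  near-half x i 20x≤ le near = *-cancelˡ-≤ (7 * s) ⦃ m*n≢0 7 s ⦃ _ ⦄ ⦃ >-nonZero s>0 ⦄ ⦄
    (≤-by 0 (+-mono-≤ (*-monoʳ-≤ 2 (near-linear x i le near)) (*-monoˡ-≤ (𝕡 (i + x)) 20x≤)) (lem s (𝕡 (i + x)) (𝕡 i) x))
    where lem : ∀ s u w x → 7 * s * u + (2 * (7 * s * w + 10 * x * u) + 7 * s * u) + 0 ≡ 7 * s * (2 * w) + (2 * (7 * s * u) + 20 * x * u)
          lem = solve-∀

  -- Over this distance `near-linear` lets p at most double.
  t = 7 * s / 20

  20t≤7s : 20 * t ≤ 7 * s
  20t≤7s = ≤-trans (≤-reflexive (*-comm 20 t)) (m/n*n≤m (7 * s) 20)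

  near-halves : ∀ w x i → x ≤ w * t → i + x ≤ n → s * s ≤ suc i + 2 * s + 2 → 𝕡 (i + x) ≤ 2 ^ w * 𝕡 i
  near-halves zero    zero i _  le near = ≤-reflexive (trans (cong 𝕡 (+-identityʳ i)) (sym (+-identityʳ (𝕡 i))))
  near-halves (suc w) x i x≤ le near = go (cut t x) x≤ le
    where
    go : ∀ {x} → Cut t x → x ≤ suc w * t → i + x ≤ n → 𝕡 (i + x) ≤ 2 ^ suc w * 𝕡 i
    go {x} (below x<t) _ le = ≤-trans (near-half x i (≤-trans (*-monoʳ-≤ 20 (<⇒≤ x<t)) 20t≤7s) le near)
      (*-monoˡ-≤ (𝕡 i) (m≤m*n 2 (2 ^ w) ⦃ m^n≢0 2 w ⦄))
    go (above x′) x≤ le = begin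
      𝕡 (i + (t + x′))        ≡⟨ cong 𝕡 eq ⟩
      𝕡 (i + x′ + t)          ≤⟨ near-half t (i + x′) 20t≤7s (≤-trans (≤-reflexive (sym eq)) le) (≤-trans near (+-monoˡ-≤ 2 (+-monoˡ-≤ (2 * s) (s≤s (m≤m+n i x′))))) ⟩
      2 * 𝕡 (i + x′)          ≤⟨ *-monoʳ-≤ 2 (near-halves w x′ i (+-cancelˡ-≤ t x′ (w * t) x≤) (≤-trans (m≤m+n (i + x′) t) (≤-trans (≤-reflexive (sym eq)) le)) near) ⟩
      2 * (2 ^ w * 𝕡 i)       ≡⟨ *-assoc 2 (2 ^ w) (𝕡 i) ⟨
      2 ^ suc w * 𝕡 i         ∎
      where
      open ≤-Reasoning
      eq : i + (t + x′) ≡ i + x′ + t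
      eq = lem i t x′
        where lem : ∀ i t x → i + (t + x) ≡ i + x + t
              lem = solve-∀

  42≤t : 42 ≤ t
  42≤t = s≤s⁻¹ (*-cancelʳ-< 20 42 (suc t) (≤-trans (≤-trans (m≤m+n 841 55) (*-monoʳ-≤ 7 s≥)) (<⇒≤ (/-next (7 * s) 19))))

  2s≤6t : 2 * s ≤ 6 * t
  2s≤6t = *-cancelˡ-≤ 20 (≤-by (136) (+-mono-≤ (*-monoʳ-≤ 6 (<⇒≤ (/-next (7 * s) 19))) (*-monoˡ-≤ 2 s≥)) (lem s t))
    where lem : ∀ s t → 20 * (2 * s) + (6 * ((1 + t) * 20) + s * 2) + 136 ≡ 20 * (6 * t) + (6 * (7 * s) + 256)
          lem = solve-∀

  -- h(j) has halved at most w times when j ≤ w t, while j + 1 grows. It is enough to have j + 1 ≥ 3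
  -- for w = 1, 42 for w = 2 and 86 = 2 · 42 + 2 for w = 6; the last is tight, 3 · 86 = 258 against
  -- 4 · 64 = 256.
  h-lower : ∀ j → 2 ≤ j → j ≤ 2 * s → j ≤ M → 4 * b ≤ 3 * (suc j * h j)
  h-lower j 2≤j j≤2s j≤M = go (at? j≤M)
    where
    go : At j → 4 * b ≤ 3 * (suc j * h j)
    go (at i e _ he) = ≤-trans (bound (j ≤? t) (j ≤? 2 * t)) (≤-reflexive (cong (λ w → 3 * (suc j * w)) (sym he)))
      where
      near : s * s ≤ suc i + 2 * s + 2
      near = ≤-by 2 (+-mono-≤ s²≤n (+-mono-≤ j≤2s (≤-reflexive (sym e)))) (lem s i z j)
        where lem : ∀ s i z j → s * s + (2 + z + (2 * s + (j + i))) + 2 ≡ 1 + i + 2 * s + 2 + (s * s + (j + (1 + z)))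
              lem = solve-∀
      halves : ∀ w → j ≤ w * t → b ≤ 2 ^ w * 𝕡 i
      halves w j≤ = ≤-trans (≤-reflexive (cong 𝕡 (trans (sym e) (+-comm j i)))) (near-halves w j i j≤ (≤-trans (≤-reflexive (trans (+-comm i j) e)) (n≤1+n M)) near)
      finish : ∀ w x → 4 * 2 ^ w ≤ 3 * x → x ≤ suc j → b ≤ 2 ^ w * 𝕡 i → 4 * b ≤ 3 * (suc j * 𝕡 i)
      finish w x num x≤ b≤ = begin
        4 * b                  ≤⟨ *-monoʳ-≤ 4 b≤ ⟩
        4 * (2 ^ w * 𝕡 i)      ≡⟨ *-assoc 4 (2 ^ w) (𝕡 i) ⟨
        4 * 2 ^ w * 𝕡 i        ≤⟨ *-monoˡ-≤ (𝕡 i) (≤-trans num (*-monoʳ-≤ 3 x≤)) ⟩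
        3 * suc j * 𝕡 i        ≡⟨ *-assoc 3 (suc j) (𝕡 i) ⟩
        3 * (suc j * 𝕡 i)      ∎
        where open ≤-Reasoning
      bound : Dec (j ≤ t) → Dec (j ≤ 2 * t) → 4 * b ≤ 3 * (suc j * 𝕡 i)
      bound (yes j≤t) _           = finish 1 3 (m≤m+n 8 1) (s≤s 2≤j) (halves 1 (≤-trans j≤t (≤-reflexive (sym (*-identityˡ t)))))
      bound (no j≰t)  (yes j≤2t)  = finish 2 42 (m≤m+n 16 110) (≤-trans 42≤t (≤-trans (<⇒≤ (≰⇒> j≰t)) (n≤1+n j))) (halves 2 j≤2t)
      bound (no _)    (no j≰2t)   = finish 6 86 (m≤m+n 256 2) (s≤s (≤-trans (s≤s (*-monoʳ-≤ 2 42≤t)) (≰⇒> j≰2t))) (halves 6 (≤-trans j≤2s 2s≤6t))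

  A-upper-at : ∀ {m} → m ≤ n → 6 * P m ≤ 5 * s * 𝕡 m
  A-upper-at {m} m≤n = *-cancelʳ-≤ _ _ a (≤-by 0 (+-mono-≤ (*-monoʳ-≤ 6 (A-mono m≤n ≤-refl)) (*-monoˡ-≤ (𝕡 m) A-upper)) (lem (P m) a (P n) (𝕡 m) s))
    where lem : ∀ P a Q m s → 6 * P * a + (6 * (Q * m) + 5 * s * a * m) + 0 ≡ 5 * s * m * a + (6 * (P * a) + 6 * Q * m)
          lem = solve-∀

  R-upper-at : ∀ {m} → m ≤ n → 36 * R m ≤ 25 * (s * s) * 𝕡 m
  R-upper-at {m} m≤n = *-cancelʳ-≤ _ _ (𝕡 m) (≤-by 0 (+-mono-≤ (*-monoʳ-≤ 36 (R-upper m≤n)) (*-mono-≤ (A-upper-at m≤n) (A-upper-at m≤n))) (lem (R m) (𝕡 m) s (P m)))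
    where lem : ∀ R p s P → 36 * R * p + (36 * (P * P) + 5 * s * p * (5 * s * p)) + 0 ≡ 25 * (s * s) * p * p + (36 * (R * p) + 6 * P * (6 * P))
          lem = solve-∀

  K<2^L : K < 2 ^ L
  K<2^L = ≤-<-trans (≤-trans K≤M (n≤1+n M)) (<-trans (n<1+n n) n<2^L)

  -- By `C-short`, σ(j + 1 + i) may be replaced by (5/3)(i + j) plus logarithmic terms. With m = n -
  -- 1 - j this is (5/3)(R(m) + j P(m)), where P ≤ (5/6) s p, R ≤ (25/36) s² p and s ≤ j/2: about
  -- (0.58 + 1.39) s j h(j). The logarithmic terms add less than 0.2.
  Sh-upper : ∀ j o → j + o ≡ K → 2 * s ≤ j → 5 * ∑ o (λ i → σ (suc (j + i)) * h (suc (j + i))) ≤ 11 * s * (suc j * h j)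
  Sh-upper j o j+o 2s≤j = go (at? (≤-trans (≤-trans (m≤m+n j o) (≤-reflexive j+o)) K≤M))
    where
    S = ∑ o (λ i → σ (suc (j + i)) * h (suc (j + i)))
    go : At j → 5 * S ≤ 11 * s * (suc j * h j)
    go (at m e _ he) = subst (λ w → 5 * S ≤ 11 * s * (suc j * w)) (sym he) (*-cancelʳ-≤ (5 * S) (11 * s * (suc j * 𝕡 m)) 432
        (≤-by (j * 𝕡 m * s * 110 + 𝕡 m * s * s + j * 𝕡 m * 72 + 𝕡 m * s * 2352) (+-mono-≤ (*-monoˡ-≤ 360 abel) (+-mono-≤ (*-monoˡ-≤ 100 (R-upper-at m≤n)) (+-mono-≤ (*-monoˡ-≤ (60 * (10 * j + (8 + 6 * L))) (A-upper-at m≤n))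
          (+-mono-≤ (*-monoˡ-≤ (225 * s * 𝕡 m) 8L≤s) (+-mono-≤ (*-monoˡ-≤ (270 * j * 𝕡 m) 8L≤s) (+-mono-≤ (*-monoˡ-≤ (1363 * s * 𝕡 m) 2s≤j) (*-monoˡ-≤ (9 * j * 𝕡 m) s≥)))))))
          (lem S s j (𝕡 m) (R m) (P m) L)))
      where
      lem : ∀ S s j p R P L → 5 * S * 432 + ((10 * R + (10 * j + (8 + 6 * L)) * P + (6 * L + 3) * j * p) * 360 + (25 * (s * s) * p * 100 + (5 * s * p * (60 * (10 * j + (8 + 6 * L))) + (s * (225 * s * p) + (s * (270 * j * p) + (j * (1363 * s * p) + s * (9 * j * p))))))) + (j * p * s * 110 + p * s * s + j * p * 72 + p * s * 2352)
        ≡ 11 * s * ((1 + j) * p) * 432 + (6 * S * 360 + (36 * R * 100 + (6 * P * (60 * (10 * j + (8 + 6 * L))) + (8 * L * (225 * s * p) + (8 * L * (270 * j * p) + (2 * s * (1363 * s * p) + 128 * (9 * j * p)))))))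
      lem = solve-∀
      m≤n : m ≤ n
      m≤n = ≤-trans (m≤n+m m j) (≤-trans (≤-reflexive e) (n≤1+n M))
      o≤m : o ≤ m
      o≤m = +-cancelˡ-≤ j o m (≤-trans (≤-reflexive j+o) (≤-trans K≤M (≤-reflexive (sym e))))
      c₀ = (6 * L + 3) * j
      u v h′ : ℕ → ℕ
      u i = 6 * σ (suc (j + i))
      v i = 10 * i + (10 * j + (8 + 6 * L))
      h′ i = (𝕡 ↓ suc i) m
      h-eq : ∀ i → h (suc (j + i)) ≡ h′ i
      h-eq i = trans (cong₂ (λ x y → (𝕡 ↓ x) y) (sym (+-suc j i)) (sym e)) (↓-shift 𝕡 j (suc i) m)
      prefix : ∀ x → x ≤ o → ∑ x u ≤ ∑ x v + c₀
      prefix x x≤o = *-cancelˡ-≤ 2 (≤-by 0 (+-mono-≤ (*-monoʳ-≤ 2 (C-short L j (j + x) (2 * (j * x) + x * x) (m≤m+n j x)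
            (≤-<-trans (≤-trans (+-monoʳ-≤ j x≤o) (≤-reflexive j+o)) K<2^L) (sq j x))) (≤-reflexive (sym (∑-linear 10 (10 * j + (8 + 6 * L)) x))))
          (trans (cong (λ w → 2 * w + (2 * (6 * C j + 5 * (2 * (j * x) + x * x) + (j + x) * (6 * L + 3)) + (2 * ∑ x v + 10 * x)) + 0) (∑-scale x 6 _))
          (trans (lem₁ (∑ x (λ i → σ (suc (j + i)))) (C j) j x L (∑ x v))
                 (cong (λ w → 2 * (∑ x v + c₀) + (2 * (6 * w) + (10 * (x * x) + 2 * ((10 * j + (8 + 6 * L)) * x)))) (sym (∑-append (suc j) x σ))))))
        where
        sq : ∀ j x → (j + x) * (j + x) ≡ j * j + (2 * (j * x) + x * x)
        sq = solve-∀
        lem₁ : ∀ S C j x L V → 2 * (6 * S) + (2 * (6 * C + 5 * (2 * (j * x) + x * x) + (j + x) * (6 * L + 3)) + (2 * V + 10 * x)) + 0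
          ≡ 2 * (V + (6 * L + 3) * j) + (2 * (6 * (C + S)) + (10 * (x * x) + 2 * ((10 * j + (8 + 6 * L)) * x)))
        lem₁ = solve-∀
      abel : 6 * S ≤ 10 * R m + (10 * j + (8 + 6 * L)) * P m + (6 * L + 3) * j * 𝕡 m
      abel = begin
        6 * S                                            ≡⟨ ∑-scale o 6 _ ⟨
        ∑ o (λ i → 6 * (σ (suc (j + i)) * h (suc (j + i))))
          ≡⟨ ∑-cong o (λ i _ → trans (sym (*-assoc 6 (σ (suc (j + i))) (h (suc (j + i))))) (cong (u i *_) (h-eq i))) ⟩
        ∑ o (λ i → u i * h′ i)                           ≤⟨ abel-prefix-const o c₀ u v h′ (λ i → p↓-antitone (suc i) m) prefix ⟩
        ∑ o (λ i → v i * h′ i) + c₀ * h′ 0               ≤⟨ +-mono-≤ (∑-longer (λ i → v i * h′ i) o≤m) (*-monoʳ-≤ c₀ (p↓-≤ 1 m)) ⟩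
        ∑ m (λ i → v i * h′ i) + c₀ * 𝕡 m                ≡⟨ cong (_+ c₀ * 𝕡 m) (linear-reverse m 10 (10 * j + (8 + 6 * L))) ⟩
        10 * R m + (10 * j + (8 + 6 * L)) * P m + c₀ * 𝕡 m ∎
        where open ≤-Reasoning

  -- The terms beyond n/4

  z′ = n ∸ K
  pz = 𝕡 z′
  θ = suc n * L * (s * pz)

  K+z′ : K + z′ ≡ n
  K+z′ = m+[n∸m]≡n (≤-trans K≤M (n≤1+n M))

  -- One bound θ serves every tail: the weights are values of σ, at most (n + 1) L, and the values
  -- of p add up to at most p(0) + ⋯ + p(n-K) ≤ s p(n-K), as A ≤ 5s/6.
  tail-sum : ∀ w (u f : ℕ → ℕ) → w ≤ suc z′ → (∀ i → i < w → u i ≤ suc n * L) → (∀ i → f i ≤ q (K + i)) → ∑ w (λ i → u i * f i) ≤ θ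
  tail-sum w u f w≤ u≤ f≤ = begin
    ∑ w (λ i → u i * f i)                  ≤⟨ ∑-mono w (λ i i<w → *-mono-≤ (u≤ i i<w) (≤-trans (f≤ i) (≤-reflexive (trans (cong (𝕡 ↓ (K + i)) (sym K+z′)) (↓-shift 𝕡 K i z′))))) ⟩
    ∑ w (λ i → suc n * L * (𝕡 ↓ i) z′)     ≡⟨ ∑-scale w (suc n * L) _ ⟩
    suc n * L * ∑ w (λ i → (𝕡 ↓ i) z′)     ≤⟨ *-monoʳ-≤ (suc n * L) (≤-trans (∑-longer (λ i → (𝕡 ↓ i) z′) w≤) (≤-trans (≤-reflexive (P-reverse (suc z′))) P≤)) ⟩
    θ                                      ∎
    where
    open ≤-Reasoning
    P≤ : P z′ + pz ≤ s * pz
    P≤ = *-cancelˡ-≤ 6 (≤-by (122 * pz) (+-mono-≤ (A-upper-at (m∸n≤m n K)) (*-monoˡ-≤ pz s≥)) (lem (P z′) pz s))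
      where lem : ∀ P p s → 6 * (P + p) + (5 * s * p + s * p) + 122 * p ≡ 6 * (s * p) + (6 * P + 128 * p)
            lem = solve-∀

  σ≤ : ∀ k → k ≤ suc n → σ k ≤ suc n * L
  σ≤ k k≤ = ≤-trans (σ-upper L k (≤-<-trans k≤ n<2^L)) (*-monoˡ-≤ L k≤)

  s⁶ : s ^ 6 ≡ s * s * (s * s) * (s * s)
  s⁶ = lem s
    where lem : ∀ s → s * (s * (s * (s * (s * (s * 1))))) ≡ s * s * (s * s) * (s * s)
          lem = solve-∀

  growth′ : s * s * (s * s) * (s * s) * pz * 2 ≤ b
  growth′ = ≤-trans (≤-reflexive (trans (lem (s * s * (s * s) * (s * s)) pz) (cong (λ w → 2 * w * pz) (sym s⁶)))) growth
    where lem : ∀ x p → x * p * 2 ≡ 2 * x * p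
          lem = solve-∀

  8θ≤ : 8 * θ ≤ suc n * (s * s) * pz
  8θ≤ = ≤-by 0 (*-monoˡ-≤ (suc n * (s * pz)) 8L≤s) (lem n L s pz)
    where lem : ∀ n L s p → 8 * ((1 + n) * L * (s * p)) + s * ((1 + n) * (s * p)) + 0 ≡ (1 + n) * (s * s) * p + 8 * L * ((1 + n) * (s * p))
          lem = solve-∀

  6θ≤b : 6 * θ ≤ b
  6θ≤b = *-cancelˡ-≤ 8 (begin
    8 * (6 * θ)                                    ≡⟨ lem₁ θ ⟩
    6 * (8 * θ)                                    ≤⟨ *-monoʳ-≤ 6 8θ≤ ⟩
    6 * (suc n * (s * s) * pz)                     ≤⟨ *-monoʳ-≤ 6 (*-monoˡ-≤ pz (*-monoˡ-≤ (s * s) n+1≤)) ⟩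
    6 * (s * s * 2 * (s * s) * pz)                 ≡⟨ lem₂ (s * s) pz ⟩
    s * s * (s * s) * 1 * pz * 12                  ≤⟨ *-mono-≤ (*-monoˡ-≤ pz (*-monoʳ-≤ (s * s * (s * s)) (*-mono-≤ s>0 s>0))) (m≤m+n 12 4) ⟩
    s * s * (s * s) * (s * s) * pz * 16            ≡⟨ lem₃ (s * s * (s * s) * (s * s) * pz) ⟩
    8 * (s * s * (s * s) * (s * s) * pz * 2)       ≤⟨ *-monoʳ-≤ 8 growth′ ⟩
    8 * b                                          ∎)
    where
    open ≤-Reasoning
    n+1≤ : suc n ≤ s * s * 2
    n+1≤ = ≤-by (s * 125 + 127) (+-mono-≤ n≤ (+-mono-≤ s·128≤s² s≥)) (lem z s)
      where lem : ∀ z s → 3 + z + (s * s + 2 * s + (s * s + s)) + (s * 125 + 127) ≡ s * s * 2 + (2 + z + (s * 128 + 128))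
            lem = solve-∀
    lem₁ : ∀ θ → 8 * (6 * θ) ≡ 6 * (8 * θ)
    lem₁ = solve-∀
    lem₂ : ∀ x p → 6 * (x * 2 * x * p) ≡ x * x * 1 * p * 12
    lem₂ = solve-∀
    lem₃ : ∀ x → x * 16 ≡ 8 * (x * 2)
    lem₃ = solve-∀

  -- The denominator of the surplus: the goal is b Y2 + (a b / w) Y0 ≤ a Y1. The factor 6 keeps the
  -- surplus within the margin 4/3 of `h-lower`.
  w = 6 * (n * h₁)

  K≤n : K ≤ n
  K≤n = ≤-trans K≤M (n≤1+n M)

  K≤z : K ≤ z
  K≤z = ≤-trans (m≤m+n K 30) K+30≤z

  rec-n : n * a ≡ ∑ n (λ k → σ (suc k) * q (suc k))
  rec-n = σ-recurrence′ n

  rec-M : M * b ≡ ∑ M (λ k → σ (suc k) * h (suc k))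
  rec-M = σ-recurrence′ M

  rec-z : z * h₁ ≡ ∑ z (λ k → σ (suc k) * h (2 + k))
  rec-z = σ-recurrence′ z

  cut-tail : ∀ T N (u f : ℕ → ℕ) → T ≤ N → N ∸ T ≤ suc z′ → (∀ k → k < N → u k ≤ suc n * L) → (∀ i → f (T + i) ≤ q (K + i)) →
    ∑ N (λ k → u k * f k) ≤ ∑ T (λ k → u k * f k) + θ
  cut-tail T N u f T≤N len u≤ f≤ = begin
    ∑ N (λ k → u k * f k)                                                 ≡⟨ cong (λ x → ∑ x (λ k → u k * f k)) (m+[n∸m]≡n T≤N) ⟨
    ∑ (T + (N ∸ T)) (λ k → u k * f k)                                     ≡⟨ ∑-append T (N ∸ T) _ ⟩
    ∑ T (λ k → u k * f k) + ∑ (N ∸ T) (λ i → u (T + i) * f (T + i))       ≤⟨ +-monoʳ-≤ _ (tail-sum (N ∸ T) (λ i → u (T + i)) (λ i → f (T + i)) len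
                                                                               (λ i i< → u≤ (T + i) (≤-trans (+-monoʳ-< T i<) (≤-reflexive (m+[n∸m]≡n T≤N)))) f≤) ⟩
    ∑ T (λ k → u k * f k) + θ                                             ∎
    where open ≤-Reasoning

  q-antitone : ∀ k → q (suc k) ≤ q k
  q-antitone k = p↓-antitone k n

  -- b times the recurrence for n minus a times the one for n - 1 leaves n a b - (n - 1) a b; θ
  -- covers the tail that is dropped.
  Sc-total : ∑ K (λ k → σ (suc k) * c (suc k)) ≤ a * b + a * θ
  Sc-total = ≤-by 0 (+-mono-≤ (+-mono-≤ (≤-reflexive (∑-ratio K (σ ∘ suc) (c ∘ suc) (h ∘ suc) (q ∘ suc) a b λ k k<K → c-eq (suc k) k<K))
                                        (*-monoˡ-≤ b (≤-trans (∑-longer (λ k → σ (suc k) * q (suc k)) K≤n) (≤-reflexive (sym rec-n)))))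
                              (*-monoˡ-≤ a (≤-trans (≤-reflexive rec-M) (cut-tail K M (σ ∘ suc) (h ∘ suc) K≤M (≤-trans (∸-monoˡ-≤ K (n≤1+n M)) (n≤1+n z′))
                                 (λ k k<M → σ≤ (suc k) (≤-trans k<M (≤-trans (n≤1+n M) (n≤1+n n)))) (λ i → ≤-trans (q-antitone (suc (K + i))) (q-antitone (K + i)))))))
               (lem (∑ K (λ k → σ (suc k) * c (suc k))) (∑ K (λ k → σ (suc k) * h (suc k))) (∑ K (λ k → σ (suc k) * q (suc k))) a b θ z)
    where lem : ∀ X Y Z a b θ z → X + (Z * b + (2 + z) * a * b + (Y + θ) * a) + 0 ≡ a * b + a * θ + (X + Y * a + Z * b + (1 + z) * b * a)
          lem = solve-∀

  b≤2h₁ : b ≤ 2 * h₁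
  b≤2h₁ = subst₂ (λ u v → u ≤ v * h₁) (trans (cong (b *_) 𝕡-1) (*-identityʳ b)) 𝕡-2 (lc 1 z (s≤s z≤n) (≤-trans (m≤m+n 1 25) 26≤z) 26≤z (n≤1+n M))

  module Core (j o : ℕ) (j+o : 2 + j + o ≡ K) where
    J = 2 + j
    H = suc J * h J
    Sc = ∑ o (λ k → σ (suc (J + k)) * c (suc (J + k)))
    Sh = ∑ o (λ k → σ (suc (J + k)) * h (suc (J + k)))
    S0 = ∑ (suc o) (λ k → σ (suc (j + k)) * h (J + k))

    J≤K : J ≤ K
    J≤K = ≤-trans (m≤m+n J o) (≤-reflexive j+o)

    J≤M : J ≤ M
    J≤M = ≤-trans J≤K K≤M

    -- The whole sum Σ σ c stands in for its part beyond J. The margin is 4/3 = 1 + 1/6 + 1/6: a b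
    -- itself, a θ ≤ a b / 6, and the surplus a b S0 ≤ w a b / 6. `h-lower` provides (J + 1) h(J) ≥
    -- 4b/3.
    core-low : J ≤ 2 * s → w * Sc + a * b * S0 ≤ w * (a * (σ J * h J))
    core-low J≤2s = ≤-trans (≤-by (a * b * h₁ * 2) (+-mono-≤ (+-mono-≤ (*-monoʳ-≤ w Sc≤) (*-monoʳ-≤ (a * b) S0≤)) (+-mono-≤ (*-monoʳ-≤ (n * (h₁ * a)) 6θ≤b) (*-monoʳ-≤ (2 * (n * (h₁ * a))) (h-lower J (s≤s (s≤s z≤n)) J≤2s J≤M))))
                       (lem h₁ Sc a b S0 θ z H))
                     (*-monoʳ-≤ w (*-monoʳ-≤ a (*-monoˡ-≤ (h J) (σ-lower′ J (s≤s (s≤s z≤n))))))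
      where
      Sc≤ : Sc ≤ a * b + a * θ
      Sc≤ = ≤-trans (m≤n+m Sc (∑ J (λ k → σ (suc k) * c (suc k)))) (≤-trans (≤-reflexive (sym (∑-append J o (λ k → σ (suc k) * c (suc k)))))
              (≤-trans (≤-reflexive (cong (λ x → ∑ x (λ k → σ (suc k) * c (suc k))) j+o)) Sc-total))
      S0≤ : S0 ≤ z * h₁
      S0≤ = begin
        S0                                                                                   ≤⟨ m≤n+m S0 (∑ j (λ k → σ (suc k) * h (2 + k))) ⟩
        ∑ j (λ k → σ (suc k) * h (2 + k)) + S0                                               ≡⟨ ∑-append j (suc o) (λ k → σ (suc k) * h (2 + k)) ⟨
        ∑ (j + suc o) (λ k → σ (suc k) * h (2 + k))                                          ≤⟨ ∑-longer _ (≤-trans (≤-reflexive (+-suc j o)) (≤-trans (n≤1+n _) (≤-trans (≤-reflexive j+o) K≤z))) ⟩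
        ∑ z (λ k → σ (suc k) * h (2 + k))                                                    ≡⟨ rec-z ⟨
        z * h₁                                                                               ∎
        where open ≤-Reasoning
      lem : ∀ g Sc a b S0 θ z H → 6 * ((2 + z) * g) * Sc + a * b * S0 + (6 * ((2 + z) * g) * (a * b + a * θ) + a * b * (z * g) + ((2 + z) * (g * a) * b + 2 * ((2 + z) * (g * a)) * (3 * H))) + (a * b * g * 2)
        ≡ 6 * ((2 + z) * g) * (a * H) + (6 * ((2 + z) * g) * Sc + a * b * S0 + ((2 + z) * (g * a) * (6 * θ) + 2 * ((2 + z) * (g * a)) * (4 * b)))
      lem = solve-∀

    module High (2s≤J : 2 * s ≤ J) where
      Sh≤ : 5 * Sh ≤ 11 * s * H
      Sh≤ = Sh-upper J o j+o 2s≤J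

      -- The product of the two constants: (22/65)(11/5) = 242/325. The correction 234/(65 s²) in
      -- `c-upper` adds less than 21/325, because s ≥ 128.
      Sc-high : 325 * Sc ≤ 263 * (b * H)
      Sc-high = *-cancelʳ-≤ (325 * Sc) (263 * (b * H)) (s * s) ⦃ m*n≢0 s s ⦃ >-nonZero s>0 ⦄ ⦃ >-nonZero s>0 ⦄ ⦄
          (≤-by (H * b * s * 114) (+-mono-≤ (*-monoˡ-≤ 5 Sc-c) (+-mono-≤ (*-monoˡ-≤ ((22 * s + 234) * b) Sh≤) (*-monoˡ-≤ (21 * (s * (b * H))) s≥))) (lem Sc s b H Sh))
        where
        lem : ∀ Sc s b H Sh → 325 * Sc * (s * s) + ((22 * s + 234) * (b * Sh) * 5 + (11 * s * H * ((22 * s + 234) * b) + s * (21 * (s * (b * H))))) + (H * b * s * 114)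
          ≡ 263 * (b * H) * (s * s) + (65 * (s * s) * Sc * 5 + (5 * Sh * ((22 * s + 234) * b) + 128 * (21 * (s * (b * H)))))
        lem = solve-∀
        Sc-c : 65 * (s * s) * Sc ≤ (22 * s + 234) * (b * Sh)
        Sc-c = begin
          65 * (s * s) * Sc    ≡⟨ ∑-scale o (65 * (s * s)) _ ⟨
          ∑ o (λ k → 65 * (s * s) * (σ (suc (J + k)) * c (suc (J + k))))
            ≤⟨ ∑-mono o (λ k k<o → ≤-trans (≤-reflexive (swap (65 * (s * s)) (σ (suc (J + k))) (c (suc (J + k)))))
                 (≤-trans (*-monoʳ-≤ (σ (suc (J + k))) (c-upper (suc (J + k)) (≤-trans (+-monoʳ-< J k<o) (≤-reflexive j+o))))
                   (≤-reflexive (swap′ (σ (suc (J + k))) (22 * s + 234) b (h (suc (J + k))))))) ⟩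
          ∑ o (λ k → (22 * s + 234) * b * (σ (suc (J + k)) * h (suc (J + k))))  ≡⟨ ∑-scale o ((22 * s + 234) * b) _ ⟩
          (22 * s + 234) * b * Sh     ≡⟨ *-assoc (22 * s + 234) b Sh ⟩
          (22 * s + 234) * (b * Sh)   ∎
          where
          open ≤-Reasoning
          swap : ∀ x y z → x * (y * z) ≡ y * (x * z)
          swap = solve-∀
          swap′ : ∀ x y b z → x * (y * (b * z)) ≡ y * b * (x * z)
          swap′ = solve-∀

      8σ≤ : ∀ k → k ≤ J → 8 * σ k ≤ s * J
      8σ≤ k k≤J = ≤-by 0 (+-mono-≤ (*-monoʳ-≤ 8 (≤-trans (σ-upper L k (≤-<-trans (≤-trans k≤J J≤K) K<2^L)) (*-monoˡ-≤ L k≤J))) (*-monoˡ-≤ J 8L≤s)) (lem (σ k) J L s)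
        where lem : ∀ σ J L s → 8 * σ + (8 * (J * L) + s * J) + 0 ≡ s * J + (8 * σ + 8 * L * J)
              lem = solve-∀

      S0-high : 40 * S0 ≤ 98 * (s * H)
      S0-high = ≤-by (h J * s * 10) (+-mono-≤ (*-monoˡ-≤ 40 S0≤) (+-mono-≤ (*-monoˡ-≤ (5 * h J) (8σ≤ (suc j) (n≤1+n (suc j)))) (+-mono-≤ (*-monoˡ-≤ (5 * h J) (8σ≤ J ≤-refl)) (*-monoˡ-≤ 8 Sh≤))))
          (lem S0 s J (h J) (σ (suc j)) (σ J) Sh)
        where
        lem : ∀ S0 s J h u v Sh → 40 * S0 + (((u + v) * h + Sh) * 40 + (s * J * (5 * h) + (s * J * (5 * h) + 11 * s * ((1 + J) * h) * 8))) + (h * s * 10)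
          ≡ 98 * (s * ((1 + J) * h)) + (S0 * 40 + (8 * u * (5 * h) + (8 * v * (5 * h) + 5 * Sh * 8)))
        lem = solve-∀
        S0≤ : S0 ≤ (σ (suc j) + σ J) * h J + Sh
        S0≤ = begin
          S0     ≡⟨ ∑-head o (λ k → σ (suc (j + k)) * h (J + k)) ⟩
          σ (suc (j + 0)) * h (J + 0) + ∑ o (λ k → σ (suc (j + suc k)) * h (J + suc k))
            ≤⟨ +-mono-≤ (≤-reflexive (cong (λ x → σ (suc x) * h (2 + x)) (+-identityʳ j)))
                 (∑-mono o (λ k _ → *-mono-≤ (≤-reflexive (cong (λ x → σ (suc x)) (+-suc j k))) (≤-trans (≤-reflexive (cong h (+-suc J k))) (h-antitone (J + k))))) ⟩
          σ (suc j) * h J + ∑ o (λ k → σ (J + k) * h (J + k))        ≤⟨ +-monoʳ-≤ (σ (suc j) * h J) (m≤m+n _ _) ⟩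
          σ (suc j) * h J + ∑ (suc o) (λ k → σ (J + k) * h (J + k))  ≡⟨ cong (σ (suc j) * h J +_) (∑-head o (λ k → σ (J + k) * h (J + k))) ⟩
          σ (suc j) * h J + (σ (J + 0) * h (J + 0) + ∑ o (λ k → σ (J + suc k) * h (J + suc k)))
            ≡⟨ cong₂ (λ x y → σ (suc j) * h J + (x + y)) (cong (λ x → σ x * h x) (+-identityʳ J)) (∑-cong o λ k _ → cong (λ x → σ x * h x) (+-suc J k)) ⟩
          σ (suc j) * h J + (σ J * h J + Sh)   ≡⟨ eq (σ (suc j)) (h J) (σ J) Sh ⟩
          (σ (suc j) + σ J) * h J + Sh         ∎
          where open ≤-Reasoning
                eq : ∀ u h v S → u * h + (v * h + S) ≡ (u + v) * h + S
                eq = solve-∀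

      -- The first term takes the fraction 263/325. The surplus is of relative size s/n, hence
      -- negligible: S0 ≤ (98/40) s H, b ≤ 2 h₁ and n ≥ 128 s.
      core-high : w * Sc + a * b * S0 ≤ w * (a * (σ J * h J))
      core-high = ≤-trans (*-cancelʳ-≤ (w * Sc + a * b * S0) (w * (a * H)) 13000
          (subst (λ x → (w * Sc + x * b * S0) * 13000 ≤ w * (x * H) * 13000) b+d
            (≤-by (H * b * h₁ * n * 14382 + H * b * h₁ * s * 44 + H * d * h₁ * n * 77502 + H * d * h₁ * s * 44) (+-mono-≤ (*-monoˡ-≤ (240 * (n * h₁)) Sc-high) (+-mono-≤ (*-monoˡ-≤ (325 * ((b + d) * b)) S0-high)
              (+-mono-≤ (*-monoˡ-≤ (31850 * (s * (b + d) * H)) b≤2h₁) (*-monoˡ-≤ (498 * ((b + d) * (h₁ * H))) (≤-trans s·128≤s² s²≤n)))))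
              (lem n h₁ Sc b d S0 H s))))
          (*-monoʳ-≤ w (*-monoʳ-≤ a (*-monoˡ-≤ (h J) (σ-lower′ J (s≤s (s≤s z≤n))))))
        where
        lem : ∀ n g Sc b d S0 H s → (6 * (n * g) * Sc + (b + d) * b * S0) * 13000 + (263 * (b * H) * (240 * (n * g)) + (98 * (s * H) * (325 * ((b + d) * b)) + (2 * g * (31850 * (s * (b + d) * H)) + n * (498 * ((b + d) * (g * H)))))) + (H * b * g * n * 14382 + H * b * g * s * 44 + H * d * g * n * 77502 + H * d * g * s * 44)
          ≡ 6 * (n * g) * ((b + d) * H) * 13000 + (325 * Sc * (240 * (n * g)) + (40 * S0 * (325 * ((b + d) * b)) + (b * (31850 * (s * (b + d) * H)) + s * 128 * (498 * ((b + d) * (g * H))))))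
        lem = solve-∀

    core : w * Sc + a * b * S0 ≤ w * (a * (σ J * h J))
    core = go (J ≤? 2 * s)
      where
      go : Dec (J ≤ 2 * s) → w * Sc + a * b * S0 ≤ w * (a * (σ J * h J))
      go (yes J≤2s) = core-low J≤2s
      go (no J≰2s)  = High.core-high (<⇒≤ (≰⇒> J≰2s))

  -- Combining the recurrences

  T = suc T′
  a′ = 𝕡 (suc n)

  T≤K : T ≤ K
  T≤K = ≤-trans (n≤1+n T) (≤-reflexive K≡)

  T≤z : T ≤ z
  T≤z = ≤-trans T≤K K≤z

  -- The sequence c for n - 1 in place of n, with its index moved by one.
  y : ℕ → ℕ
  y k = q k * h₁ ∸ h k * b

  in-range : ∀ {t} → t < T → 2 + t ≤ K
  in-range t<T = ≤-trans (s≤s t<T) (≤-reflexive K≡)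

  y-eq : ∀ t → t < T → y (2 + t) + h (2 + t) * b ≡ q (2 + t) * h₁
  y-eq t t<T = go (at? (≤-trans (in-range t<T) K≤M))
    where
    go : At (2 + t) → y (2 + t) + h (2 + t) * b ≡ q (2 + t) * h₁
    go (at i e qe he) = m∸n+n≡m (subst₂ (λ u v → u * b ≤ v * h₁) (sym he) (sym qe)
      (≤-trans (≤-reflexive (*-comm (𝕡 i) b)) (lc i z (≤-trans (s≤s z≤n) (large (in-range t<T) e))
        (≤-trans (m≤n+m i (suc t)) (≤-reflexive (suc-injective e))) 26≤z (n≤1+n M))))

  y-mono : ∀ t → suc t < T → y (2 + t) * h (3 + t) ≤ y (3 + t) * h (2 + t)
  y-mono t t<T = ratio-sub {y (2 + t)} {h (2 + t)} {q (2 + t)} {y (3 + t)} {h (3 + t)} {q (3 + t)} b h₁ (y-eq t (<-trans (n<1+n t) t<T)) (y-eq (suc t) t<T)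
      (go (at? (≤-trans (in-range (<-trans (n<1+n t) t<T)) K≤M)) (at? (≤-trans (in-range t<T) K≤M)))
    where
    go : At (2 + t) → At (3 + t) → q (2 + t) * h (3 + t) ≤ q (3 + t) * h (2 + t)
    go (at i e qe he) (at i′ e′ qe′ he′) = subst₂ _≤_ (sym (cong₂ _*_ qe he′)) (sym (cong₂ _*_ qe′ he))
      (lc i′ i (≤-trans (s≤s z≤n) (large (in-range t<T) e′))
        (≤-trans (n≤1+n i′) (≤-reflexive (+-cancelˡ-≡ (2 + t) (suc i′) i (trans (+-suc (2 + t) i′) (trans e′ (sym e))))))
        (large (in-range (<-trans (n<1+n t) t<T)) e) (s≤s (≤-trans (m≤n+m i (2 + t)) (≤-reflexive e))))

  h-pos : ∀ t → t < T → 0 < h (2 + t)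
  h-pos t t<T = go (at? (≤-trans (in-range t<T) K≤M))
    where go : At (2 + t) → 0 < h (2 + t)
          go (at i _ _ he) = subst (0 <_) (sym he) (p-pos i)

  trunc : ∀ k → Dec (k ≤ K) → ℕ
  trunc k (yes _) = σ k
  trunc k (no _)  = 0

  -- σ cut off above K: the term k = K + 1 belongs to the tail.
  u : ℕ → ℕ
  u k = trunc k (k ≤? K)

  u-in : ∀ {k} → k ≤ K → u k ≡ σ k
  u-in {k} k≤K with k ≤? K
  ... | yes _   = refl
  ... | no k≰K  = ⊥-elim (k≰K k≤K)

  u-out : u (suc K) ≡ 0
  u-out with suc K ≤? K
  ... | yes K<K = ⊥-elim (<-irrefl refl K<K)
  ... | no _    = refl

  α β : ℕ → ℕ
  α t = w * a * σ (2 + t)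
  β t = w * b * u (3 + t) + a * b * σ (1 + t)

  -- As h(k) = q(k + 1), `c-eq` turns b Σ σ(k+1) h(k) into Σ σ(k+1) c(k+1) + a Σ σ(k+1) h(k+1). The
  -- last sum cancels against all terms of α but the first, and `core` is what is left.
  suffix : ∀ j o → j + o ≡ T → ∑ o (λ k → β (j + k) * h (2 + (j + k))) ≤ ∑ o (λ k → α (j + k) * h (2 + (j + k)))
  suffix j zero    e = z≤n
  suffix j (suc o) e = begin
      ∑ (suc o) (λ k → β (j + k) * h (J + k))
        ≡⟨ ∑-cong (suc o) (λ k _ → split (w * b) (u (suc (J + k))) (a * b) (σ (suc (j + k))) (h (J + k))) ⟩
      ∑ (suc o) (λ k → w * b * (u (suc (J + k)) * h (J + k)) + a * b * (σ (suc (j + k)) * h (J + k)))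
        ≡⟨ trans (∑-add (suc o) _ _) (cong₂ _+_ (∑-scale (suc o) (w * b) _) (∑-scale (suc o) (a * b) _)) ⟩
      w * b * (∑ o (λ k → u (suc (J + k)) * h (J + k)) + u (suc (J + o)) * h (J + o)) + a * b * S0
        ≡⟨ cong₂ (λ x y → w * b * (x + y) + a * b * S0)
             (∑-cong o (λ k k<o → cong (_* h (J + k)) (u-in (≤-trans (+-monoʳ-< J k<o) (≤-reflexive j+o)))))
             (cong (_* h (J + o)) (trans (cong (u ∘ suc) j+o) u-out)) ⟩
      w * b * (∑ o (λ k → σ (suc (J + k)) * h (J + k)) + 0) + a * b * S0
        ≡⟨ eq₁ w b (∑ o (λ k → σ (suc (J + k)) * h (J + k))) (a * b * S0) ⟩
      w * (∑ o (λ k → σ (suc (J + k)) * h (J + k)) * b) + a * b * S0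
        ≡⟨ cong (λ x → w * x + a * b * S0) (∑-ratio o (λ k → σ (suc (J + k))) (λ k → c (suc (J + k))) (λ k → h (suc (J + k))) (λ k → h (J + k)) a b
             (λ k k<o → c-eq (suc (J + k)) (≤-trans (+-monoʳ-< J k<o) (≤-reflexive j+o)))) ⟨
      w * (Sc + Sh * a) + a * b * S0
        ≡⟨ eq₂ w Sc Sh a (a * b * S0) ⟩
      w * Sc + a * b * S0 + w * a * Sh    ≤⟨ +-monoˡ-≤ (w * a * Sh) core ⟩
      w * (a * (σ J * h J)) + w * a * Sh  ≡⟨ eq₃ w a (σ J * h J) Sh ⟩
      w * a * (σ J * h J + Sh)
        ≡⟨ cong₂ (λ x y → w * a * (x + y)) (cong (λ x → σ x * h x) (+-identityʳ J)) (∑-cong o λ k _ → cong (λ x → σ x * h x) (+-suc J k)) ⟨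
      w * a * (σ (J + 0) * h (J + 0) + ∑ o (λ k → σ (J + suc k) * h (J + suc k)))
        ≡⟨ cong (w * a *_) (∑-head o (λ k → σ (J + k) * h (J + k))) ⟨
      w * a * ∑ (suc o) (λ k → σ (J + k) * h (J + k))
        ≡⟨ ∑-scale (suc o) (w * a) _ ⟨
      ∑ (suc o) (λ k → w * a * (σ (J + k) * h (J + k)))
        ≡⟨ ∑-cong (suc o) (λ k _ → sym (*-assoc (w * a) (σ (J + k)) (h (J + k)))) ⟩
      ∑ (suc o) (λ k → α (j + k) * h (J + k)) ∎
    where
    open ≤-Reasoning
    j+o : 2 + j + o ≡ K
    j+o = trans (cong suc (trans (sym (+-suc j o)) e)) K≡
    open Core j o j+o
    split : ∀ x u y v h → (x * u + y * v) * h ≡ x * (u * h) + y * (v * h)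
    split = solve-∀
    eq₁ : ∀ w b S R → w * b * (S + 0) + R ≡ w * (S * b) + R
    eq₁ = solve-∀
    eq₂ : ∀ w c h a R → w * (c + h * a) + R ≡ w * c + R + w * a * h
    eq₂ = solve-∀
    eq₃ : ∀ w a x h → w * (a * x) + w * a * h ≡ w * a * (x + h)
    eq₃ = solve-∀

  Y0 = ∑ T (λ t → σ (1 + t) * y (2 + t))
  Y1 = ∑ T (λ t → σ (2 + t) * y (2 + t))
  Y2 = ∑ T′ (λ t → σ (3 + t) * y (2 + t))

  -- Y0, Y1 and Y2 pair y(k) with σ(k-1), σ(k) and σ(k+1). In the recurrences below Y2 bounds p(n+1)
  -- from above and Y1 is bounded by the smaller values of p; the Y0 term is the surplus.
  abel : w * b * Y2 + a * b * Y0 ≤ w * a * Y1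
  abel = begin
    w * b * Y2 + a * b * Y0
      ≡⟨ cong (λ x → w * b * x + a * b * Y0) Y2-eq ⟩
    w * b * ∑ T (λ t → u (3 + t) * y (2 + t)) + a * b * Y0
      ≡⟨ trans (∑-add T _ _) (cong₂ _+_ (∑-scale T (w * b) _) (∑-scale T (a * b) _)) ⟨
    ∑ T (λ t → w * b * (u (3 + t) * y (2 + t)) + a * b * (σ (1 + t) * y (2 + t)))
      ≡⟨ ∑-cong T (λ t _ → split (w * b) (u (3 + t)) (a * b) (σ (1 + t)) (y (2 + t))) ⟨
    ∑ T (λ t → β t * y (2 + t))
      ≤⟨ abel-suffix T α β (λ t → h (2 + t)) (λ t → y (2 + t)) h-pos y-mono suffix ⟩
    ∑ T (λ t → α t * y (2 + t))
      ≡⟨ trans (∑-cong T λ t _ → *-assoc (w * a) (σ (2 + t)) (y (2 + t))) (∑-scale T (w * a) _) ⟩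
    w * a * Y1 ∎
    where
    open ≤-Reasoning
    split : ∀ x u y v h → (x * u + y * v) * h ≡ x * (u * h) + y * (v * h)
    split = solve-∀
    Y2-eq : Y2 ≡ ∑ T (λ t → u (3 + t) * y (2 + t))
    Y2-eq = trans (sym (+-identityʳ Y2)) (cong₂ _+_
      (∑-cong T′ λ t t<T′ → cong (_* y (2 + t)) (sym (u-in (≤-trans (s≤s (s≤s t<T′)) (≤-reflexive K≡)))))
      (cong (_* y (2 + T′)) (sym (trans (cong (u ∘ suc) K≡) u-out))))

  head-1 : ∀ N (f : ℕ → ℕ) → ∑ (suc N) (λ k → σ (suc k) * f k) ≡ f 0 + ∑ N (λ k → σ (2 + k) * f (suc k))
  head-1 N f = trans (∑-head N _) (cong (_+ ∑ N (λ k → σ (2 + k) * f (suc k))) (*-identityˡ (f 0)))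

  head-2 : ∀ N (f : ℕ → ℕ) → ∑ (2 + N) (λ k → σ (suc k) * f k) ≡ f 0 + (3 * f 1 + ∑ N (λ k → σ (3 + k) * f (2 + k)))
  head-2 N f = trans (head-1 (suc N) f) (cong (f 0 +_) (∑-head N _))

  -- h₁ times the recurrence for n + 1, less b times the one for n. The leading terms, with σ(1) = 1
  -- and σ(2) = 3, are split off, and the two products 3 b h₁ cancel.
  next-bound : h₁ * (suc n * a′) + b * b ≤ h₁ * a + h₁ * θ + Y2 + n * a * b
  next-bound = ≤-by 0 (+-mono-≤ (+-mono-≤ (*-monoʳ-≤ h₁ top) (≤-reflexive (sym ratio))) (*-monoˡ-≤ b bottom))
      (lem h₁ (suc n * a′) b a θ Y2 (n * a) (∑ T′ (λ t → σ (3 + t) * q (2 + t))) (∑ T′ (λ t → σ (3 + t) * h (2 + t))))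
    where
    A2 = ∑ T′ (λ t → σ (3 + t) * q (2 + t))
    B2 = ∑ T′ (λ t → σ (3 + t) * h (2 + t))
    ratio : Y2 + B2 * b ≡ A2 * h₁
    ratio = ∑-ratio T′ (λ t → σ (3 + t)) (λ t → y (2 + t)) (λ t → h (2 + t)) (λ t → q (2 + t)) b h₁ (λ t t<T′ → y-eq t (<-trans t<T′ (n<1+n T′)))
    top : suc n * a′ ≤ a + (3 * b + A2) + θ
    top = begin
      suc n * a′                                       ≡⟨ σ-recurrence′ (suc n) ⟩
      ∑ (suc n) (λ k → σ (suc k) * q k)                ≤⟨ cut-tail K (suc n) (σ ∘ suc) q (≤-trans K≤n (n≤1+n n)) (≤-reflexive (+-∸-assoc 1 K≤n)) (λ k k<n → σ≤ (suc k) k<n) (λ i → ≤-refl) ⟩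
      ∑ K (λ k → σ (suc k) * q k) + θ                  ≡⟨ cong (λ x → ∑ x (λ k → σ (suc k) * q k) + θ) K≡ ⟨
      ∑ (2 + T′) (λ k → σ (suc k) * q k) + θ           ≡⟨ cong (_+ θ) (head-2 T′ q) ⟩
      a + (3 * b + A2) + θ                             ∎
      where open ≤-Reasoning
    bottom : b + (3 * h₁ + B2) ≤ n * a
    bottom = ≤-trans (+-monoʳ-≤ b (+-monoʳ-≤ (3 * h₁) (∑-longer (λ t → σ (3 + t) * h (2 + t)) (≤-trans (n≤1+n T′) T≤z)))) (≤-reflexive (sym (trans rec-n (head-2 z (q ∘ suc)))))
    lem : ∀ h₁ x b a θ Y na A B → h₁ * x + b * b + (h₁ * (a + (3 * b + A) + θ) + (Y + B * b) + na * b) + 0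
      ≡ h₁ * a + h₁ * θ + Y + na * b + (h₁ * x + A * h₁ + (b + (3 * h₁ + B)) * b)
    lem = solve-∀

  -- b times the recurrence for n - 1 against h₁ times the one for n; the terms with σ(1) are both b
  -- h₁ and cancel.
  Y1-bound : Y1 + M * b * b ≤ n * a * h₁ + b * θ
  Y1-bound = ≤-by 0 (+-mono-≤ (+-mono-≤ (*-monoˡ-≤ b top) (≤-reflexive ratio)) (*-monoˡ-≤ h₁ bottom))
      (lem Y1 (M * b) b (n * a) h₁ θ A1 B1)
    where
    A1 = ∑ T (λ t → σ (2 + t) * q (2 + t))
    B1 = ∑ T (λ t → σ (2 + t) * h (2 + t))
    ratio : Y1 + B1 * b ≡ A1 * h₁
    ratio = ∑-ratio T (λ t → σ (2 + t)) (λ t → y (2 + t)) (λ t → h (2 + t)) (λ t → q (2 + t)) b h₁ y-eq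
    top : M * b ≤ h₁ + (B1 + θ)
    top = begin
      M * b                                            ≡⟨ trans rec-M (head-1 z (h ∘ suc)) ⟩
      h₁ + ∑ z (λ t → σ (2 + t) * h (2 + t))
        ≤⟨ +-monoʳ-≤ h₁ (cut-tail T z (λ t → σ (2 + t)) (λ t → h (2 + t)) T≤z len (λ k k<z → σ≤ (2 + k) (≤-trans (s≤s k<z) (≤-trans (n≤1+n M) (n≤1+n n)))) shrink) ⟩
      h₁ + (B1 + θ)                                    ∎
      where
      open ≤-Reasoning
      len : z ∸ T ≤ suc z′
      len = ≤-trans (∸-monoʳ-≤ z (n≤1+n T′)) (≤-trans (≤-reflexive (cong (n ∸_) K≡)) (n≤1+n z′))
      shrink : ∀ i → h (2 + (T + i)) ≤ q (K + i)
      shrink i = ≤-trans (q-antitone (2 + (T + i))) (≤-trans (q-antitone (suc (T + i))) (≤-reflexive (cong (λ x → q (x + i)) K≡)))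
    bottom : b + A1 ≤ n * a
    bottom = ≤-trans (+-monoʳ-≤ b (∑-longer (λ t → σ (2 + t) * q (2 + t)) (≤-trans T≤z (n≤1+n z)))) (≤-reflexive (sym (trans rec-n (head-1 M (q ∘ suc)))))
    lem : ∀ Y Mb b na h₁ θ A B → Y + Mb * b + ((h₁ + (B + θ)) * b + A * h₁ + na * h₁) + 0
      ≡ na * h₁ + b * θ + (Mb * b + (Y + B * b) + (b + A) * h₁)
    lem = solve-∀

  -- h₁ times the recurrence for n - 1 against b times the one for n - 2: the left sides differ by
  -- exactly b h₁.
  Y0-bound : b * h₁ ≤ Y0 + θ * h₁
  Y0-bound = ≤-by 0 (+-mono-≤ (+-mono-≤ (*-monoˡ-≤ h₁ top) (≤-reflexive (sym ratio))) (*-monoˡ-≤ b bottom))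
      (lem b h₁ Y0 θ A0 B0 z)
    where
    A0 = ∑ T (λ t → σ (1 + t) * q (2 + t))
    B0 = ∑ T (λ t → σ (1 + t) * h (2 + t))
    ratio : Y0 + B0 * b ≡ A0 * h₁
    ratio = ∑-ratio T (λ t → σ (1 + t)) (λ t → y (2 + t)) (λ t → h (2 + t)) (λ t → q (2 + t)) b h₁ y-eq
    top : M * b ≤ A0 + θ
    top = ≤-trans (≤-reflexive rec-M) (cut-tail T M (σ ∘ suc) (h ∘ suc) (≤-trans T≤z (n≤1+n z)) (≤-trans (≤-reflexive (cong (n ∸_) K≡)) (n≤1+n z′))
      (λ k k<M → σ≤ (suc k) (≤-trans k<M (≤-trans (n≤1+n M) (n≤1+n n)))) (λ i → ≤-trans (q-antitone (suc (T + i))) (≤-reflexive (cong (λ x → q (x + i)) K≡))))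
    bottom : B0 ≤ z * h₁
    bottom = ≤-trans (∑-longer (λ t → σ (1 + t) * h (2 + t)) T≤z) (≤-reflexive (sym rec-z))
    lem : ∀ b h₁ Y θ A B z → b * h₁ + ((A + θ) * h₁ + (Y + B * b) + z * h₁ * b) + 0
      ≡ Y + θ * h₁ + ((1 + z) * b * h₁ + A * h₁ + B * b)
    lem = solve-∀

  step : a′ * b < a * a
  step = go (a * a ≤? a′ * b)
    where
    go : Dec (a * a ≤ a′ * b) → a′ * b < a * a
    go (no ≰)  = ≰⇒> ≰
    go (yes a²≤) = ⊥-elim (<-irrefl refl (<-≤-trans (<-≤-trans (s≤s final-bound) small) (≤-trans scaled (≤-reflexive refl))))
      where
      first : suc n * (a * a) * h₁ + b * b * b ≤ b * (h₁ * a + h₁ * θ + Y2 + n * a * b)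
      first = ≤-by 0 (+-mono-≤ (*-monoʳ-≤ b next-bound) (*-monoˡ-≤ (suc n * h₁) a²≤)) (lem (suc n) a h₁ b θ Y2 (n * a * b) a′)
        where lem : ∀ m a h b θ Y r a′ → m * (a * a) * h + b * b * b + (b * (h * a + h * θ + Y + r) + a′ * b * (m * h)) + 0
                      ≡ b * (h * a + h * θ + Y + r) + (b * (h * (m * a′) + b * b) + a * a * (m * h))
              lem = solve-∀
      -- Y2 is traded for Y1 by `abel`, then Y1 and Y0 are eliminated. Up to θ this reads a b² ≤ 6 n
      -- d (b² - a h₁).
      combined : 6 * n * (a * a * h₁ + b * b * b) + a * b * b ≤ 6 * n * (a * b * h₁ + a * b * b + b * h₁ * θ + a * b * θ) + a * b * θ
      combined = *-cancelʳ-≤ _ _ h₁ (≤-by (0) (+-mono-≤ (*-monoʳ-≤ w first) (+-mono-≤ abel (+-mono-≤ (*-monoʳ-≤ (w * a) Y1-bound) (*-monoʳ-≤ (a * b) Y0-bound))))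
          (lem M a h₁ b θ Y0 Y1 Y2))
        where lem : ∀ M a g b θ Y0 Y1 Y2 → (6 * (1 + M) * (a * a * g + b * b * b) + a * b * b) * g + (6 * ((1 + M) * g) * (b * (g * a + g * θ + Y2 + (1 + M) * a * b)) + (6 * ((1 + M) * g) * a * Y1 + (6 * ((1 + M) * g) * a * ((1 + M) * a * g + b * θ) + a * b * (Y0 + θ * g)))) + (0)
                    ≡ (6 * (1 + M) * (a * b * g + a * b * b + b * g * θ + a * b * θ) + a * b * θ) * g + (6 * ((1 + M) * g) * ((1 + (1 + M)) * (a * a) * g + b * b * b) + (6 * ((1 + M) * g) * b * Y2 + a * b * Y0 + (6 * ((1 + M) * g) * a * (Y1 + M * b * b) + a * b * (b * g))))
              lem = solve-∀
      -- y is nonnegative, so `Y1-bound` also gives n (b² - a h₁) ≤ b² + b θ, which removes the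
      -- large factor n from the loss.
      expanded : a * b * b ≤ (6 * (d * b) + 6 * (d * θ) + 6 * (n * (h₁ + a) * θ) + a * θ) * b
      expanded = subst (λ x → x * b * b ≤ (6 * (d * b) + 6 * (d * θ) + 6 * (n * (h₁ + x) * θ) + x * θ) * b) b+d
          (≤-by (0) (+-mono-≤ (subst (λ x → 6 * n * (x * x * h₁ + b * b * b) + x * b * b ≤ 6 * n * (x * b * h₁ + x * b * b + b * h₁ * θ + x * b * θ) + x * b * θ) (sym b+d) combined)
                              (*-monoʳ-≤ (6 * d) (subst (λ x → M * b * b ≤ n * x * h₁ + b * θ) (sym b+d) (≤-trans (m≤n+m _ Y1) Y1-bound))))
            (lem M b d h₁ θ))
        where lem : ∀ M b d g θ → (b + d) * b * b + (6 * (1 + M) * ((b + d) * b * g + (b + d) * b * b + b * g * θ + (b + d) * b * θ) + (b + d) * b * θ + 6 * d * ((1 + M) * (b + d) * g + b * θ)) + (0)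
                    ≡ (6 * (d * b) + 6 * (d * θ) + 6 * ((1 + M) * (g + (b + d)) * θ) + (b + d) * θ) * b + (6 * (1 + M) * ((b + d) * (b + d) * g + b * b * b) + (b + d) * b * b + 6 * d * (M * b * b))
              lem = solve-∀
      -- d ≤ 2b/s and s ≥ 128 give 6 d ≤ (3/32) b, so 29/32 of a b has to be covered by θ alone.
      final-bound : 29 * b ≤ 32 * (θ * (12 * n + 7))
      final-bound = *-cancelʳ-≤ _ _ (4 * a) ⦃ m*n≢0 4 a ⦄ (≤-by (0) (+-mono-≤ (*-monoˡ-≤ 128 (*-cancelʳ-≤ (a * b) (6 * (d * b) + 6 * (d * θ) + 6 * (n * (h₁ + a) * θ) + a * θ) b expanded))
          (+-mono-≤ (*-monoˡ-≤ (768 * θ) (m∸n≤m a b)) (+-mono-≤ (*-monoˡ-≤ (768 * (n * θ)) (≤-trans (p-mono-step z) (p-mono-step M)))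
            (+-mono-≤ (*-monoˡ-≤ (6 * (d * b)) s≥) (+-mono-≤ (*-monoˡ-≤ (6 * b) d-upper) (*-monoˡ-≤ (12 * b) (p-mono-step M)))))))
          (lem n b a θ d h₁ s))
        where lem : ∀ n b a θ d g s → 29 * b * (4 * a) + ((6 * (d * b) + 6 * (d * θ) + 6 * (n * (g + a) * θ) + a * θ) * 128 + (a * (768 * θ) + (a * (768 * (n * θ)) + (s * (6 * (d * b)) + (2 * b * (6 * b) + a * (12 * b)))))) + (0)
                    ≡ 32 * (θ * (12 * n + 7)) * (4 * a) + (a * b * 128 + (d * (768 * θ) + (g * (768 * (n * θ)) + (128 * (6 * (d * b)) + (s * d * (6 * b) + b * (12 * b))))))
              lem = solve-∀
      -- The leading term is 48 s⁴, and 58 = 2 · 29 matches 29 times the bound 2 s⁶ p(n-K) ≤ b. The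
      -- power s⁶ in `growth` is the size of n θ / p(n-K), up to a constant.
      quartic : 4 * ((12 * n + 7) * suc n) < 58 * (s * s * (s * s))
      quartic = ≤-trans (s≤s (*-monoʳ-≤ 4 (*-mono-≤ (+-monoˡ-≤ 7 (*-monoʳ-≤ 12 n≤)) (s≤s n≤))))
          (≤-by (s * s * s * 1080 + s * s * 745 + s * 1255 + 99) (+-mono-≤ (*-monoˡ-≤ (10 * (s * s)) s·128≤s²) (+-mono-≤ (*-monoˡ-≤ (8 * s) s·128≤s²) (+-mono-≤ (+-mono-≤ (*-monoˡ-≤ 6 s·128≤s²) (*-monoˡ-≤ (5 * s) s≥)) s≥))) (lem s))
        where lem : ∀ s → 1 + 4 * ((12 * (s * s + 2 * s) + 7) * (1 + (s * s + 2 * s))) + (s * s * (10 * (s * s)) + (s * s * (8 * s) + (s * s * 6 + s * (5 * s) + s))) + (s * s * s * 1080 + s * s * 745 + s * 1255 + 99)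
                    ≡ 58 * (s * s * (s * s)) + (s * 128 * (10 * (s * s)) + (s * 128 * (8 * s) + (s * 128 * 6 + 128 * (5 * s) + 128)))
              lem = solve-∀
      small : suc (32 * (θ * (12 * n + 7))) ≤ 58 * (s * s * (s * s)) * (s * s * pz)
      small = begin
        suc (32 * (θ * (12 * n + 7)))                       ≡⟨ cong suc (eq₁ θ (12 * n + 7)) ⟩
        suc (8 * θ * (4 * (12 * n + 7)))                    ≤⟨ s≤s (*-monoˡ-≤ (4 * (12 * n + 7)) 8θ≤) ⟩
        suc (suc n * (s * s) * pz * (4 * (12 * n + 7)))     ≡⟨ cong suc (eq₂ (suc n) (s * s) pz (12 * n + 7)) ⟩
        suc (4 * ((12 * n + 7) * suc n) * (s * s * pz))     ≤⟨ *-monoˡ-< (s * s * pz) ⦃ m*n≢0 (s * s) pz ⦃ m*n≢0 s s ⦃ >-nonZero s>0 ⦄ ⦃ >-nonZero s>0 ⦄ ⦄ ⦄ quartic ⟩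
        58 * (s * s * (s * s)) * (s * s * pz)               ∎
        where
        open ≤-Reasoning
        eq₁ : ∀ θ x → 32 * (θ * x) ≡ 8 * θ * (4 * x)
        eq₁ = solve-∀
        eq₂ : ∀ m t p x → m * t * p * (4 * x) ≡ 4 * (x * m) * (t * p)
        eq₂ = solve-∀
      scaled : 58 * (s * s * (s * s)) * (s * s * pz) ≤ 29 * b
      scaled = ≤-trans (≤-reflexive (eq (s * s) pz)) (*-monoʳ-≤ 29 growth′)
        where eq : ∀ t p → 58 * (t * t) * (t * p) ≡ 29 * (t * t * t * p * 2)
              eq = solve-∀

-- Choice of s and L

isqrt : ∀ n → ∃ λ s → s * s ≤ n × n ≤ s * s + 2 * s
isqrt zero = 0 , z≤n , z≤n
isqrt (suc n) with isqrt n
... | s , s²≤n , n≤ with suc n ≤? s * s + 2 * s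
...   | yes sn≤ = s , m≤n⇒m≤1+n s²≤n , sn≤
...   | no sn≰  = suc s , ≤-trans (≤-reflexive (lem s)) (≰⇒> sn≰) , ≤-by (s * 2 + 2) n≤ (lem′ s n)
  where lem : ∀ s → (1 + s) * (1 + s) ≡ 1 + (s * s + 2 * s)
        lem = solve-∀
        lem′ : ∀ s n → 1 + n + (s * s + 2 * s) + (s * 2 + 2) ≡ (1 + s) * (1 + s) + 2 * (1 + s) + n
        lem′ = solve-∀

square-below-power : ∀ t → (8 * (t + 16) + 9) * (8 * (t + 16) + 9) ≤ 2 ^ (t + 16)
square-below-power zero    = toWitness {a? = 137 * 137 ≤? 2 ^ 16} tt
square-below-power (suc t) = ≤-trans (≤-by (t * t * 64 + t * 2064 + 16513) (z≤n {0}) (lem t)) (*-monoʳ-≤ 2 (square-below-power t))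
  where lem : ∀ t → (8 * (1 + (t + 16)) + 9) * (8 * (1 + (t + 16)) + 9) + 0 + (t * t * 64 + t * 2064 + 16513) ≡ 2 * ((8 * (t + 16) + 9) * (8 * (t + 16) + 9)) + 0
        lem = solve-∀

-- With s = t + 128, L starts at 16 and is raised only when (s + 1)² reaches 2^L. If then s < 8 (L +
-- 1), also (8 L + 9)² would exceed 2^L, against `square-below-power`.
log-size : ∀ t → ∃ λ L → 16 ≤ L × 8 * L ≤ t + 128 × (t + 129) * (t + 129) < 2 ^ L
log-size zero = 16 , ≤-refl , ≤-refl , toWitness {a? = 129 * 129 <? 2 ^ 16} tt
log-size (suc t) with log-size t
... | L , 16≤L , 8L≤ , sq< with (suc t + 129) * (suc t + 129) <? 2 ^ L
...   | yes sq<′ = L , 16≤L , m≤n⇒m≤1+n 8L≤ , sq<′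
...   | no sq≮   = suc L , m≤n⇒m≤1+n 16≤L , 8L′≤ (suc t + 128 ≤? 8 * L + 7) , bigger
  where
  bigger : (suc t + 129) * (suc t + 129) < 2 * 2 ^ L
  bigger = <-≤-trans (≤-<-trans (≤-by (t * t + t * 256 + 16382) (z≤n {0}) (lem t)) (*-monoʳ-< 2 sq<)) ≤-refl
    where lem : ∀ t → (1 + t + 129) * (1 + t + 129) + 0 + (t * t + t * 256 + 16382) ≡ 2 * ((t + 129) * (t + 129)) + 0
          lem = solve-∀
  8L′≤ : Dec (suc t + 128 ≤ 8 * L + 7) → 8 * suc L ≤ suc t + 128
  8L′≤ (no gt)  = ≤-trans (≤-reflexive (lem L)) (≰⇒> gt)
    where lem : ∀ L → 8 * (1 + L) ≡ 1 + (8 * L + 7)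
          lem = solve-∀
  8L′≤ (yes le) = ⊥-elim (sq≮ (<-≤-trans (*-mono-< small small) (subst (λ l → (8 * l + 9) * (8 * l + 9) ≤ 2 ^ l) (m∸n+n≡m 16≤L) (square-below-power (L ∸ 16)))))
    where small : suc t + 129 < 8 * L + 9
          small = ≤-by 0 le (lem t L)
            where lem : ∀ t L → 1 + (1 + t + 129) + (8 * L + 7) + 0 ≡ 8 * L + 9 + (1 + t + 128)
                  lem = solve-∀

large-step : ∀ m → 16384 ≤ 1 + m → LC (1 + m) → LogConcaveAt 𝕡 m
large-step zero    (s≤s ()) lc
large-step (suc z) n≥ lc = go (isqrt (2 + z))
  where
  n = 2 + z
  go : (∃ λ s → s * s ≤ n × n ≤ s * s + 2 * s) → LogConcaveAt 𝕡 (suc z)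
  go (s , s²≤n , n≤) = go′ (subst (λ w → ∃ λ L → 16 ≤ L × 8 * L ≤ w × suc w * suc w < 2 ^ L) (m∸n+n≡m s≥) (shift (log-size (s ∸ 128))))
    where
    s≥ : 128 ≤ s
    s≥ = ≮⇒≥ λ s<128 → <⇒≱ (≤-<-trans (≤-trans n≤ (+-mono-≤ (*-mono-≤ (s≤s⁻¹ s<128) (s≤s⁻¹ s<128)) (*-monoʳ-≤ 2 (s≤s⁻¹ s<128)))) (n<1+n 16383)) n≥
    shift : ∀ {t} → (∃ λ L → 16 ≤ L × 8 * L ≤ t + 128 × (t + 129) * (t + 129) < 2 ^ L) →
      ∃ λ L → 16 ≤ L × 8 * L ≤ t + 128 × suc (t + 128) * suc (t + 128) < 2 ^ L
    shift {t} (L , a , b , c) = L , a , b , subst (λ w → w * w < 2 ^ L) (+-suc t 128) c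
    go′ : (∃ λ L → 16 ≤ L × 8 * L ≤ s × suc s * suc s < 2 ^ L) → LogConcaveAt 𝕡 (suc z)
    go′ (L , _ , 8L≤s , sq<) = Step.step z s L (n / 4) s≥ s²≤n n≤ 8L≤s
      (≤-<-trans (≤-trans (s≤s n≤) (≤-reflexive (lem s))) sq<)
      (≤-trans (≤-reflexive (*-comm 4 (n / 4))) (m/n*n≤m n 4))
      (≤-trans (/-next n 3) (≤-reflexive (lem₁ (n / 4))))
      lc (n / 4 ∸ 2) (m+[n∸m]≡n 2≤K)
      where
      lem : ∀ s → 1 + (s * s + 2 * s) ≡ (1 + s) * (1 + s)
      lem = solve-∀
      lem₁ : ∀ k → (1 + k) * 4 ≡ 4 * k + 4
      lem₁ = solve-∀
      2≤K : 2 ≤ n / 4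
      2≤K = ≤-trans (m≤m+n 2 4094) (/-monoˡ-≤ 4 n≥)

log-concave-from : ∀ m → 26 ≤ m → LC (1 + m) → LogConcaveAt 𝕡 m
log-concave-from m 26≤m lc with 16384 ≤? 1 + m
... | yes large = large-step m large lc
... | no ≰      = subst (LogConcaveAt 𝕡) (m+[n∸m]≡n 26≤m) (log-concave-below (m ∸ 26)
  (+-cancelˡ-< 27 (m ∸ 26) 16357 (≤-trans (s≤s (≤-reflexive (cong suc (m+[n∸m]≡n 26≤m)))) (≰⇒> ≰))))

-- Decrease of all ratios, and the theorem

lc-all : ∀ n → LC n
-- The new ratio p(n+1)/p(n) is below its predecessor by log-concavity at n, and the predecessor is
-- already below the earlier ratios. The chain starts from the table at n = 26.
lc-extend : ∀ n → LC n → ∀ i → 1 ≤ i → i ≤ n → 26 ≤ n → 𝕡 (suc n) * 𝕡 i ≤ 𝕡 (suc i) * 𝕡 n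
lc-extend n lc (suc i) 1≤i i≤n 26≤n with 26 ≟ n
... | yes refl = base-ratio i i≤n
... | no 26≢n with suc i ≟ n
...   | yes refl = ≤-refl
...   | no i≢n with n | ≤∧≢⇒< 26≤n 26≢n | ≤∧≢⇒< i≤n i≢n
...     | suc j | s≤s 26≤j | s≤s i≤j = *-cancelʳ-≤ _ _ (𝕡 j)
  (≤-by 0 (+-mono-≤ (*-monoˡ-≤ (𝕡 (suc i)) (<⇒≤ (log-concave-from j 26≤j lc))) (*-monoˡ-≤ (𝕡 (suc j)) (lc (suc i) j 1≤i i≤j 26≤j ≤-refl)))
    (lem (𝕡 (2 + j)) (𝕡 (suc i)) (𝕡 j) (𝕡 (suc j)) (𝕡 (2 + i))))
  where lem : ∀ c i b a i′ → c * i * b + (a * a * i + i′ * b * a) + 0 ≡ i′ * a * b + (c * b * i + a * i * a)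
        lem = solve-∀
lc-all (suc n) i j 1≤i i≤j 26≤j (s≤s j≤n) with m≤n⇒m<n∨m≡n j≤n
... | inj₁ j<n  = lc-all n i j 1≤i i≤j 26≤j j<n
... | inj₂ refl = lc-extend n (lc-all n) i 1≤i i≤j 26≤j

log-concave : ∀ m → 26 ≤ m → LogConcaveAt 𝕡 m
log-concave m 26≤m = log-concave-from m 26≤m (lc-all (1 + m))

ratio-chain : ∀ k i j → 1 ≤ i → i ≤ j → 26 ≤ j → 𝕡 (j + k) * 𝕡 i ≤ 𝕡 (i + k) * 𝕡 j
ratio-chain zero    i j _ _ _ = ≤-reflexive (trans (cong (λ x → 𝕡 x * 𝕡 i) (+-identityʳ j)) (trans (*-comm (𝕡 j) (𝕡 i)) (cong (λ x → 𝕡 x * 𝕡 j) (sym (+-identityʳ i)))))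
ratio-chain (suc k) i j 1≤i i≤j 26≤j = subst₂ (λ x y → 𝕡 x * 𝕡 i ≤ 𝕡 y * 𝕡 j) (sym (+-suc j k)) (sym (+-suc i k))
  (*-cancelʳ-≤ _ _ (𝕡 (suc j)) (*-cancelʳ-≤ _ _ (𝕡 (suc i)) (≤-trans (≤-reflexive (lem (𝕡 (suc j + k)) (𝕡 i) (𝕡 (suc j)) (𝕡 (suc i))))
    (≤-trans (*-mono-≤ (ratio-chain k (suc i) (suc j) (s≤s z≤n) (s≤s i≤j) (m≤n⇒m≤1+n 26≤j)) (lc-all (suc j) i j 1≤i i≤j 26≤j ≤-refl))
      (≤-reflexive (lem′ (𝕡 (suc i + k)) (𝕡 (suc j)) (𝕡 (suc i)) (𝕡 j)))))))
  where
  lem : ∀ x i a b → x * i * a * b ≡ x * b * (a * i)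
  lem = solve-∀
  lem′ : ∀ y a b j → y * a * (b * j) ≡ y * j * a * b
  lem′ = solve-∀

-- With n = x + k + 1, the k + 1 ratios leading from n to n + k + 1 are compared with those from x
-- to n. One strict comparison is enough: p(n+1)/p(n) < p(n)/p(n-1) ≤ p(x+1)/p(x), by log-concavity
-- at n. The other k come from `ratio-chain`.
strict-above : ∀ x k → 1 ≤ x → 27 ≤ x + suc k → 𝕡 x * 𝕡 (x + suc k + suc k) < 𝕡 (x + suc k) * 𝕡 (x + suc k)
strict-above x k 1≤x 27≤n = *-cancelʳ-< (𝕡 (suc n)) _ _ (*-cancelʳ-< (𝕡 (suc x)) _ _ (≤-<-trans (≤-reflexive (lem (𝕡 x) (𝕡 (n + suc k)) (𝕡 (suc n)) (𝕡 (suc x))))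
    (<-≤-trans (*-mono-<-≤ first rest) (≤-reflexive (lem′ (𝕡 (suc x)) (𝕡 n) (𝕡 (suc n)))))))
  where
  n = x + suc k
  m = x + k
  n≡ : suc m ≡ n
  n≡ = sym (+-suc x k)
  26≤m : 26 ≤ m
  26≤m = s≤s⁻¹ (≤-trans 27≤n (≤-reflexive (sym n≡)))
  first : 𝕡 (suc n) * 𝕡 x < 𝕡 (suc x) * 𝕡 n
  first = subst (λ w → 𝕡 (suc w) * 𝕡 x < 𝕡 (suc x) * 𝕡 w) n≡ (*-cancelʳ-< (𝕡 m) _ _ (begin-strict
    𝕡 (2 + m) * 𝕡 x * 𝕡 m               ≡⟨ lem₁ (𝕡 (2 + m)) (𝕡 x) (𝕡 m) ⟩
    𝕡 (2 + m) * 𝕡 m * 𝕡 x               <⟨ *-monoˡ-< (𝕡 x) (log-concave m 26≤m) ⟩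
    𝕡 (1 + m) * 𝕡 (1 + m) * 𝕡 x         ≡⟨ *-assoc (𝕡 (1 + m)) (𝕡 (1 + m)) (𝕡 x) ⟩
    𝕡 (1 + m) * (𝕡 (1 + m) * 𝕡 x)       ≤⟨ *-monoʳ-≤ (𝕡 (1 + m)) (lc-all (suc m) x m 1≤x (m≤m+n x k) 26≤m ≤-refl) ⟩
    𝕡 (1 + m) * (𝕡 (suc x) * 𝕡 m)       ≡⟨ lem₂ (𝕡 (1 + m)) (𝕡 (suc x)) (𝕡 m) ⟩
    𝕡 (suc x) * 𝕡 (1 + m) * 𝕡 m         ∎))
    where open ≤-Reasoning
          lem₁ : ∀ a b c → a * b * c ≡ a * c * b
          lem₁ = solve-∀
          lem₂ : ∀ a b c → a * (b * c) ≡ b * a * c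
          lem₂ = solve-∀
  rest : 𝕡 (n + suc k) * 𝕡 (suc x) ≤ 𝕡 n * 𝕡 (suc n)
  rest = subst₂ (λ u v → 𝕡 u * 𝕡 (suc x) ≤ 𝕡 v * 𝕡 (suc n)) (sym (+-suc n k)) n≡
    (ratio-chain k (suc x) (suc n) (s≤s z≤n) (s≤s (m≤m+n x (suc k))) (≤-trans (n≤1+n 26) (m≤n⇒m≤1+n 27≤n)))
  *-mono-<-≤ : ∀ {a b c d} → a < b → c ≤ d → .⦃ _ : NonZero d ⦄ → a * c < b * d
  *-mono-<-≤ {a} {b} {c} {d} a<b c≤d = ≤-<-trans (*-monoʳ-≤ a c≤d) (*-monoˡ-< d a<b)
  instance
    prod-nonZero : NonZero (𝕡 n * 𝕡 (suc n))
    prod-nonZero = m*n≢0 (𝕡 n) (𝕡 (suc n))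
  lem : ∀ x y a b → x * y * a * b ≡ (a * x) * (y * b)
  lem = solve-∀
  lem′ : ∀ b n a → b * n * (n * a) ≡ n * n * a * b
  lem′ = solve-∀

theorem-𝕡 : ∀ n m → 1 < m → m < n → 𝕡 (n ∸ m) * 𝕡 (n + m) < 𝕡 n * 𝕡 n
theorem-𝕡 n (suc k) 1<m m<n with 27 ≤? n
... | yes 27≤n = subst (λ w → 𝕡 (n ∸ suc k) * 𝕡 (w + suc k) < 𝕡 w * 𝕡 w) eq
      (strict-above (n ∸ suc k) k (m<n⇒0<n∸m m<n) (≤-trans 27≤n (≤-reflexive (sym eq))))
  where eq : n ∸ suc k + suc k ≡ n
        eq = m∸n+n≡m (<⇒≤ m<n)
... | no n≱27 = subst₂ _<_ (cong₂ _*_ (v (n ∸ suc k) (≤-<-trans (m∸n≤m n (suc k)) n<56)) (v (n + suc k) (<-≤-trans (+-mono-< n<27 (<-trans m<n n<27)) (m≤m+n 54 2)))) (cong₂ _*_ (v n n<56) (v n n<56))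
      (small-cases n<27 m<n 1<m)
  where
  n<27 : n < 27
  n<27 = ≰⇒> n≱27
  n<56 : n < 56
  n<56 = <-≤-trans n<27 (m≤m+n 27 29)
  v : ∀ i → i < 56 → value initial i ≡ 𝕡 i
  v = initial-value

theorem5p1 : ∀ (n m : ℕ) → 1 < m → m < n →
    p (n ∸ m) * p (n + m) < p n * p n
theorem5p1 n m 1<m m<n = subst₂ _<_ (cong₂ _*_ (𝕡-def (n ∸ m)) (𝕡-def (n + m))) (cong₂ _*_ (𝕡-def n) (𝕡-def n)) (theorem-𝕡 n m 1<m m<n)
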